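{- Let $G$ be a $2$-edge-connected graph which has a decomposition into a tree $T$ and a cycle $C$, where $C$ has $k \le 3$ components. Then $G$ has a CDC $\mathcal S$ with $C \in \mathcal S$. More precisely: (1) if $k \le 2$, then $G$ has a $5$-CDC $\mathcal S_2$ with $C \in \mathcal S_2$; (2) if $k = 3$, then $G$ has a $5$-CDC $\mathcal S_3$ with $C \in \mathcal S_3$ provided $G$ is not contractible to the Petersen graph; otherwise $G$ has a $6$-CDC $\mathcal S_3'$ with $C \in \mathcal S_3'$.
   Context: Graphs are finite and may have parallel edges. A cycle is a graph (here a subgraph of $G$) in which every vertex has even degree. A decomposition of $G$ is a set of edge-disjoint subgraphs whose edge sets cover $E(G)$. A cycle double cover (CDC) of $G$ is a set of cycles of $G$ such that every edge lies in the edge sets of exactly two of them; a $k$-CDC is a CDC consisting of $k$ cycles. "Contractible to the Petersen graph" means the Petersen graph can be obtained from $G$ by contracting edges. -}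

module Defs where

open import Data.Nat using (ℕ; zero; suc; _+_)
open import Data.Nat.Divisibility using (_∣_)
open import Data.Fin using (Fin; zero; suc; _≟_)
open import Data.Bool using (Bool; true; false; if_then_else_)
open import Data.Product using (Σ; ∃; _×_; _,_; proj₁; proj₂)
open import Data.Sum using (_⊎_)
open import Relation.Nullary using (¬_; does)
open import Relation.Binary.PropositionalEquality using (_≡_; _≢_)
open import Function.Definitions using (Injective)
open import Data.Fin using (#_)

record Graph : Set where
  field
    n    : ℕ
    m    : ℕ
    src  : Fin m → Fin n
    tgt  : Fin m → Fin n
    loopless : ∀ e → src e ≢ tgt e
open Graph public

-- A subgraph is given by its edge set.
EdgeSet : Graph → Set
EdgeSet G = Fin (m G) → Bool

sumFin : (k : ℕ) → (Fin k → ℕ) → ℕ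
sumFin zero    f = 0
sumFin (suc k) f = f zero + sumFin k (λ i → f (suc i))

⟦_⟧ : Bool → ℕ
⟦ b ⟧ = if b then 1 else 0

deg : (G : Graph) → EdgeSet G → Fin (n G) → ℕ
deg G S v = sumFin (m G) (λ e → if S e
  then ⟦ does (src G e ≟ v) ⟧ + ⟦ does (tgt G e ≟ v) ⟧ else 0)

IsCycle : (G : Graph) → EdgeSet G → Set
IsCycle G S = ∀ v → 2 ∣ deg G S v

Joins : (G : Graph) → Fin (m G) → Fin (n G) → Fin (n G) → Set
Joins G e u w = (src G e ≡ u × tgt G e ≡ w) ⊎ (src G e ≡ w × tgt G e ≡ u)

data Reach (G : Graph) (S : EdgeSet G) : Fin (n G) → Fin (n G) → Set where
  here : ∀ {u} → Reach G S u u
  step : ∀ {u w v} (e : Fin (m G)) → S e ≡ true → Joins G e u w →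
         Reach G S w v → Reach G S u v

everything : (G : Graph) → EdgeSet G
everything G e = true

without : (G : Graph) → Fin (m G) → EdgeSet G
without G e f = if does (e ≟ f) then false else true

Connected : Graph → Set
Connected G = ∀ u v → Reach G (everything G) u v

TwoEdgeConnected : Graph → Set
TwoEdgeConnected G = Connected G × (∀ e u v → Reach G (without G e) u v)

-- two edges of S lie in the same component of the subgraph S
EdgeConn : (G : Graph) → EdgeSet G → Fin (m G) → Fin (m G) → Set
EdgeConn G S e e' = Reach G S (src G e) (src G e')

HasComponents : (G : Graph) → EdgeSet G → ℕ → Set
HasComponents G S k = Σ ((e : Fin (m G)) → S e ≡ true → Fin k) λ f →
  (∀ j → ∃ λ e → Σ (S e ≡ true) λ p → f e p ≡ j) ×
  (∀ e e' (p : S e ≡ true) (p' : S e' ≡ true) →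
     (f e p ≡ f e' p' → EdgeConn G S e e') × (EdgeConn G S e e' → f e p ≡ f e' p'))

IsTree : (G : Graph) → EdgeSet G → Set
IsTree G T =
  (∀ e e' → T e ≡ true → T e' ≡ true → EdgeConn G T e e') ×
  (∀ (D : EdgeSet G) → (∀ e → D e ≡ true → T e ≡ true) → IsCycle G D →
     ∀ e → D e ≡ false)

Decomposition : (G : Graph) → EdgeSet G → EdgeSet G → Set
Decomposition G T C =
  (∀ e → T e ≡ true → C e ≡ false) × (∀ e → (T e ≡ true) ⊎ (C e ≡ true))

IsCDC : (G : Graph) (k : ℕ) → (Fin k → EdgeSet G) → Set
IsCDC G k S = (∀ i → IsCycle G (S i)) ×
  (∀ e → sumFin k (λ i → ⟦ S i e ⟧) ≡ 2)

HasCDCWith : (G : Graph) → ℕ → EdgeSet G → Set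
HasCDCWith G k C = Σ (Fin k → EdgeSet G) λ S →
  IsCDC G k S × ∃ λ i → ∀ e → S i e ≡ C e

-- Petersen graph: outer 5-cycle 0..4, spokes i—i+5, inner pentagram 5,7,9,6,8
petEdge : Fin 15 → Fin 10 × Fin 10
petEdge zero = (# 0 , # 1)
petEdge (suc zero) = (# 1 , # 2)
petEdge (suc (suc zero)) = (# 2 , # 3)
petEdge (suc (suc (suc zero))) = (# 3 , # 4)
petEdge (suc (suc (suc (suc zero)))) = (# 4 , # 0)
petEdge (suc (suc (suc (suc (suc zero))))) = (# 0 , # 5)
petEdge (suc (suc (suc (suc (suc (suc zero)))))) = (# 1 , # 6)
petEdge (suc (suc (suc (suc (suc (suc (suc zero))))))) = (# 2 , # 7)
petEdge (suc (suc (suc (suc (suc (suc (suc (suc zero)))))))) = (# 3 , # 8)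
petEdge (suc (suc (suc (suc (suc (suc (suc (suc (suc zero))))))))) = (# 4 , # 9)
petEdge (suc (suc (suc (suc (suc (suc (suc (suc (suc (suc zero)))))))))) = (# 5 , # 7)
petEdge (suc (suc (suc (suc (suc (suc (suc (suc (suc (suc (suc zero))))))))))) = (# 7 , # 9)
petEdge (suc (suc (suc (suc (suc (suc (suc (suc (suc (suc (suc (suc zero)))))))))))) = (# 9 , # 6)
petEdge (suc (suc (suc (suc (suc (suc (suc (suc (suc (suc (suc (suc (suc zero))))))))))))) = (# 6 , # 8)
petEdge (suc (suc (suc (suc (suc (suc (suc (suc (suc (suc (suc (suc (suc (suc zero)))))))))))))) = (# 8 , # 5)

-- Contracting edges of G yields the Petersen graph: there is a map φ of
-- V(G) onto V(P) whose fibres are connected by the edges inside them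
-- (these are exactly the contracted edges; any edge inside a fibre must be
-- contracted, otherwise a loop would remain), and the remaining edges
-- (between different fibres) correspond bijectively to the edges of P,
-- respecting ends.
ContractibleToPetersen : Graph → Set
ContractibleToPetersen G = Σ (Fin (n G) → Fin 10) λ φ →
  let inside : EdgeSet G
      inside e = does (φ (src G e) ≟ φ (tgt G e))
  in
  (∀ a → ∃ λ v → φ v ≡ a) ×
  (∀ u v → φ u ≡ φ v → Reach G inside u v) ×
  Σ (Fin 15 → Fin (m G)) λ g →
    Injective _≡_ _≡_ g ×
    (∀ j → (φ (src G (g j)) ≡ proj₁ (petEdge j) × φ (tgt G (g j)) ≡ proj₂ (petEdge j))
         ⊎ (φ (src G (g j)) ≡ proj₂ (petEdge j) × φ (tgt G (g j)) ≡ proj₁ (petEdge j))) ×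
    (∀ e → inside e ≡ false → ∃ λ j → g j ≡ e)

{-# OPTIONS --safe #-}
-- Colour the vertices of C by its components (at most three). Covering T twice and C once by N further cycles amounts to a
-- choice of N vertex sets α on C, each bounding a set of edges of C, such that these edge sets partition C and each side of a
-- tree edge meets exactly two of the α in an odd number of vertices. With N = 4 this is a nowhere-zero GF(2)²-flow of G/C:
-- a flow whose boundary on C is a lifts along Euler trails to g with values in GF(2)² on C, and the fourth degree of freedom,
-- the boundary of the product of the coordinates of g, bounds in T since trails pass vertices with a = 0 unchanged.
--
-- Since T is a tree, the flows of G/C are found by recursion over T rooted anywhere. The only data needed of a subtree are
-- the triples of colour sums its flows attain, up to GL(2,2), and 2-edge-connectedness says that both sides of each tree
-- edge share a colour. Only 185 states arise, and those that admit no flow come from a single tree: a centre with branches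
-- (i, (j, k)), which is the Petersen graph minus three independent vertices with no common neighbour. In that case contracting
-- the parts of the tree gives the Petersen graph, and a 5-cycle double cover of the Petersen graph tells which four of N = 5
-- labels to use around each component of C; the parity conditions on the three pieces at a component are met by adding a
-- constant to g, two of them by choice and the third by handshaking.
module Submission where

open import Defs
open import Data.Nat using (ℕ; zero; suc; _+_; _≤_; _<_; z≤n; s≤s; _≡ᵇ_)
open import Data.Nat.Properties using (+-comm; +-assoc; *-comm; ≤-trans; ≤-refl; ≤-reflexive; +-mono-≤; +-mono-<-≤; +-mono-≤-<; m≤m+n; m≤n+m; <⇒≱; ≡ᵇ⇒≡)
open import Data.Nat.Divisibility using (_∣_; divides)
open import Data.Bool using (Bool; true; false; if_then_else_; _∧_; _∨_; _xor_; not; T)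
open import Data.Bool.Properties using (xor-comm; xor-same; xor-identityʳ; ∧-distribˡ-xor; ∧-distribʳ-xor; ∧-zeroʳ; ∧-identityʳ; ∧-comm; ∧-assoc; ∨-zeroʳ; not-involutive)
import Data.Bool.Properties as 𝔹
open import Data.Bool.Solver using (module xor-∧-Solver)
open import Data.Fin using (Fin; zero; suc; _≟_; #_; inject≤; toℕ)
open import Data.Fin.Properties using (any?; all?; inject≤-injective; toℕ-inject≤; toℕ<n)
open import Data.Maybe using (Maybe; just; nothing)
open import Data.Maybe.Properties using (just-injective)
open import Data.List using (List; []; _∷_; _++_; map; foldr)
open import Data.List.Membership.Propositional using (_∈_)
open import Data.List.Membership.Propositional.Properties using (∈-++⁻)
import Data.List.Membership.DecPropositional as DecMembership
open import Data.List.Relation.Unary.Any using (here; there)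
open import Data.Vec using (Vec; []; _∷_; lookup; tabulate; replicate; zipWith)
import Data.Vec as Vec
open import Data.Vec.Properties using (lookup-zipWith; lookup∘tabulate; lookup-map; lookup-replicate)
open import Data.Product using (Σ; ∃; _×_; _,_; proj₁; proj₂)
open import Data.Sum using (_⊎_; inj₁; inj₂; [_,_]′)
open import Data.Unit using (⊤; tt)
open import Data.Empty using (⊥; ⊥-elim)
open import Function.Definitions using (Injective)
open import Relation.Nullary using (¬_; Dec; yes; no; does)
open import Relation.Nullary.Decidable using (dec-true; dec-false; toWitness; _→-dec_; _×-dec_; _⊎-dec_; ¬?)
open import Relation.Binary.PropositionalEquality using (_≡_; _≢_; refl; sym; trans; cong; cong₂; subst; subst₂; module ≡-Reasoning)
open xor-∧-Solver using (solve; _:+_; _:*_; _:=_; con)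

-- Sums over GF(2)

-- The product of the coordinates is the one choice of the free bit for which the four labels on `C`
-- become the indicators of the four values of the flow, hence a partition of `C`. In the Petersen
-- graph, which is cubic, a nowhere-zero flow over GF(2)² would be a 3-edge-colouring; this is why
-- an exception and a fifth label arise. The obstacle is to recognise the exceptional tree. Its
-- shape can be read only from its centre; rooted elsewhere, a failing tree shows no more than the
-- patterns attained by its limbs. The direction of the centre is betrayed by these: a limb
-- containing it attains every pattern of nonzero sum except those of the small limb opposite. The
-- root is moved along such limbs until none is left. The table of states serves in one direction: a
-- listed zero pattern is converted into a flow, and where it is missing, the shape read at the
-- centre is converted into a contraction and a cover.

δ : ∀ {k} → Fin k → Fin k → Bool
δ i j = does (i ≟ j)

δ-refl : ∀ {k} (i : Fin k) → δ i i ≡ true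
δ-refl i = dec-true (i ≟ i) refl

δ-≢ : ∀ {k} {i j : Fin k} → i ≢ j → δ i j ≡ false
δ-≢ {i = i} {j} i≢j = dec-false (i ≟ j) i≢j

δ-sound : ∀ {k} {i j : Fin k} → δ i j ≡ true → i ≡ j
δ-sound {i = i} {j} p with i ≟ j
... | yes q = q

true≢false : true ≢ false
true≢false ()

xor-interchange : ∀ a b c d → (a xor b) xor (c xor d) ≡ (a xor c) xor (b xor d)
xor-interchange = solve 4 (λ a b c d → (a :+ b) :+ (c :+ d) := (a :+ c) :+ (b :+ d)) refl

xor-telescope : ∀ a b c → (a xor b) xor (b xor c) ≡ a xor c
xor-telescope = solve 3 (λ a b c → (a :+ b) :+ (b :+ c) := a :+ c) refl

∧-split : ∀ {a b} → a ∧ b ≡ true → (a ≡ true) × (b ≡ true)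
∧-split {true} {true} _ = refl , refl

bit≤1 : ∀ b → ⟦ b ⟧ ≤ 1
bit≤1 false = z≤n
bit≤1 true  = ≤-refl

par : ℕ → Bool
par zero    = false
par (suc n) = not (par n)

par-+ : ∀ m n → par (m + n) ≡ par m xor par n
par-+ zero    n = refl
par-+ (suc m) n = trans (cong not (par-+ m n)) (helper (par m) (par n))
  where
  helper : ∀ a b → not (a xor b) ≡ not a xor b
  helper false b     = refl
  helper true  false = refl
  helper true  true  = refl

par-⟦⟧ : ∀ b → par ⟦ b ⟧ ≡ b
par-⟦⟧ false = refl
par-⟦⟧ true  = refl

abstract
  xsum : ∀ {k} → (Fin k → Bool) → Bool
  xsum {zero}  f = false
  xsum {suc k} f = f zero xor xsum (λ i → f (suc i))

  xsum-cong : ∀ {k} {f g : Fin k → Bool} → (∀ i → f i ≡ g i) → xsum f ≡ xsum g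
  xsum-cong {zero}  h = refl
  xsum-cong {suc k} h = cong₂ _xor_ (h zero) (xsum-cong (λ i → h (suc i)))

  xsum-zero : ∀ {k} {f : Fin k → Bool} → (∀ i → f i ≡ false) → xsum f ≡ false
  xsum-zero {zero}  h = refl
  xsum-zero {suc k} h = cong₂ _xor_ (h zero) (xsum-zero (λ i → h (suc i)))

  xsum-xor : ∀ {k} (f g : Fin k → Bool) → xsum (λ i → f i xor g i) ≡ xsum f xor xsum g
  xsum-xor {zero}  f g = refl
  xsum-xor {suc k} f g = trans (cong ((f zero xor g zero) xor_) (xsum-xor (λ i → f (suc i)) (λ i → g (suc i))))
    (xor-interchange (f zero) (g zero) _ _)

  xsum-∧ : ∀ {k} c (f : Fin k → Bool) → xsum (λ i → c ∧ f i) ≡ c ∧ xsum f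
  xsum-∧ {k} false f = xsum-zero {k} {f = λ _ → false} (λ _ → refl)
  xsum-∧ true  f = refl

  xsum-swap : ∀ {k l} (f : Fin k → Fin l → Bool) → xsum (λ i → xsum (f i)) ≡ xsum (λ j → xsum (λ i → f i j))
  xsum-swap {zero} {l} f = sym (xsum-zero {l} {f = λ _ → false} (λ _ → refl))
  xsum-swap {suc k} f = trans (cong (xsum (f zero) xor_) (xsum-swap (λ i → f (suc i))))
    (sym (xsum-xor (f zero) (λ j → xsum (λ i → f (suc i) j))))

  xsum-δ : ∀ {k} (i : Fin k) (f : Fin k → Bool) → xsum (λ j → δ i j ∧ f j) ≡ f i
  xsum-δ {suc k} zero f = trans (cong (f zero xor_) (xsum-zero {k} {f = λ _ → false} (λ _ → refl))) (xor-identityʳ (f zero))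
  xsum-δ (suc i) f = xsum-δ i (λ j → f (suc j))

  xsum-true⇒∃ : ∀ {k} (f : Fin k → Bool) → xsum f ≡ true → ∃ λ i → f i ≡ true
  xsum-true⇒∃ {suc k} f p with f zero in eq
  ... | true  = zero , eq
  ... | false with xsum-true⇒∃ (λ i → f (suc i)) p
  ...   | i , q = suc i , q

  par-sumFin : ∀ k (f : Fin k → ℕ) → par (sumFin k f) ≡ xsum (λ i → par (f i))
  par-sumFin zero    f = refl
  par-sumFin (suc k) f = trans (par-+ (f zero) _) (cong (par (f zero) xor_) (par-sumFin k (λ i → f (suc i))))

2∣⇒even : ∀ {n} → 2 ∣ n → par n ≡ false
2∣⇒even (divides q refl) = trans (cong par (*-comm q 2)) (trans (par-+ q (q + 0))
  (trans (cong (par q xor_) (trans (par-+ q 0) (xor-identityʳ (par q)))) (xor-same (par q))))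

even⇒2∣ : ∀ n → par n ≡ false → 2 ∣ n
even⇒2∣ zero          p = divides 0 refl
even⇒2∣ (suc (suc n)) p with even⇒2∣ n (trans (sym (not-involutive (par n))) p)
... | divides q eq = divides (suc q) (cong (λ k → suc (suc k)) eq)

-- Boundaries of edge sets

module Boundary (G : Graph) where

  V E : Set
  V = Fin (n G)
  E = Fin (m G)

  ∂ : (E → Bool) → V → Bool
  ∂ S v = xsum (λ e → S e ∧ (δ (src G e) v xor δ (tgt G e) v))

  -- Degrees as numbers enter only here. From now on a cycle is an edge set with zero boundary over
  -- GF(2), so that all parity arguments are linear.
  deg-parity : ∀ S v → par (deg G S v) ≡ ∂ S v
  deg-parity S v = trans (par-sumFin (m G) _) (xsum-cong λ e → term (S e) (δ (src G e) v) (δ (tgt G e) v))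
    where
    term : ∀ s a b → par (if s then ⟦ a ⟧ + ⟦ b ⟧ else 0) ≡ s ∧ (a xor b)
    term false a b = refl
    term true  a b = trans (par-+ ⟦ a ⟧ ⟦ b ⟧) (cong₂ _xor_ (par-⟦⟧ a) (par-⟦⟧ b))

  cycle⇒∂ : ∀ {S} → IsCycle G S → ∀ v → ∂ S v ≡ false
  cycle⇒∂ {S} c v = trans (sym (deg-parity S v)) (2∣⇒even (c v))

  ∂⇒cycle : ∀ {S} → (∀ v → ∂ S v ≡ false) → IsCycle G S
  ∂⇒cycle {S} c v = even⇒2∣ _ (trans (deg-parity S v) (c v))

  ∂-cong : ∀ {S S'} → (∀ e → S e ≡ S' e) → ∀ v → ∂ S v ≡ ∂ S' v
  ∂-cong h v = xsum-cong λ e → cong (_∧ _) (h e)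

  ∂-xor : ∀ S S' v → ∂ (λ e → S e xor S' e) v ≡ ∂ S v xor ∂ S' v
  ∂-xor S S' v = trans (xsum-cong λ e → ∧-distribʳ-xor (δ (src G e) v xor δ (tgt G e) v) (S e) (S' e)) (xsum-xor _ _)

  ∂-∧ : ∀ c S v → ∂ (λ e → c ∧ S e) v ≡ c ∧ ∂ S v
  ∂-∧ c S v = trans (xsum-cong λ e → ∧-assoc c (S e) _) (xsum-∧ c _)

  ∂-zero : ∀ {S} → (∀ e → S e ≡ false) → ∀ v → ∂ S v ≡ false
  ∂-zero h v = xsum-zero λ e → cong (_∧ _) (h e)

  joins-ends : ∀ {e u w} → Joins G e u w → ∀ v → δ (src G e) v xor δ (tgt G e) v ≡ δ u v xor δ w v
  joins-ends (inj₁ (refl , refl)) v = refl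
  joins-ends {e} (inj₂ (refl , refl)) v = xor-comm (δ (src G e) v) (δ (tgt G e) v)

  ∂-single : ∀ {e u w} → Joins G e u w → ∀ c v → ∂ (λ e' → δ e e' ∧ c) v ≡ c ∧ (δ u v xor δ w v)
  ∂-single {e} j c v = trans (xsum-cong λ e' → ∧-assoc (δ e e') c _)
    (trans (xsum-δ e _) (cong (c ∧_) (joins-ends j v)))

  -- Exchange the two sums: each edge contributes at both of its ends. This supplies every global
  -- parity below: even totals on the tree, closing labels along an Euler trail, the last parity in
  -- the Petersen case.
  handshake : ∀ S → xsum (∂ S) ≡ false
  handshake S = trans (sym (xsum-swap (λ e v → S e ∧ (δ (src G e) v xor δ (tgt G e) v))))
    (xsum-zero λ e → trans (xsum-∧ (S e) _) (trans (cong (S e ∧_) (ends e)) (∧-zeroʳ (S e))))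
    where
    one : ∀ (u : V) → xsum (δ u) ≡ true
    one u = trans (xsum-cong λ v → sym (∧-identityʳ (δ u v))) (xsum-δ u (λ _ → true))
    ends : ∀ e → xsum (λ v → δ (src G e) v xor δ (tgt G e) v) ≡ false
    ends e = trans (xsum-xor (δ (src G e)) (δ (tgt G e))) (cong₂ _xor_ (one (src G e)) (one (tgt G e)))

  joins-sym : ∀ {e u w} → Joins G e u w → Joins G e w u
  joins-sym (inj₁ p) = inj₂ p
  joins-sym (inj₂ p) = inj₁ p

  incident-end : ∀ {e u w v} → Joins G e u w → (src G e ≡ v) ⊎ (tgt G e ≡ v) → (v ≡ u) ⊎ (v ≡ w)
  incident-end (inj₁ (refl , refl)) (inj₁ refl) = inj₁ refl
  incident-end (inj₁ (refl , refl)) (inj₂ refl) = inj₂ refl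
  incident-end (inj₂ (refl , refl)) (inj₁ refl) = inj₂ refl
  incident-end (inj₂ (refl , refl)) (inj₂ refl) = inj₁ refl

  joins-incident : ∀ {e u w} → Joins G e u w → (src G e ≡ u) ⊎ (tgt G e ≡ u)
  joins-incident (inj₁ (p , _)) = inj₁ p
  joins-incident (inj₂ (_ , p)) = inj₂ p

  reach-trans : ∀ {S u v w} → Reach G S u v → Reach G S v w → Reach G S u w
  reach-trans here           q = q
  reach-trans (step e s j p) q = step e s j (reach-trans p q)

  reach-sym : ∀ {S u v} → Reach G S u v → Reach G S v u
  reach-sym here           = here
  reach-sym (step e s j p) = reach-trans (reach-sym p) (step e s (joins-sym j) here)

  reach-mono : ∀ {S S' u v} → (∀ e → S e ≡ true → S' e ≡ true) → Reach G S u v → Reach G S' u v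
  reach-mono h here           = here
  reach-mono h (step e s j p) = step e (h e s) j (reach-mono h p)

  reach-end : ∀ {S e} → S e ≡ true → Reach G S (src G e) (tgt G e)
  reach-end {e = e} s = step e s (inj₁ (refl , refl)) here

  -- A walk may repeat edges, so they are counted mod 2; the boundary is still given by the two
  -- ends.
  walk-set : ∀ {S u v} → Reach G S u v → E → Bool
  walk-set here           e' = false
  walk-set (step e _ _ p) e' = (δ e e' ∧ true) xor walk-set p e'

  ∂-walk-set : ∀ {S u v} (p : Reach G S u v) x → ∂ (walk-set p) x ≡ δ u x xor δ v x
  ∂-walk-set {u = u} here x = trans (∂-zero (λ _ → refl) x) (sym (xor-same (δ u x)))
  ∂-walk-set {u = u} {v} (step {w = w} e s j p) x =
    trans (∂-xor _ (walk-set p) x) (trans (cong₂ _xor_ (∂-single j true x) (∂-walk-set p x))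
      (xor-telescope (δ u x) (δ w x) (δ v x)))

  walk-set⊆ : ∀ {S u v} (p : Reach G S u v) e → walk-set p e ≡ true → S e ≡ true
  walk-set⊆ (step e s j p) e' q with e ≟ e'
  ... | yes refl = s
  ... | no  _    = walk-set⊆ p e' q

sumFin-mono : ∀ k {f g : Fin k → ℕ} → (∀ i → f i ≤ g i) → sumFin k f ≤ sumFin k g
sumFin-mono zero    h = z≤n
sumFin-mono (suc k) h = +-mono-≤ (h zero) (sumFin-mono k (λ i → h (suc i)))

sumFin-mono-< : ∀ k {f g : Fin k → ℕ} → (∀ i → f i ≤ g i) → ∀ j → f j < g j → sumFin k f < sumFin k g
sumFin-mono-< (suc k) h zero    p = +-mono-<-≤ p (sumFin-mono k (λ i → h (suc i)))
sumFin-mono-< (suc k) h (suc j) p = +-mono-≤-< (h zero) (sumFin-mono-< k (λ i → h (suc i)) j p)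

-- The group GF(2)² and the product of its coordinates

V4 : Set
V4 = Bool × Bool

𝟎 : V4
𝟎 = false , false

infixl 6 _⊕_
_⊕_ : V4 → V4 → V4
(a , b) ⊕ (c , d) = (a xor c) , (b xor d)

⊕-identityʳ : ∀ x → x ⊕ 𝟎 ≡ x
⊕-identityʳ (a , b) = cong₂ _,_ (xor-identityʳ a) (xor-identityʳ b)

zero-or-not : ∀ (x : V4) → x ≡ 𝟎 ⊎ x ≢ 𝟎
zero-or-not (false , false) = inj₁ refl
zero-or-not (false , true)  = inj₂ λ ()
zero-or-not (true  , _)     = inj₂ λ ()

quad : V4 → Bool
quad (a , b) = a ∧ b

Additive : (V4 → Bool) → Set
Additive ψ = ∀ x y → ψ (x ⊕ y) ≡ ψ x xor ψ y

additive-𝟎 : ∀ ψ → Additive ψ → ψ 𝟎 ≡ false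
additive-𝟎 ψ add = trans (add 𝟎 𝟎) (xor-same (ψ 𝟎))

-- Euler trails

module Trails (G : Graph) where
  open Boundary G

  -- Nothing in the type forbids repeated edges. Multiplicities are kept in `cnt`, and a bound
  -- `cnt t e ≤ ⟦ S e ⟧` says that the trail uses edges of `S` only, each at most once.
  data Trail : V → V → Set where
    nil  : ∀ {u} → Trail u u
    cons : ∀ {u w v} (e : E) → Joins G e u w → Trail w v → Trail u v

  cnt : ∀ {u v} → Trail u v → E → ℕ
  cnt nil          f = 0
  cnt (cons e _ t) f = ⟦ δ e f ⟧ + cnt t f

  -- The start counts only if the trail returns to it, because labels change on arrival at a vertex.
  visits : ∀ {u v} → Trail u v → V → Bool
  visits nil                    x = false
  visits (cons {w = w} e _ t) x = δ w x ∨ visits t x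

  OnTrail : ∀ {u v} → Trail u v → V → Set
  OnTrail {u} t x = (u ≡ x) ⊎ (visits t x ≡ true)

  _⊙_ : ∀ {u v w} → Trail u v → Trail v w → Trail u w
  nil        ⊙ s = s
  cons e j t ⊙ s = cons e j (t ⊙ s)

  cnt-⊙ : ∀ {u v w} (t : Trail u v) (s : Trail v w) f → cnt (t ⊙ s) f ≡ cnt t f + cnt s f
  cnt-⊙ nil          s f = refl
  cnt-⊙ (cons e j t) s f = trans (cong (⟦ δ e f ⟧ +_) (cnt-⊙ t s f)) (sym (+-assoc ⟦ δ e f ⟧ _ _))

  ∨-true : ∀ a {b} → b ≡ true → a ∨ b ≡ true
  ∨-true a refl = ∨-zeroʳ a

  insertLoop : ∀ {u v x} (t : Trail u v) → OnTrail t x → (l : Trail x x) →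
    Σ (Trail u v) λ t' → ∀ f → cnt t' f ≡ cnt l f + cnt t f
  insertLoop t (inj₁ refl) l = l ⊙ t , cnt-⊙ l t
  insertLoop {x = x} (cons {w = w} e j t) (inj₂ p) l =
    cons e j (proj₁ rest) , λ f → trans (cong (⟦ δ e f ⟧ +_) (proj₂ rest f)) (swap ⟦ δ e f ⟧ (cnt l f) (cnt t f))
    where
    on : OnTrail t x
    on = at (w ≟ x) p
      where
      at : (d : Dec (w ≡ x)) → does d ∨ visits t x ≡ true → OnTrail t x
      at (yes q) _ = inj₁ q
      at (no  _) r = inj₂ r
    rest : Σ (Trail w _) λ t' → ∀ f → cnt t' f ≡ cnt l f + cnt t f
    rest = insertLoop t on l
    swap : ∀ a b c → a + (b + c) ≡ b + (a + c)
    swap a b c = trans (sym (+-assoc a b c)) (trans (cong (_+ c) (+-comm a b)) (+-assoc b a c))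

  covered-end : ∀ {u v} (t : Trail u v) f → 1 ≤ cnt t f → ∀ {x} → (src G f ≡ x) ⊎ (tgt G f ≡ x) → OnTrail t x
  covered-end (cons {w = w} e j t) f p {x} i with e ≟ f
  ... | yes refl with incident-end j i
  ...   | inj₁ refl = inj₁ refl
  ...   | inj₂ refl = inj₂ (cong (_∨ visits t w) (δ-refl w))
  covered-end (cons {w = w} e j t) f p {x} i | no _ with covered-end t f p i
  ... | inj₁ refl = inj₂ (cong (_∨ visits t w) (δ-refl w))
  ... | inj₂ q    = inj₂ (∨-true (δ w x) q)

  ∂-cnt : ∀ {u v} (t : Trail u v) x → ∂ (λ f → par (cnt t f)) x ≡ δ u x xor δ v x
  ∂-cnt {u} nil x = trans (∂-zero (λ _ → refl) x) (sym (xor-same (δ u x)))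
  ∂-cnt {u} {v} (cons {w = w} e j t) x =
    trans (∂-cong (λ f → trans (par-+ ⟦ δ e f ⟧ (cnt t f))
      (cong (_xor par (cnt t f)) (trans (par-⟦⟧ (δ e f)) (sym (∧-identityʳ (δ e f)))))) x)
    (trans (∂-xor (λ f → δ e f ∧ true) _ x)
    (trans (cong₂ _xor_ (∂-single j true x) (∂-cnt t x))
      (xor-telescope (δ u x) (δ w x) (δ v x))))

  size : (E → Bool) → ℕ
  size S = sumFin (m G) (λ e → ⟦ S e ⟧)

  remove : E → (E → Bool) → E → Bool
  remove e S f = S f ∧ not (δ e f)

  remove≤ : ∀ e S f → ⟦ remove e S f ⟧ ≤ ⟦ S f ⟧
  remove≤ e S f with S f | δ e f
  ... | false | _     = z≤n
  ... | true  | true  = z≤n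
  ... | true  | false = ≤-refl

  size-remove : ∀ e S → S e ≡ true → size (remove e S) < size S
  size-remove e S p = sumFin-mono-< (m G) (remove≤ e S) e (lemma p (δ-refl e))
    where
    lemma : S e ≡ true → δ e e ≡ true → ⟦ remove e S e ⟧ < ⟦ S e ⟧
    lemma p q rewrite p | q = s≤s z≤n

  ∂-remove : ∀ {e u w} S → S e ≡ true → Joins G e u w → ∀ x →
    ∂ (remove e S) x ≡ ∂ S x xor (δ u x xor δ w x)
  ∂-remove {e} S p j x = trans (∂-cong split x)
    (trans (∂-xor S _ x) (cong (∂ S x xor_) (∂-single j true x)))
    where
    split : ∀ f → remove e S f ≡ S f xor (δ e f ∧ true)
    split f with e ≟ f
    split f | yes refl rewrite p = refl
    split f | no _ = trans (∧-identityʳ (S f)) (sym (xor-identityʳ (S f)))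

  edge-at : ∀ S y → ∂ S y ≡ true → ∃ λ e → ∃ λ w → (S e ≡ true) × Joins G e y w
  edge-at S y h = found (xsum-true⇒∃ _ h)
    where
    other-end : ∀ e → δ (src G e) y xor δ (tgt G e) y ≡ true → ∃ λ w → Joins G e y w
    other-end e q with src G e ≟ y
    ... | yes r = tgt G e , inj₁ (r , refl)
    ... | no  _ = src G e , inj₂ (refl , δ-sound q)
    found : (∃ λ e → S e ∧ (δ (src G e) y xor δ (tgt G e) y) ≡ true) → ∃ λ e → ∃ λ w → (S e ≡ true) × Joins G e y w
    found (e , p) = e , proj₁ (other-end e (proj₂ (∧-split {S e} p))) , proj₁ (∧-split {S e} p) , proj₂ (other-end e (proj₂ (∧-split {S e} p)))

  cons≤ : ∀ {x w z} S {e} (j : Joins G e z w) (t : Trail w x) → S e ≡ true →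
    (∀ f → cnt t f ≤ ⟦ remove e S f ⟧) → ∀ f → cnt (cons e j t) f ≤ ⟦ S f ⟧
  cons≤ S {e} j t Se c f = bound (S f) (e ≟ f) (λ { refl → Se }) (c f)
    where
    bound : ∀ b (d : Dec (e ≡ f)) → (e ≡ f → b ≡ true) → cnt t f ≤ ⟦ b ∧ not (does d) ⟧ → ⟦ does d ⟧ + cnt t f ≤ ⟦ b ⟧
    bound b     (yes q) h le rewrite h q = s≤s le
    bound false (no _)  h le = le
    bound true  (no _)  h le = le

  lower : ∀ {a b} → suc a ≤ suc b → a ≤ b
  lower (s≤s p) = p

  -- As long as the current end `y` differs from `x`, the boundary of `S` at `y` is odd, so an edge
  -- of `S` leaves `y`. Walking and deleting it moves the odd vertex to its other end; `k` bounds
  -- the number of edges left.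
  closing-trail : ∀ k S x y → size S ≤ k → (∀ v → ∂ S v ≡ δ x v xor δ y v) →
    Σ (Trail y x) λ t → ∀ e → cnt t e ≤ ⟦ S e ⟧
  extend : ∀ k S x y → size S ≤ k → (∀ v → ∂ S v ≡ δ x v xor δ y v) → Dec (x ≡ y) →
    Σ (Trail y x) λ t → ∀ e → cnt t e ≤ ⟦ S e ⟧
  closing-trail k S x y le h = extend k S x y le h (x ≟ y)
  extend k S x y le h (yes refl) = nil , λ _ → z≤n
  extend k S x y le h (no x≢y) = leave k le (edge-at S y (trans (h y) (cong₂ _xor_ (δ-≢ x≢y) (δ-refl y))))
    where
    leave : ∀ k → size S ≤ k → (∃ λ e → ∃ λ w → (S e ≡ true) × Joins G e y w) →
      Σ (Trail y x) λ t → ∀ e → cnt t e ≤ ⟦ S e ⟧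
    leave zero    le (e , w , Se , j) with () ← ≤-trans (size-remove e S Se) le
    leave (suc k) le (e , w , Se , j) = cons e j (proj₁ rest) , cons≤ S j (proj₁ rest) Se (proj₂ rest)
      where
      rest : Σ (Trail w x) λ t → ∀ f → cnt t f ≤ ⟦ remove e S f ⟧
      rest = closing-trail k (remove e S) x w (lower (≤-trans (size-remove e S Se) le))
        (λ v → trans (∂-remove S Se j v) (trans (cong (_xor (δ y v xor δ w v)) (h v))
          (xor-telescope (δ x v) (δ y v) (δ w v))))

  module _ (D : E → Bool) (even : ∀ v → ∂ D v ≡ false) where

    uncovered : ∀ {u v} → Trail u v → E → Bool
    uncovered t e = D e xor par (cnt t e)

    Sub : ∀ {u v} → Trail u v → Set
    Sub t = ∀ e → cnt t e ≤ ⟦ D e ⟧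

    -- Along a walk in `D` that starts on the trail, covered edges lead to vertices of the trail.
    -- The first uncovered edge therefore starts at a vertex where a loop can be spliced in.
    frontier : ∀ {u v x y} (t : Trail u v) → Sub t → Reach G D x y → OnTrail t x →
      ∀ e → uncovered t e ≡ true → src G e ≡ y →
      ∃ λ f → ∃ λ z → ∃ λ w → (uncovered t f ≡ true) × Joins G f z w × OnTrail t z
    frontier t sub here on e p q = e , _ , _ , p , inj₁ (q , refl) , on
    frontier t sub (step f s j r) on e p q with uncovered t f in eq
    ... | true  = f , _ , _ , eq , j , on
    ... | false = frontier t sub r (covered-end t f (pos (cnt t f) eq) (joins-incident (joins-sym j))) e p q
      where
      pos : ∀ c → D f xor par c ≡ false → 1 ≤ c
      pos zero    h = ⊥-elim (true≢false (trans (sym s) (trans (sym (xor-identityʳ (D f))) h)))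
      pos (suc c) h = s≤s z≤n

    -- Hierholzer's argument: the uncovered edges form an even set, so an uncovered edge at a vertex
    -- of the trail closes up to a loop of uncovered edges. Splicing it in makes the uncovered set
    -- smaller.
    euler : ∀ k {r} (t : Trail r r) → Sub t → (∀ e → D e ≡ true → Reach G D r (src G e)) →
      size (uncovered t) ≤ k → Σ (Trail r r) λ t' → ∀ e → cnt t' e ≡ ⟦ D e ⟧
    euler k {r} t sub conn le with any? (λ e → uncovered t e 𝔹.≟ true)
    ... | no none = t , λ e → full (cnt t e) (D e) (sub e) (λ q → none (e , q))
      where
      full : ∀ c d → c ≤ ⟦ d ⟧ → (d xor par c ≢ true) → c ≡ ⟦ d ⟧
      full zero       false p h = refl
      full zero       true  p h = ⊥-elim (h refl)
      full (suc zero) true  p h = refl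
      full (suc (suc c)) true (s≤s ()) h
    ... | yes (e , p) with frontier t sub (conn e (inD e p)) (inj₁ refl) e p refl
      where
      inD : ∀ e → uncovered t e ≡ true → D e ≡ true
      inD e p with D e | cnt t e | sub e
      ... | true  | _     | _ = refl
      ... | false | zero  | _ with () ← p
      ... | false | suc _ | ()
    ... | f , z , w , Uf , j , on = again k le (insertLoop t on loop)
      where
      U : E → Bool
      U = uncovered t
      ∂U : ∀ v → ∂ U v ≡ false
      ∂U v = trans (∂-xor D _ v) (cong₂ _xor_ (even v) (trans (∂-cnt t v) (xor-same (δ r v))))
      back : Σ (Trail w z) λ s → ∀ e → cnt s e ≤ ⟦ remove f U e ⟧
      back = closing-trail (size (remove f U)) (remove f U) z w ≤-refl
        (λ v → trans (∂-remove U Uf j v) (cong (_xor (δ z v xor δ w v)) (∂U v)))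
      loop : Trail z z
      loop = cons f j (proj₁ back)
      loop≤ : ∀ e → cnt loop e ≤ ⟦ U e ⟧
      loop≤ = cons≤ U j (proj₁ back) Uf (proj₂ back)
      again : ∀ k → size U ≤ k → (Σ (Trail r r) λ t' → ∀ e → cnt t' e ≡ cnt loop e + cnt t e) →
        Σ (Trail r r) λ t' → ∀ e → cnt t' e ≡ ⟦ D e ⟧
      again zero le _ with ≤-trans (sumFin-mono-< (m G) {λ _ → 0} (λ _ → z≤n) f (subst (λ b → 0 < ⟦ b ⟧) (sym Uf) (s≤s z≤n))) le
      ... | ()
      again (suc k) le (t' , h) = euler k t' sub' conn (lower (≤-trans smaller le))
        where
        pointwise : ∀ l c d → l ≤ ⟦ d xor par c ⟧ → c ≤ ⟦ d ⟧ →
          (l + c ≤ ⟦ d ⟧) × (⟦ d xor par (l + c) ⟧ ≤ ⟦ d xor par c ⟧) × (1 ≤ l → ⟦ d xor par (l + c) ⟧ < ⟦ d xor par c ⟧)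
        pointwise zero c d p q = q , ≤-refl , λ ()
        pointwise (suc zero) zero true p q = ≤-refl , z≤n , λ _ → ≤-refl
        pointwise (suc (suc l)) zero true (s≤s ()) q
        pointwise (suc l) (suc zero) true () q
        pointwise (suc l) (suc (suc c)) true p (s≤s ())
        pw : ∀ e → _
        pw e = pointwise (cnt loop e) (cnt t e) (D e) (loop≤ e) (sub e)
        sub' : Sub t'
        sub' e rewrite h e = proj₁ (pw e)
        smaller : size (uncovered t') < size U
        smaller = sumFin-mono-< (m G)
          (λ e → subst (λ c → ⟦ D e xor par c ⟧ ≤ ⟦ U e ⟧) (sym (h e)) (proj₁ (proj₂ (pw e)))) f
          (subst (λ c → ⟦ D f xor par c ⟧ < ⟦ U f ⟧) (sym (h f))
            (proj₂ (proj₂ (pw f)) (subst (λ b → 1 ≤ ⟦ b ⟧ + cnt (proj₁ back) f) (sym (δ-refl f)) (s≤s z≤n))))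

  -- Labelling a trail: the label changes by a x at the last visit of x and nowhere else.
  module Labels (a : V → V4) where

    next : ∀ {u v} → V4 → Trail u v → V4
    next {u} π t = π ⊕ (if visits t u then 𝟎 else a u)

    final : ∀ {u v} → V4 → Trail u v → V4
    final π nil          = π
    final π (cons e j t) = final (next π t) t

    labelled : (V4 → Bool) → ∀ {u v} → V4 → Trail u v → E → Bool
    labelled ψ π nil          f = false
    labelled ψ π (cons e j t) f = (δ e f ∧ ψ π) xor labelled ψ (next π t) t f

    jump : (V4 → Bool) → ∀ {u v} → V4 → Trail u v → V → Bool
    jump ψ π nil                  x = false
    jump ψ π (cons {w = w} e j t) x = (δ w x ∧ (ψ π xor ψ (next π t))) xor jump ψ (next π t) t x

    -- Summation by parts along the trail. `ψ` is arbitrary, so the formula covers the two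
    -- coordinates as well as `quad`, which is not additive.
    ∂-labelled : ∀ ψ {u v} π (t : Trail u v) x →
      ∂ (labelled ψ π t) x ≡ ((δ u x ∧ ψ π) xor (δ v x ∧ ψ (final π t))) xor jump ψ π t x
    ∂-labelled ψ {u} π nil x = trans (∂-zero (λ _ → refl) x)
      (sym (trans (xor-identityʳ _) (xor-same (δ u x ∧ ψ π))))
    ∂-labelled ψ {u} {v} π (cons {w = w} e j t) x =
      trans (∂-xor (λ f → δ e f ∧ ψ π) _ x)
      (trans (cong₂ _xor_ (∂-single j (ψ π) x) (∂-labelled ψ (next π t) t x))
        (identity (ψ π) (ψ (next π t)) (δ u x) (δ w x) (δ v x ∧ ψ (final π (cons e j t))) (jump ψ (next π t) t x)))
      where
      identity : ∀ p p' u w f r → (p ∧ (u xor w)) xor (((w ∧ p') xor f) xor r) ≡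
        ((u ∧ p) xor f) xor ((w ∧ (p xor p')) xor r)
      identity = solve 6 (λ p p' u w f r → (p :* (u :+ w)) :+ (((w :* p') :+ f) :+ r) :=
        ((u :* p) :+ f) :+ ((w :* (p :+ p')) :+ r)) refl

    jump-zero : ∀ ψ {u v} π (t : Trail u v) x → a x ≡ 𝟎 → jump ψ π t x ≡ false
    jump-zero ψ π nil                  x p = refl
    jump-zero ψ π (cons {w = w} e j t) x p = cong₂ _xor_ (here-zero (w ≟ x)) (jump-zero ψ (next π t) t x p)
      where
      here-zero : (d : Dec (w ≡ x)) → does d ∧ (ψ π xor ψ (next π t)) ≡ false
      here-zero (no _) = refl
      here-zero (yes refl) = trans (cong (λ y → ψ π xor ψ y) stays) (xor-same (ψ π))
        where
        stays : next π t ≡ π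
        stays with visits t w
        ... | true  = ⊕-identityʳ π
        ... | false = trans (cong (π ⊕_) p) (⊕-identityʳ π)

    -- Earlier visits of `x` contribute nothing and the last one contributes the difference of two
    -- labels, which additivity turns into `ψ (a x)`.
    jump-additive : ∀ ψ → Additive ψ → ∀ {u v} π (t : Trail u v) x → jump ψ π t x ≡ visits t x ∧ ψ (a x)
    jump-additive ψ add π nil                  x = refl
    jump-additive ψ add π (cons {w = w} e j t) x =
      trans (cong ((δ w x ∧ (ψ π xor ψ (next π t))) xor_) (jump-additive ψ add (next π t) t x)) (at (w ≟ x))
      where
      at : (d : Dec (w ≡ x)) → (does d ∧ (ψ π xor ψ (next π t))) xor (visits t x ∧ ψ (a x)) ≡ (does d ∨ visits t x) ∧ ψ (a x)
      at (no _) = refl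
      at (yes refl) = trans (cong (λ y → (ψ π xor y) xor (visits t w ∧ ψ (a w))) (add π _)) (change (visits t w))
        where
        change : ∀ b → (ψ π xor (ψ π xor ψ (if b then 𝟎 else a w))) xor (b ∧ ψ (a w)) ≡ ψ (a w)
        change true  rewrite additive-𝟎 ψ add = solve 2 (λ p q → (p :+ (p :+ con false)) :+ q := q) refl (ψ π) (ψ (a w))
        change false = solve 2 (λ p q → (p :+ (p :+ q)) :+ con false := q) refl (ψ π) (ψ (a w))

    labelled-off : ∀ ψ {u v} π (t : Trail u v) f → cnt t f ≡ 0 → labelled ψ π t f ≡ false
    labelled-off ψ π nil          f p = refl
    labelled-off ψ π (cons e j t) f p with e ≟ f
    ... | no _ = labelled-off ψ (next π t) t f p

    label : ∀ {u v} → V4 → Trail u v → E → V4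
    label π t f = labelled proj₁ π t f , labelled proj₂ π t f

    labelled-label : ∀ ψ → ψ 𝟎 ≡ false → ∀ {u v} π (t : Trail u v) f → cnt t f ≤ 1 → labelled ψ π t f ≡ ψ (label π t f)
    labelled-label ψ ψ0 π nil          f p = sym ψ0
    labelled-label ψ ψ0 π (cons e j t) f p with e ≟ f
    ... | no _ = labelled-label ψ ψ0 (next π t) t f p
    ... | yes _ with cnt t f in eq
    ...   | zero rewrite labelled-off ψ (next π t) t f eq | labelled-off proj₁ (next π t) t f eq
                       | labelled-off proj₂ (next π t) t f eq =
            trans (xor-identityʳ (ψ π)) (cong ψ (sym (⊕-identityʳ π)))
    labelled-label ψ ψ0 π (cons e j t) f (s≤s ()) | yes _ | suc _

  -- The product of the coordinates has no boundary where a vanishes: the trail passes such vertices with constant label.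
  euler-lift : ∀ (D : E → Bool) → (∀ v → ∂ D v ≡ false) → ∀ r → (∀ e → D e ≡ true → Reach G D r (src G e)) →
    (a : V → V4) → (∀ v → a v ≢ 𝟎 → ∃ λ e → (D e ≡ true) × ((src G e ≡ v) ⊎ (tgt G e ≡ v))) →
    (∀ ψ → Additive ψ → xsum (λ v → ψ (a v)) ≡ false) →
    Σ (E → V4) λ g → (∀ e → D e ≡ false → g e ≡ 𝟎) ×
      (∀ v → ∂ (λ e → proj₁ (g e)) v ≡ proj₁ (a v)) × (∀ v → ∂ (λ e → proj₂ (g e)) v ≡ proj₂ (a v)) ×
      (∀ v → a v ≡ 𝟎 → ∂ (λ e → quad (g e)) v ≡ false)
  euler-lift D even r conn a onD total = g , off , ∂g proj₁ (λ _ _ → refl) , ∂g proj₂ (λ _ _ → refl) , ∂q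
    where
    open Labels a
    tour : Σ (Trail r r) λ t → ∀ e → cnt t e ≡ ⟦ D e ⟧
    tour = euler D even (size (uncovered D even {r} nil)) nil (λ _ → z≤n) conn ≤-refl
    t : Trail r r
    t = proj₁ tour
    g : E → V4
    g = label 𝟎 t
    off : ∀ e → D e ≡ false → g e ≡ 𝟎
    off e p = cong₂ _,_ (labelled-off proj₁ 𝟎 t e none) (labelled-off proj₂ 𝟎 t e none)
      where
      none : cnt t e ≡ 0
      none = trans (proj₂ tour e) (cong ⟦_⟧ p)
    visits-end : ∀ {u w v} e (j : Joins G e u w) (s : Trail w v) → visits (cons e j s) v ≡ true
    visits-end {w = w} e j nil            = cong (_∨ false) (δ-refl w)
    visits-end {w = w} {v} e j (cons f i s) = ∨-true (δ w v) (visits-end f i s)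
    visits-covered : ∀ {u} (s : Trail u u) e → 1 ≤ cnt s e → visits s u ≡ true
    visits-covered (cons f i s) e _ = visits-end f i s
    visited : ∀ v → a v ≢ 𝟎 → visits t v ≡ true
    visited v h with onD v h
    ... | e , De , i with covered-end t e (≤-reflexive (sym (trans (proj₂ tour e) (cong ⟦_⟧ De)))) i
    ...   | inj₂ q    = q
    -- A closed trail with an edge returns to its start, so the start is visited too.
    ...   | inj₁ refl = visits-covered t e (≤-reflexive (sym (trans (proj₂ tour e) (cong ⟦_⟧ De))))
    masked : ∀ ψ → Additive ψ → ∀ v → visits t v ∧ ψ (a v) ≡ ψ (a v)
    masked ψ add v with zero-or-not (a v)
    ... | inj₁ z rewrite z | additive-𝟎 ψ add = ∧-zeroʳ (visits t v)
    ... | inj₂ h rewrite visited v h = refl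
    ∂l : ∀ ψ → Additive ψ → ∀ v → ∂ (labelled ψ 𝟎 t) v ≡ (δ r v ∧ ψ (final 𝟎 t)) xor ψ (a v)
    ∂l ψ add v = trans (∂-labelled ψ 𝟎 t v) (cong₂ _xor_
      (cong (_xor (δ r v ∧ ψ (final 𝟎 t))) (trans (cong (δ r v ∧_) (additive-𝟎 ψ add)) (∧-zeroʳ (δ r v))))
      (trans (jump-additive ψ add 𝟎 t v) (masked ψ add v)))
    -- The boundary of `labelled` sums to zero by handshaking, and so does `ψ` of `a`. What remains
    -- is the mismatch of labels where the closed trail meets its start, which is hence zero.
    final-zero : ∀ ψ → Additive ψ → ψ (final 𝟎 t) ≡ false
    final-zero ψ add = trans (sym (trans (xor-identityʳ (xsum (λ v → δ r v ∧ ψ (final 𝟎 t)))) (xsum-δ r _)))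
      (trans (cong (xsum (λ v → δ r v ∧ ψ (final 𝟎 t)) xor_) (sym (total ψ add)))
      (trans (sym (xsum-xor (λ v → δ r v ∧ ψ (final 𝟎 t)) (λ v → ψ (a v))))
      (trans (xsum-cong (λ v → sym (∂l ψ add v))) (handshake (labelled ψ 𝟎 t)))))
    final≡𝟎 : final 𝟎 t ≡ 𝟎
    final≡𝟎 = cong₂ _,_ (final-zero proj₁ (λ _ _ → refl)) (final-zero proj₂ (λ _ _ → refl))
    once : ∀ e → cnt t e ≤ 1
    once e = subst (_≤ 1) (sym (proj₂ tour e)) (bit≤1 (D e))
    ∂g : ∀ ψ → Additive ψ → ∀ v → ∂ (λ e → ψ (g e)) v ≡ ψ (a v)
    ∂g ψ add v = trans (∂-cong (λ e → sym (labelled-label ψ (additive-𝟎 ψ add) 𝟎 t e (once e))) v)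
      (trans (∂l ψ add v) (cong (_xor ψ (a v)) (trans (cong (δ r v ∧_) (final-zero ψ add)) (∧-zeroʳ (δ r v)))))
    ∂q : ∀ v → a v ≡ 𝟎 → ∂ (λ e → quad (g e)) v ≡ false
    ∂q v p = trans (∂-cong (λ e → sym (labelled-label quad refl 𝟎 t e (once e))) v)
      (trans (∂-labelled quad 𝟎 t v) (cong₂ _xor_
        (cong₂ _xor_ (∧-zeroʳ (δ r v)) (trans (cong (λ y → δ r v ∧ quad y) final≡𝟎) (∧-zeroʳ (δ r v))))
        (jump-zero quad 𝟎 t v p)))

-- Rooted trees in a graph

≤1-cases : ∀ {n} → n ≤ 1 → (n ≡ 0) ⊎ (n ≡ 1)
≤1-cases z≤n       = inj₁ refl
≤1-cases (s≤s z≤n) = inj₂ refl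

0-or-1≤ : ∀ n → (n ≡ 0) ⊎ (1 ≤ n)
0-or-1≤ zero    = inj₁ refl
0-or-1≤ (suc n) = inj₂ (s≤s z≤n)

¬1≤⇒0 : ∀ k → (1 ≤ k → ⊥) → k ≡ 0
¬1≤⇒0 zero    _ = refl
¬1≤⇒0 (suc k) h = ⊥-elim (h (s≤s z≤n))

1≤+ : ∀ m {n} → 1 ≤ m + n → (1 ≤ m) ⊎ (1 ≤ n)
1≤+ zero    p = inj₂ p
1≤+ (suc m) p = inj₁ (s≤s z≤n)

+≤1-disjoint : ∀ {m n} → m + n ≤ 1 → 1 ≤ m → 1 ≤ n → ⊥
+≤1-disjoint {suc zero}    {suc n} (s≤s ()) _ _
+≤1-disjoint {suc (suc m)} {suc n} (s≤s ()) _ _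

disjoint-+≤1 : ∀ {m n} → m ≤ 1 → n ≤ 1 → (1 ≤ m → 1 ≤ n → ⊥) → m + n ≤ 1
disjoint-+≤1 {zero}     p q h = q
disjoint-+≤1 {suc zero} {zero}  p q h = ≤-refl
disjoint-+≤1 {suc zero} {suc n} p q h = ⊥-elim (h (s≤s z≤n) (s≤s z≤n))
disjoint-+≤1 {suc (suc m)} (s≤s ()) q h

1≤bit : ∀ {b} → 1 ≤ ⟦ b ⟧ → b ≡ true
1≤bit {true} _ = refl

bit-true : ∀ {b} → b ≡ true → 1 ≤ ⟦ b ⟧
bit-true refl = ≤-refl

∨-true⁻ : ∀ a {b} → a ∨ b ≡ true → (a ≡ true) ⊎ (b ≡ true)
∨-true⁻ true  _ = inj₁ refl
∨-true⁻ false p = inj₂ p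

sumFin-cong : ∀ k {f g : Fin k → ℕ} → (∀ i → f i ≡ g i) → sumFin k f ≡ sumFin k g
sumFin-cong zero    h = refl
sumFin-cong (suc k) h = cong₂ _+_ (h zero) (sumFin-cong k (λ i → h (suc i)))

module Bushes (G : Graph) where
  open Boundary G

  -- Only the shape is recorded. Disjointness of the parts is a bound on `cntV` and `cntE`, and
  -- bushes that differ in their root or in the order of grafting are compared by these counts.
  data Bush : V → Set where
    bare  : ∀ u → Bush u
    graft : ∀ {u w} → Bush u → (e : E) → Joins G e u w → Bush w → Bush u

  cntV : ∀ {u} → Bush u → V → ℕ
  cntV (bare u)        v = ⟦ δ u v ⟧
  cntV (graft b e j c) v = cntV b v + cntV c v

  cntE : ∀ {u} → Bush u → E → ℕ
  cntE (bare u)        f = 0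
  cntE (graft b e j c) f = ⟦ δ e f ⟧ + (cntE b f + cntE c f)

  sumB : (V → Bool) → ∀ {u} → Bush u → Bool
  sumB α (bare u)        = α u
  sumB α (graft b e j c) = sumB α b xor sumB α c

  -- In a tree the edge set with a prescribed boundary is forced: an edge belongs to it when the
  -- limb beyond it has odd total. An odd overall total would be left at the root.
  flow : (V → Bool) → ∀ {u} → Bush u → E → Bool
  flow α (bare u)        f = false
  flow α (graft b e j c) f = (δ e f ∧ sumB α c) xor (flow α b f xor flow α c f)

  root∈ : ∀ {u} (b : Bush u) → 1 ≤ cntV b u
  root∈ (bare u)        = bit-true (δ-refl u)
  root∈ (graft b e j c) = ≤-trans (root∈ b) (m≤m+n _ _)

  ∂-flow : ∀ α {u} (b : Bush u) v → ∂ (flow α b) v ≡ (par (cntV b v) ∧ α v) xor (δ u v ∧ sumB α b)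
  ∂-flow α (bare u) v = trans (∂-zero (λ _ → refl) v) (sym (trans (cong (λ x → (x ∧ α v) xor (δ u v ∧ α u)) (par-⟦⟧ (δ u v))) (at (u ≟ v))))
    where
    at : (d : Dec (u ≡ v)) → (does d ∧ α v) xor (does d ∧ α u) ≡ false
    at (yes refl) = xor-same (α u)
    at (no _)     = refl
  ∂-flow α {u} (graft {w = w} b e j c) v =
    trans (∂-xor (λ f → δ e f ∧ sumB α c) _ v)
    (trans (cong₂ _xor_ (∂-single j (sumB α c) v) (trans (∂-xor (flow α b) (flow α c) v) (cong₂ _xor_ (∂-flow α b v) (∂-flow α c v))))
    (trans (identity (sumB α b) (sumB α c) (δ u v) (δ w v) (par (cntV b v)) (par (cntV c v)) (α v))
      (cong (λ x → (x ∧ α v) xor (δ u v ∧ (sumB α b xor sumB α c))) (sym (par-+ (cntV b v) (cntV c v))))))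
    where
    identity : ∀ b c u w p q a → (c ∧ (u xor w)) xor (((p ∧ a) xor (u ∧ b)) xor ((q ∧ a) xor (w ∧ c))) ≡
      ((p xor q) ∧ a) xor (u ∧ (b xor c))
    identity = solve 7 (λ b c u w p q a → (c :* (u :+ w)) :+ (((p :* a) :+ (u :* b)) :+ ((q :* a) :+ (w :* c))) :=
      ((p :+ q) :* a) :+ (u :* (b :+ c))) refl

  sumB-xsum : ∀ α {u} (b : Bush u) → sumB α b ≡ xsum (λ v → par (cntV b v) ∧ α v)
  sumB-xsum α (bare u) = trans (sym (xsum-δ u α)) (xsum-cong λ v → cong (_∧ α v) (sym (par-⟦⟧ (δ u v))))
  sumB-xsum α (graft b e j c) = trans (cong₂ _xor_ (sumB-xsum α b) (sumB-xsum α c))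
    (trans (sym (xsum-xor (λ v → par (cntV b v) ∧ α v) (λ v → par (cntV c v) ∧ α v)))
      (xsum-cong λ v → trans (sym (∧-distribʳ-xor (α v) (par (cntV b v)) (par (cntV c v))))
        (cong (_∧ α v) (sym (par-+ (cntV b v) (cntV c v))))))

  sumB-cong : ∀ {α β u} (b : Bush u) → (∀ v → 1 ≤ cntV b v → α v ≡ β v) → sumB α b ≡ sumB β b
  sumB-cong (bare u)        h = h u (bit-true (δ-refl u))
  sumB-cong (graft b e j c) h = cong₂ _xor_ (sumB-cong b (λ v p → h v (≤-trans p (m≤m+n _ _))))
    (sumB-cong c (λ v p → h v (≤-trans p (m≤n+m _ _))))

  sumB-xor : ∀ α β {u} (b : Bush u) → sumB (λ v → α v xor β v) b ≡ sumB α b xor sumB β b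
  sumB-xor α β (bare u)        = refl
  sumB-xor α β (graft b e j c) = trans (cong₂ _xor_ (sumB-xor α β b) (sumB-xor α β c))
    (xor-interchange (sumB α b) (sumB β b) (sumB α c) (sumB β c))

  sumB-∧ : ∀ k α {u} (b : Bush u) → sumB (λ v → k ∧ α v) b ≡ k ∧ sumB α b
  sumB-∧ k α (bare u)        = refl
  sumB-∧ k α (graft b e j c) = trans (cong₂ _xor_ (sumB-∧ k α b) (sumB-∧ k α c))
    (sym (∧-distribˡ-xor k (sumB α b) (sumB α c)))

  sumB-zero : ∀ {α u} (b : Bush u) → (∀ v → 1 ≤ cntV b v → α v ≡ false) → sumB α b ≡ false
  sumB-zero (bare u)        h = h u (bit-true (δ-refl u))
  sumB-zero (graft b e j c) h = cong₂ _xor_ (sumB-zero b (λ v p → h v (≤-trans p (m≤m+n _ _))))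
    (sumB-zero c (λ v p → h v (≤-trans p (m≤n+m _ _))))

  AllCuts : (∀ {w} → Bush w → Set) → ∀ {u} → Bush u → Set
  AllCuts P (bare u)        = ⊤
  AllCuts P (graft b e j c) = AllCuts P b × AllCuts P c × P c

  flow-off : ∀ α {u} (b : Bush u) f → cntE b f ≡ 0 → flow α b f ≡ false
  flow-off α (bare u)        f p = refl
  flow-off α (graft b e j c) f p with e ≟ f
  ... | no _ with cntE b f in p₁ | cntE c f in p₂
  ...   | zero | zero = cong₂ _xor_ (flow-off α b f p₁) (flow-off α c f p₂)

  flow-cut : ∀ {P : ∀ {w} → Bush w → Set} {u} (b : Bush u) f → cntE b f ≡ 1 → AllCuts P b →
    ∃ λ w → Σ (Bush w) λ c → P c × (∀ α → flow α b f ≡ sumB α c)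
  flow-cut (graft {w = w} b e j c) f p (hb , hc , h) with e ≟ f
  ... | yes _ = w , c , h , λ α → trans (cong (sumB α c xor_) (cong₂ _xor_ (flow-off α b f (left p)) (flow-off α c f (right p))))
                 (xor-identityʳ (sumB α c))
    where
    left : ∀ {x y} → suc (x + y) ≡ 1 → x ≡ 0
    left {zero} _ = refl
    right : ∀ {x y} → suc (x + y) ≡ 1 → y ≡ 0
    right {zero} {zero} _ = refl
  ... | no _ with cntE b f in p₁ | cntE c f in p₂
  ...   | zero     | suc zero with flow-cut c f p₂ hc
  ...     | x , d , q , k = x , d , q , λ α → trans (cong (_xor flow α c f) (flow-off α b f p₁)) (k α)
  flow-cut (graft b e j c) f p (hb , hc , h) | no _ | suc zero | zero with flow-cut b f p₁ hb
  ... | x , d , q , k = x , d , q , λ α → trans (cong (flow α b f xor_) (flow-off α c f p₂)) (trans (xor-identityʳ (flow α b f)) (k α))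

  edge-ends∈ : ∀ {u} (b : Bush u) f → 1 ≤ cntE b f → ∀ {v} → (src G f ≡ v) ⊎ (tgt G f ≡ v) → 1 ≤ cntV b v
  edge-ends∈ (graft {w = w} b e j c) f p {v} i with e ≟ f
  ... | yes refl with incident-end j i
  ...   | inj₁ refl = ≤-trans (root∈ b) (m≤m+n _ _)
  ...   | inj₂ refl = ≤-trans (root∈ c) (m≤n+m _ _)
  edge-ends∈ (graft b e j c) f p i | no _ with 1≤+ (cntE b f) p
  ... | inj₁ q = ≤-trans (edge-ends∈ b f q i) (m≤m+n _ _)
  ... | inj₂ q = ≤-trans (edge-ends∈ c f q i) (m≤n+m _ _)

  record Spans (T : EdgeSet G) {u} (b : Bush u) : Set where
    field
      edges : ∀ e → cntE b e ≡ ⟦ T e ⟧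
      verts : ∀ v → cntV b v ≤ 1

  module _ {T C : EdgeSet G} (dec : Decomposition G T C) (cyc : IsCycle G C)
           {r : V} (b : Bush r) (span : Spans T b) where

    -- Each `ℓ l` is completed to a cycle by the edge set of the tree with the same boundary. Its
    -- total is even by handshaking, so no excess is left at the root. A tree edge lies in the
    -- completed set when the limb beyond it has odd `α l`-sum; an edge of `C` lies in `C` and in
    -- one further cycle.
    labels⇒CDC : ∀ N (α : Fin N → V → Bool) (ℓ : Fin N → E → Bool) →
      (∀ l e → C e ≡ false → ℓ l e ≡ false) → (∀ l v → ∂ (ℓ l) v ≡ α l v) →
      (∀ l v → cntV b v ≡ 0 → α l v ≡ false) →
      (∀ e → C e ≡ true → sumFin N (λ l → ⟦ ℓ l e ⟧) ≡ 1) →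
      AllCuts (λ c → sumFin N (λ l → ⟦ sumB (α l) c ⟧) ≡ 2) b →
      HasCDCWith G (suc N) C
    labels⇒CDC N α ℓ offC bd offT one cuts = S , (even , twice) , zero , λ _ → refl
      where
      S : Fin (suc N) → EdgeSet G
      S zero      = C
      S (suc l) e = ℓ l e xor flow (α l) b e
      inT : ∀ l v → par (cntV b v) ∧ α l v ≡ α l v
      inT l v with ≤1-cases (Spans.verts span v)
      ... | inj₁ p rewrite p = sym (offT l v p)
      ... | inj₂ p rewrite p = refl
      total : ∀ l → sumB (α l) b ≡ false
      total l = trans (sumB-xsum (α l) b) (trans (xsum-cong (λ v → trans (inT l v) (sym (bd l v)))) (handshake (ℓ l)))
      even : ∀ i → IsCycle G (S i)
      even zero    = cyc
      even (suc l) = ∂⇒cycle λ v → trans (∂-xor (ℓ l) (flow (α l) b) v)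
        (trans (cong₂ _xor_ (bd l v) (trans (∂-flow (α l) b v) (cong₂ _xor_ (inT l v)
          (trans (cong (δ r v ∧_) (total l)) (∧-zeroʳ (δ r v))))))
        (trans (cong (α l v xor_) (xor-identityʳ (α l v))) (xor-same (α l v))))
      twice : ∀ e → sumFin (suc N) (λ i → ⟦ S i e ⟧) ≡ 2
      twice e with C e in Ce
      ... | true = cong suc (trans (sumFin-cong N λ l → cong ⟦_⟧ (trans (cong (ℓ l e xor_) (flow-off (α l) b e onC)) (xor-identityʳ (ℓ l e)))) (one e Ce))
        where
        onC : cntE b e ≡ 0
        onC = trans (Spans.edges span e) (cong ⟦_⟧ (notT (T e) refl))
          where
          notT : ∀ t → T e ≡ t → t ≡ false
          notT false _ = refl
          notT true  q = ⊥-elim (true≢false (trans (sym Ce) (proj₁ dec e q)))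
      ... | false with proj₂ dec e
      ...   | inj₂ q = ⊥-elim (true≢false (trans (sym q) Ce))
      ...   | inj₁ Te with flow-cut b e (trans (Spans.edges span e) (cong ⟦_⟧ Te)) cuts
      ...     | w , c , two , k = trans (sumFin-cong N λ l → cong ⟦_⟧ (trans (cong (_xor flow (α l) b e) (offC l e Ce)) (k (α l)))) two

-- Growing a rooted tree from an acyclic edge set

module Planting (G : Graph) where
  open Boundary G
  open Trails G using (size; remove; size-remove; lower)
  open Bushes G

  record Planted (S : E → Bool) (u : V) : Set where
    field
      bush     : Bush u
      onceV    : ∀ v → cntV bush v ≤ 1
      onceE    : ∀ e → cntE bush e ≤ 1
      V⇒reach  : ∀ v → 1 ≤ cntV bush v → Reach G S u v
      reach⇒V  : ∀ v → Reach G S u v → 1 ≤ cntV bush v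
      E⇒reach  : ∀ e → 1 ≤ cntE bush e → (S e ≡ true) × Reach G S u (src G e)
      reach⇒E  : ∀ e → S e ≡ true → Reach G S u (src G e) → 1 ≤ cntE bush e
  open Planted

  remove-⊆ : ∀ e S f → remove e S f ≡ true → S f ≡ true
  remove-⊆ e S f p = proj₁ (∧-split {S f} p)

  remove-≢ : ∀ {e f} S → S f ≡ true → e ≢ f → remove e S f ≡ true
  remove-≢ S p q rewrite p | δ-≢ q = refl

  remove-self : ∀ e S → remove e S e ≡ false
  remove-self e S rewrite δ-refl e = ∧-zeroʳ (S e)

  -- Only the part of the walk after its last use of `e` matters: every use of `e` restarts the walk
  -- at the end it arrives at.
  reach-split : ∀ {S e u w} → Joins G e u w → ∀ {x v} → Reach G S x v →
    Reach G (remove e S) u x ⊎ Reach G (remove e S) w x → Reach G (remove e S) u v ⊎ Reach G (remove e S) w v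
  reach-split j here h = h
  reach-split {S} {e} j (step f s i p) h with e ≟ f
  ... | yes refl with incident-end j (joins-incident (joins-sym i))
  ...   | inj₁ refl = reach-split j p (inj₁ here)
  ...   | inj₂ refl = reach-split j p (inj₂ here)
  reach-split {S} {e} j (step f s i p) (inj₁ h) | no q = reach-split j p (inj₁ (reach-trans h (step f (remove-≢ S s q) i here)))
  reach-split {S} {e} j (step f s i p) (inj₂ h) | no q = reach-split j p (inj₂ (reach-trans h (step f (remove-≢ S s q) i here)))

  module _ (T : E → Bool) (acyclic : ∀ (D : E → Bool) → (∀ e → D e ≡ true → T e ≡ true) → IsCycle G D → ∀ e → D e ≡ false) where

    -- A detour around `e`, taken mod 2, would close up with `e` to a nonempty even set inside `T`.
    bridge : ∀ {S e u w} → (∀ f → S f ≡ true → T f ≡ true) → S e ≡ true → Joins G e u w → ¬ Reach G (remove e S) u w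
    bridge {S} {e} {u} {w} S⊆T Se j p = true≢false (trans (sym De) (acyclic D D⊆T (∂⇒cycle ∂D) e))
      where
      D : E → Bool
      D f = (δ e f ∧ true) xor walk-set p f
      off : walk-set p e ≡ false
      off with walk-set p e in eq
      ... | false = refl
      ... | true  = ⊥-elim (true≢false (trans (sym (walk-set⊆ p e eq)) (remove-self e S)))
      De : D e ≡ true
      De rewrite δ-refl e | off = refl
      D⊆T : ∀ f → D f ≡ true → T f ≡ true
      D⊆T f q with e ≟ f
      ... | yes refl = S⊆T e Se
      ... | no _     = S⊆T f (remove-⊆ e S f (walk-set⊆ p f q))
      ∂D : ∀ v → ∂ D v ≡ false
      ∂D v = trans (∂-xor _ (walk-set p) v) (trans (cong₂ _xor_ (∂-single j true v) (∂-walk-set p v)) (xor-same (δ u v xor δ w v)))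

    -- Any edge at `u` is taken out and trees are planted at both of its ends in the same smaller
    -- set; since the edge is a bridge, the two trees are disjoint and can be grafted.
    plant : ∀ k S → size S ≤ k → (∀ f → S f ≡ true → T f ≡ true) → ∀ u → Planted S u
    plant k S le S⊆T u with any? (λ e → (S e ∧ (δ (src G e) u ∨ δ (tgt G e) u)) 𝔹.≟ true)
    ... | no none = record
      { bush = bare u ; onceV = λ v → bit≤1 (δ u v) ; onceE = λ _ → z≤n
      ; V⇒reach = λ v p → subst (Reach G S u) (δ-sound (1≤bit p)) here
      ; reach⇒V = λ v p → subst (λ x → 1 ≤ ⟦ δ u x ⟧) (stuck p refl) (bit-true (δ-refl u))
      ; E⇒reach = λ e () ; reach⇒E = λ e s p → ⊥-elim (no-edge e s (inj₁ (sym (stuck p refl)))) }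
      where
      no-edge : ∀ e → S e ≡ true → ¬ ((src G e ≡ u) ⊎ (tgt G e ≡ u))
      no-edge e s (inj₁ q) = none (e , cong₂ _∧_ s (cong (_∨ δ (tgt G e) u) (dec-true (src G e ≟ u) q)))
      no-edge e s (inj₂ q) = none (e , cong₂ _∧_ s (trans (cong (δ (src G e) u ∨_) (dec-true (tgt G e ≟ u) q)) (∨-zeroʳ (δ (src G e) u))))
      stuck : ∀ {x v} → Reach G S x v → x ≡ u → u ≡ v
      stuck here           refl = refl
      stuck (step e s j p) refl = ⊥-elim (no-edge e s (joins-incident j))
    ... | yes (e , h) = grow k le (∧-split {S e} h)
      where
      grow : ∀ k → size S ≤ k → (S e ≡ true) × (δ (src G e) u ∨ δ (tgt G e) u ≡ true) → Planted S u
      grow zero    le (Se , _) with () ← ≤-trans (size-remove e S Se) le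
      grow (suc k) le (Se , i) = join (other-end (∨-true⁻ (δ (src G e) u) i))
        where
        other-end : (δ (src G e) u ≡ true) ⊎ (δ (tgt G e) u ≡ true) → ∃ λ w → Joins G e u w
        other-end (inj₁ p) = tgt G e , inj₁ (δ-sound p , refl)
        other-end (inj₂ p) = src G e , inj₂ (refl , δ-sound p)
        S' : E → Bool
        S' = remove e S
        sub : ∀ x → Planted S' x
        sub = plant k S' (lower (≤-trans (size-remove e S Se) le)) (λ f p → S⊆T f (remove-⊆ e S f p))
        mono : ∀ {x y} → Reach G S' x y → Reach G S x y
        mono = reach-mono (remove-⊆ e S)
        join : (∃ λ w → Joins G e u w) → Planted S u
        join (w , j) = record
          { bush = graft b e j c
          ; onceV = λ v → disjoint-+≤1 (onceV (sub u) v) (onceV (sub w) v)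
              (λ p q → apart (V⇒reach (sub u) v p) (V⇒reach (sub w) v q))
          ; onceE = λ f → disjoint-+≤1 (bit≤1 (δ e f))
              (disjoint-+≤1 (onceE (sub u) f) (onceE (sub w) f)
                (λ p q → apart (proj₂ (E⇒reach (sub u) f p)) (proj₂ (E⇒reach (sub w) f q))))
              (λ p q → new f (δ-sound (1≤bit p)) (1≤+ (cntE b f) q))
          ; V⇒reach = λ v p → toV v (1≤+ (cntV b v) p)
          ; reach⇒V = λ v p → fromV v (reach-split j p (inj₁ here))
          ; E⇒reach = λ f p → toE f (1≤+ ⟦ δ e f ⟧ p)
          ; reach⇒E = λ f s p → fromE f s (e ≟ f) (reach-split j p (inj₁ here)) }
          where
          b : Bush u
          b = bush (sub u)
          c : Bush w
          c = bush (sub w)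
          across : Reach G S u w
          across = step e Se j here
          apart : ∀ {v} → Reach G S' u v → Reach G S' w v → ⊥
          apart p q = bridge S⊆T Se j (reach-trans p (reach-sym q))
          new : ∀ f → e ≡ f → (1 ≤ cntE b f) ⊎ (1 ≤ cntE c f) → ⊥
          new f refl (inj₁ q) = true≢false (trans (sym (proj₁ (E⇒reach (sub u) f q))) (remove-self e S))
          new f refl (inj₂ q) = true≢false (trans (sym (proj₁ (E⇒reach (sub w) f q))) (remove-self e S))
          toV : ∀ v → (1 ≤ cntV b v) ⊎ (1 ≤ cntV c v) → Reach G S u v
          toV v (inj₁ p) = mono (V⇒reach (sub u) v p)
          toV v (inj₂ p) = reach-trans across (mono (V⇒reach (sub w) v p))
          fromV : ∀ v → Reach G S' u v ⊎ Reach G S' w v → 1 ≤ cntV b v + cntV c v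
          fromV v (inj₁ p) = ≤-trans (reach⇒V (sub u) v p) (m≤m+n _ _)
          fromV v (inj₂ p) = ≤-trans (reach⇒V (sub w) v p) (m≤n+m _ _)
          from-start : ∀ {f} → e ≡ f → Reach G S u (src G f)
          from-start refl = at j
            where
            at : Joins G e u w → Reach G S u (src G e)
            at (inj₁ (p , _)) = subst (Reach G S u) (sym p) here
            at (inj₂ (p , _)) = subst (Reach G S u) (sym p) across
          toE : ∀ f → (1 ≤ ⟦ δ e f ⟧) ⊎ (1 ≤ cntE b f + cntE c f) → (S f ≡ true) × Reach G S u (src G f)
          toE f (inj₁ p) = subst (λ x → S x ≡ true) (δ-sound (1≤bit p)) Se , from-start (δ-sound (1≤bit p))
          toE f (inj₂ p) with 1≤+ (cntE b f) p
          ... | inj₁ q = let s , r = E⇒reach (sub u) f q in remove-⊆ e S f s , mono r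
          ... | inj₂ q = let s , r = E⇒reach (sub w) f q in remove-⊆ e S f s , reach-trans across (mono r)
          fromE : ∀ f → S f ≡ true → (d : Dec (e ≡ f)) → Reach G S' u (src G f) ⊎ Reach G S' w (src G f) →
            1 ≤ ⟦ does d ⟧ + (cntE b f + cntE c f)
          fromE f s (yes _) _ = s≤s z≤n
          fromE f s (no q) (inj₁ r) = ≤-trans (reach⇒E (sub u) f (remove-≢ S s q) r) (m≤m+n _ _)
          fromE f s (no q) (inj₂ r) = ≤-trans (reach⇒E (sub w) f (remove-≢ S s q) r) (m≤n+m _ _)

    spanning-bush : ∀ r → (∀ e → T e ≡ true → Reach G T r (src G e)) → Σ (Bush r) (Spans T)
    spanning-bush r conn = bush p , record { edges = λ e → count e (T e) refl ; verts = onceV p }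
      where
      p : Planted T r
      p = plant (size T) T ≤-refl (λ _ q → q) r
      count : ∀ e t → T e ≡ t → cntE (bush p) e ≡ ⟦ t ⟧
      count e true  q with ≤1-cases (onceE p e)
      ... | inj₂ k = k
      ... | inj₁ k with () ← subst (1 ≤_) k (reach⇒E p e q (conn e q))
      count e false q with 0-or-1≤ (cntE (bush p) e)
      ... | inj₁ k = k
      ... | inj₂ k = ⊥-elim (true≢false (trans (sym (proj₁ (E⇒reach p e k))) q))

-- Patterns of colour sums and their orbits under GL(2,2)

Pat : Set
Pat = V4 × V4 × V4

infixl 6 _⊞_
_⊞_ : Pat → Pat → Pat
(x , y , z) ⊞ (x' , y' , z') = x ⊕ x' , y ⊕ y' , z ⊕ z'

∣_∣ₚ : Pat → V4
∣ x , y , z ∣ₚ = x ⊕ y ⊕ z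

coord : Pat → Fin 3 → V4
coord (x , y , z) zero             = x
coord (x , y , z) (suc zero)       = y
coord (x , y , z) (suc (suc zero)) = z

coord-zero : ∀ i → coord (𝟎 , 𝟎 , 𝟎) i ≡ 𝟎
coord-zero zero             = refl
coord-zero (suc zero)       = refl
coord-zero (suc (suc zero)) = refl

single : Fin 3 → V4 → Pat
single zero             x = x , 𝟎 , 𝟎
single (suc zero)       x = 𝟎 , x , 𝟎
single (suc (suc zero)) x = 𝟎 , 𝟎 , x

act : V4 × V4 → V4 → V4
act ((a , b) , (c , d)) (x , y) = (a ∧ x) xor (c ∧ y) , (b ∧ x) xor (d ∧ y)

actₚ : V4 × V4 → Pat → Pat
actₚ γ (x , y , z) = act γ x , act γ y , act γ z

pattern 𝟏 = true  , false
pattern 𝟐 = false , true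
pattern 𝟑 = true  , true

GL : List (V4 × V4)
GL = (𝟏 , 𝟐) ∷ (𝟏 , 𝟑) ∷ (𝟐 , 𝟏) ∷ (𝟐 , 𝟑) ∷ (𝟑 , 𝟏) ∷ (𝟑 , 𝟐) ∷ []

-- A pattern is a 2 by 3 matrix over GF(2), and its orbit is determined by the row space: a subspace
-- of GF(2)³ of dimension at most two, of which there are 1 + 7 + 7.
rep : Vec Pat 15
rep = (𝟎 , 𝟎 , 𝟎) ∷ (𝟎 , 𝟎 , 𝟏) ∷ (𝟎 , 𝟏 , 𝟎) ∷ (𝟎 , 𝟏 , 𝟏) ∷ (𝟎 , 𝟏 , 𝟐) ∷ (𝟏 , 𝟎 , 𝟎) ∷ (𝟏 , 𝟎 , 𝟏) ∷ (𝟏 , 𝟎 , 𝟐) ∷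
      (𝟏 , 𝟏 , 𝟎) ∷ (𝟏 , 𝟏 , 𝟏) ∷ (𝟏 , 𝟏 , 𝟐) ∷ (𝟏 , 𝟐 , 𝟎) ∷ (𝟏 , 𝟐 , 𝟏) ∷ (𝟏 , 𝟐 , 𝟐) ∷ (𝟏 , 𝟐 , 𝟑) ∷ []

Orbits : Set
Orbits = Vec Bool 15

eqB : Bool → Bool → Bool
eqB true  b = b
eqB false b = not b

eqB-sound : ∀ a b → eqB a b ≡ true → a ≡ b
eqB-sound true  true  _ = refl
eqB-sound false false _ = refl

eqV4 : V4 → V4 → Bool
eqV4 (a , b) (c , d) = eqB a c ∧ eqB b d

eqV4-sound : ∀ x y → eqV4 x y ≡ true → x ≡ y
eqV4-sound (a , b) (c , d) p = cong₂ _,_ (eqB-sound a c (proj₁ (∧-split p))) (eqB-sound b d (proj₂ (∧-split {eqB a c} p)))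

eqPat : Pat → Pat → Bool
eqPat (x , y , z) (x' , y' , z') = eqV4 x x' ∧ (eqV4 y y' ∧ eqV4 z z')

eqPat-sound : ∀ s t → eqPat s t ≡ true → s ≡ t
eqPat-sound (x , y , z) (x' , y' , z') p with ∧-split {eqV4 x x'} p
... | px , q with ∧-split {eqV4 y y'} q
...   | py , pz rewrite eqV4-sound x x' px | eqV4-sound y y' py | eqV4-sound z z' pz = refl

anyᵇ allᵇ : ∀ {A : Set} → (A → Bool) → List A → Bool
anyᵇ p []       = false
anyᵇ p (x ∷ xs) = p x ∨ anyᵇ p xs
allᵇ p []       = true
allᵇ p (x ∷ xs) = p x ∧ allᵇ p xs

anyᵇ-sound : ∀ {A : Set} (p : A → Bool) xs → anyᵇ p xs ≡ true → ∃ λ x → (x ∈ xs) × (p x ≡ true)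
anyᵇ-sound p (x ∷ xs) h with p x in eq
... | true  = x , here refl , eq
... | false with anyᵇ-sound p xs h
...   | y , i , q = y , there i , q

allᵇ-sound : ∀ {A : Set} (p : A → Bool) xs → allᵇ p xs ≡ true → ∀ {x} → x ∈ xs → p x ≡ true
allᵇ-sound p (x ∷ xs) h (here refl) = proj₁ (∧-split h)
allᵇ-sound p (x ∷ xs) h (there i)   = allᵇ-sound p xs (proj₂ (∧-split {p x} h)) i

-- Sums of orbits: entry (a , b , o) tells whether orbit o meets the sum of orbits a and b.
sums : Vec (Vec Orbits 15) 15
sums = Vec.map (λ s → Vec.map (λ t → Vec.map (λ r → anyᵇ (λ γ → anyᵇ (λ γ' → eqPat (actₚ γ s ⊞ actₚ γ' t) r) GL) GL) rep) rep) rep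

choose : ∀ {k} → Vec Bool k → Vec Orbits k → Orbits
choose []          []       = replicate 15 false
choose (true  ∷ a) (r ∷ rs) = zipWith _∨_ r (choose a rs)
choose (false ∷ a) (r ∷ rs) = choose a rs

Table : Set
Table = Vec (Vec Orbits 15) 15

rows : Table → Orbits → Vec Orbits 15
rows table B = Vec.map (choose B) table

-- The sum of a pattern is the flow value on the edge by which the limb is attached. Whether it
-- vanishes depends on the orbit alone.
nonzero : Orbits
nonzero = Vec.map (λ s → not (eqV4 ∣ s ∣ₚ 𝟎)) rep

-- Sets of colours

CS : Set
CS = Bool × Bool × Bool

∅ : CS
∅ = false , false , false

infixr 6 _∪_
_∪_ : CS → CS → CS
(a , b , c) ∪ (a' , b' , c') = a ∨ a' , b ∨ b' , c ∨ c'

meets : CS → CS → Bool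
meets (a , b , c) (a' , b' , c') = (a ∧ a') ∨ ((b ∧ b') ∨ (c ∧ c'))

has : CS → Fin 3 → Bool
has (a , b , c) zero             = a
has (a , b , c) (suc zero)       = b
has (a , b , c) (suc (suc zero)) = c

colourSet : Maybe (Fin 3) → CS
colourSet nothing                     = ∅
colourSet (just zero)                 = true , false , false
colourSet (just (suc zero))           = false , true , false
colourSet (just (suc (suc zero)))     = false , false , true

-- A predicate on the eight colour sets is stored as its table of values, so that states are finite
-- data and can be compared.
memo : (CS → Bool) → Vec Bool 8
memo f = f (false , false , false) ∷ f (false , false , true) ∷ f (false , true , false) ∷ f (false , true , true) ∷
         f (true , false , false) ∷ f (true , false , true) ∷ f (true , true , false) ∷ f (true , true , true) ∷ []

recall : Vec Bool 8 → CS → Bool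
recall (x ∷ _)                             (false , false , false) = x
recall (_ ∷ x ∷ _)                         (false , false , true)  = x
recall (_ ∷ _ ∷ x ∷ _)                     (false , true , false)  = x
recall (_ ∷ _ ∷ _ ∷ x ∷ _)                 (false , true , true)   = x
recall (_ ∷ _ ∷ _ ∷ _ ∷ x ∷ _)             (true , false , false)  = x
recall (_ ∷ _ ∷ _ ∷ _ ∷ _ ∷ x ∷ _)         (true , false , true)   = x
recall (_ ∷ _ ∷ _ ∷ _ ∷ _ ∷ _ ∷ x ∷ _)     (true , true , false)   = x
recall (_ ∷ _ ∷ _ ∷ _ ∷ _ ∷ _ ∷ _ ∷ x ∷ _) (true , true , true)    = x

recall-memo : ∀ f S → recall (memo f) S ≡ f S
recall-memo f (false , false , false) = refl
recall-memo f (false , false , true)  = refl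
recall-memo f (false , true , false)  = refl
recall-memo f (false , true , true)   = refl
recall-memo f (true , false , false)  = refl
recall-memo f (true , false , true)   = refl
recall-memo f (true , true , false)   = refl
recall-memo f (true , true , true)    = refl

-- Pieces of the tree left by the Petersen graph minus three independent vertices: mono i has only the colour i, cherry i
-- joins pieces of the two other colours, branch i joins a piece of colour i to cherry i.
data Kind : Set where
  mono cherry branch : Fin 3 → Kind

-- What has been recognised at a root; `none` means nothing usable. `one κ` is an uncoloured root
-- with one child of kind `κ`, `many i` a bush of colour `i` that absorbs every value including
-- zero. `pair i` and `fork i` are completed roots of a cherry and of a branch, `branches i` is an
-- uncoloured root with branches of the two colours other than `i`.
data Tok : Set where
  none empty centre       : Tok
  one                     : Kind → Tok
  many pair fork branches : Fin 3 → Tok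

kind : Tok → Maybe Kind
kind none         = nothing
kind empty        = nothing
kind centre       = nothing
kind (one κ)      = just κ
kind (many i)     = just (mono i)
kind (pair i)     = just (cherry i)
kind (fork i)     = just (branch i)
kind (branches i) = nothing

third : Fin 3 → Fin 3 → Fin 3
third zero             (suc zero)       = suc (suc zero)
third zero             (suc (suc zero)) = suc zero
third (suc zero)       zero             = suc (suc zero)
third (suc zero)       (suc (suc zero)) = zero
third (suc (suc zero)) zero             = suc zero
third (suc (suc zero)) (suc zero)       = zero
third i                _                = i

join : Tok → Maybe Kind → Tok
join empty              (just κ)          = one κ
join (one (mono i))     (just (mono j))   = if δ i j then many i else pair (third i j)
join (one (mono i))     (just (cherry j)) = if δ i j then fork i else none
join (one (cherry i))   (just (mono j))   = if δ i j then fork i else none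
join (one (branch i))   (just (branch j)) = if δ i j then none else branches (third i j)
join (many i)           (just (mono j))   = if δ i j then many i else none
join (branches i)       (just (branch j)) = if δ i j then centre else none
join _                  _                 = none

-- The states of the dynamic programme

-- safe tells which sets of colours outside leave no bridge inside; big records whether some limb points to the Petersen centre.
record Bundle : Set where
  constructor ⟨_,_,_,_,_⟩
  field
    orbits  : Orbits
    colours : CS
    safe    : Vec Bool 8
    big     : Bool
    tok     : Tok
open Bundle public

record Limb : Set where
  constructor ⟪_,_,_,_⟫
  field
    orbits  : Orbits
    colours : CS
    safe    : Vec Bool 8
    shape   : Maybe Kind
module L = Limb

-- Adds the edge above the root. It must carry a nonzero value, and it is no bridge only if some
-- colour below it also occurs outside.
close : Bundle → Limb
close b = ⟪ zipWith _∧_ nonzero (orbits b) , colours b , memo (λ S → recall (safe b) S ∧ meets (colours b) S) , kind (tok b) ⟫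

-- In the use below, the exceptions are the orbits attained by the small side of the edge: one for a
-- piece of a single colour (1, 2, 5), one for a cherry (4, 7, 11), two for a branch.
except : List ℕ → Orbits
except is = zipWith _∧_ nonzero (tabulate λ o → allᵇ (λ i → not (i ≡ᵇ Data.Fin.toℕ o)) is)

eqVec : ∀ {k} → Vec Bool k → Vec Bool k → Bool
eqVec []       []       = true
eqVec (a ∷ as) (b ∷ bs) = eqB a b ∧ eqVec as bs

-- The limbs of the Petersen tree that contain its centre; the numbers are positions in rep.
bigOrbits : List Orbits
bigOrbits = map except ((1 ∷ []) ∷ (2 ∷ []) ∷ (5 ∷ []) ∷ (4 ∷ []) ∷ (7 ∷ []) ∷ (11 ∷ []) ∷
                        (10 ∷ 12 ∷ []) ∷ (10 ∷ 13 ∷ []) ∷ (12 ∷ 13 ∷ []) ∷ [])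

isBig : List Orbits → Limb → Bool
isBig bs e = anyᵇ (eqVec (L.orbits e)) bs

attachWith : List Orbits → Vec Orbits 15 → Bundle → Limb → Bundle
attachWith bs rs b e = ⟨ choose (orbits b) rs , colours b ∪ L.colours e
  , memo (λ S → recall (safe b) (S ∪ L.colours e) ∧ recall (L.safe e) (S ∪ colours b))
  , big b ∨ isBig bs e , join (tok b) (L.shape e) ⟩

attach : Table → List Orbits → Bundle → Limb → Bundle
attach table bs b e = attachWith bs (rows table (L.orbits e)) b e

bareState : Maybe (Fin 3) → Bundle
bareState nothing  = ⟨ tabulate (λ o → eqPat (lookup rep o) (𝟎 , 𝟎 , 𝟎)) , ∅ , replicate 8 true , false , empty ⟩
-- A coloured vertex absorbs any value; all nonzero values form one orbit, represented by `𝟏`.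
bareState (just i) = ⟨ tabulate (λ o → anyᵇ (λ x → eqPat (lookup rep o) (single i x)) (𝟎 ∷ 𝟏 ∷ [])) , colourSet (just i) , replicate 8 true , false , many i ⟩

code : Tok → ℕ
codeK : Kind → ℕ
codeF : Fin 3 → ℕ
codeF i = Data.Fin.toℕ i
codeK (mono i)   = codeF i
codeK (cherry i) = 3 + codeF i
codeK (branch i) = 6 + codeF i
code none         = 0
code empty        = 1
code centre       = 2
code (one κ)      = 3 + codeK κ
code (many i)     = 12 + codeF i
code (pair i)     = 15 + codeF i
code (fork i)     = 18 + codeF i
code (branches i) = 21 + codeF i

codeM : Maybe Kind → ℕ
codeM nothing  = 0
codeM (just κ) = suc (codeK κ)

eqCS : CS → CS → Bool
eqCS (a , b , c) (a' , b' , c') = eqB a a' ∧ (eqB b b' ∧ eqB c c')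

eqBundle : Bundle → Bundle → Bool
eqBundle x y = eqVec (orbits x) (orbits y) ∧ (eqB (big x) (big y) ∧ ((code (tok x) ≡ᵇ code (tok y)) ∧ (eqCS (colours x) (colours y) ∧ eqVec (safe x) (safe y))))
eqLimb : Limb → Limb → Bool
eqLimb x y = eqVec (L.orbits x) (L.orbits y) ∧ ((codeM (L.shape x) ≡ᵇ codeM (L.shape y)) ∧ (eqCS (L.colours x) (L.colours y) ∧ eqVec (L.safe x) (L.safe y)))
nth : ∀ {A : Set} → A → List A → ℕ → A
nth d []       _       = d
nth d (x ∷ xs) zero    = x
nth d (x ∷ xs) (suc k) = nth d xs k

derive : Table → List Orbits → List Bundle → List (ℕ × ℕ) → List Bundle
derive table big bs []            = bs
derive table big bs ((i , j) ∷ s) = derive table big (attach table big (nth (bareState nothing) bs i) (close (nth (bareState nothing) bs j)) ∷ bs) s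

-- All states reachable from the bare ones: (i , j) attaches the j-th most recently derived state to the i-th.
statesFrom : Table → List Orbits → List Bundle
statesFrom table big = derive table big (bareState (just (# 2)) ∷ bareState (just (# 1)) ∷ bareState (just (# 0)) ∷ bareState nothing ∷ [])
  (
    (3 , 3) ∷ (3 , 4) ∷ (3 , 5) ∷ (3 , 6) ∷ (7 , 6) ∷ (6 , 7) ∷ (6 , 8) ∷ (10 , 8) ∷ (10 , 9) ∷ (9 , 10) ∷
    (13 , 10) ∷ (13 , 11) ∷ (13 , 12) ∷ (7 , 16) ∷ (7 , 17) ∷ (5 , 18) ∷ (10 , 18) ∷ (10 , 19) ∷ (10 , 20) ∷
    (9 , 21) ∷ (9 , 22) ∷ (8 , 23) ∷ (12 , 23) ∷ (12 , 24) ∷ (12 , 25) ∷ (15 , 23) ∷ (29 , 20) ∷ (27 , 21) ∷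
    (21 , 22) ∷ (19 , 23) ∷ (19 , 24) ∷ (19 , 25) ∷ (35 , 25) ∷ (34 , 26) ∷ (26 , 27) ∷ (26 , 28) ∷
    (39 , 27) ∷ (37 , 28) ∷ (27 , 29) ∷ (42 , 29) ∷ (42 , 30) ∷ (36 , 31) ∷ (45 , 30) ∷ (44 , 31) ∷
    (36 , 32) ∷ (48 , 32) ∷ (48 , 33) ∷ (42 , 34) ∷ (24 , 50) ∷ (16 , 43) ∷ (10 , 41) ∷ (5 , 39) ∷ (55 , 35) ∷
    (53 , 36) ∷ (43 , 37) ∷ (58 , 37) ∷ (57 , 38) ∷ (49 , 39) ∷ (61 , 39) ∷ (59 , 40) ∷ (49 , 41) ∷
    (28 , 42) ∷ (22 , 43) ∷ (66 , 43) ∷ (67 , 43) ∷ (66 , 44) ∷ (58 , 45) ∷ (40 , 46) ∷ (22 , 47) ∷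
    (72 , 47) ∷ (73 , 47) ∷ (73 , 48) ∷ (67 , 49) ∷ (76 , 49) ∷ (76 , 50) ∷ (70 , 51) ∷ (39 , 52) ∷
    (34 , 53) ∷ (81 , 53) ∷ (82 , 51) ∷ (83 , 51) ∷ (84 , 51) ∷ (85 , 51) ∷ (40 , 52) ∷ (87 , 52) ∷
    (88 , 51) ∷ (89 , 51) ∷ (90 , 51) ∷ (91 , 50) ∷ (92 , 50) ∷ (93 , 49) ∷ (94 , 49) ∷ (95 , 48) ∷
    (96 , 48) ∷ (97 , 47) ∷ (98 , 47) ∷ (31 , 77) ∷ (23 , 78) ∷ (24 , 77) ∷ (102 , 50) ∷ (41 , 51) ∷
    (36 , 52) ∷ (28 , 53) ∷ (106 , 53) ∷ (107 , 53) ∷ (108 , 53) ∷ (109 , 52) ∷ (110 , 52) ∷ (111 , 51) ∷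
    (112 , 51) ∷ (113 , 50) ∷ (106 , 51) ∷ (104 , 52) ∷ (116 , 52) ∷ (109 , 53) ∷ (107 , 54) ∷ (119 , 54) ∷
    (120 , 54) ∷ (121 , 52) ∷ (114 , 53) ∷ (123 , 53) ∷ (116 , 54) ∷ (111 , 55) ∷ (126 , 55) ∷ (127 , 55) ∷
    (128 , 53) ∷ (129 , 53) ∷ (130 , 52) ∷ (131 , 52) ∷ (121 , 53) ∷ (119 , 54) ∷ (134 , 54) ∷ (135 , 54) ∷
    (136 , 49) ∷ (13 , 73) ∷ (6 , 74) ∷ (7 , 69) ∷ (140 , 40) ∷ (133 , 41) ∷ (142 , 41) ∷ (132 , 42) ∷
    (144 , 42) ∷ (131 , 43) ∷ (146 , 42) ∷ (147 , 42) ∷ (148 , 42) ∷ (149 , 34) ∷ (150 , 34) ∷ (151 , 33) ∷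
    (152 , 33) ∷ (153 , 30) ∷ (154 , 29) ∷ (155 , 29) ∷ (156 , 23) ∷ (157 , 23) ∷ (18 , 94) ∷ (159 , 21) ∷
    (159 , 22) ∷ (157 , 23) ∷ (154 , 24) ∷ (152 , 25) ∷ (87 , 26) ∷ (86 , 27) ∷ (166 , 27) ∷ (156 , 28) ∷
    (100 , 29) ∷ (169 , 29) ∷ (156 , 30) ∷ (109 , 31) ∷ (172 , 30) ∷ (173 , 29) ∷ (174 , 28) ∷ (175 , 12) ∷
    (176 , 11) ∷ (176 , 12) ∷ (178 , 10) ∷ (179 , 10) ∷ (178 , 11) ∷ (181 , 10) ∷ (182 , 10) ∷ (180 , 11) ∷ [])

limbsOf : List Bundle → List Limb
limbsOf = foldr (λ b es → if anyᵇ (eqLimb (close b)) es then es else close b ∷ es) []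

-- Search trees over the orbit sets keep the closure check fast.
data Trie : ℕ → Set where
  leaf : List Bundle → Trie 0
  node : ∀ {k} → Trie k → Trie k → Trie (suc k)

find : ∀ {k} → Trie k → Vec Bool k → List Bundle
find (leaf xs)  []          = xs
find (node l r) (true  ∷ v) = find l v
find (node l r) (false ∷ v) = find r v

tails : ∀ {k} → Bool → List (Vec Bool (suc k) × Bundle) → List (Vec Bool k × Bundle)
tails c []                 = []
tails c ((b ∷ v , x) ∷ xs) = if eqB b c then (v , x) ∷ tails c xs else tails c xs

build : ∀ k → List (Vec Bool k × Bundle) → Trie k
build zero    xs = leaf (map proj₂ xs)
build (suc k) xs = node (build k (tails true xs)) (build k (tails false xs))

trie : ∀ k → (Bundle → Vec Bool k) → List Bundle → Trie k
trie k key bs = build k (map (λ b → key b , b) bs)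

-- The finite check

closedUnder : Table → List Orbits → List Bundle → Trie 15 → List Limb → Bool
closedUnder table big bs t es =
  allᵇ (λ b → anyᵇ (eqLimb (close b)) es) bs ∧ allᵇ (λ e → inner (rows table (L.orbits e)) e) es
  where
  member : Bundle → Bool
  member x = anyᵇ (eqBundle x) (find t (orbits x))
  inner : Vec Orbits 15 → Limb → Bool
  inner rs e = allᵇ (λ b → member (attachWith big rs b e)) bs

zeroIn : Bundle → Bool
zeroIn b = Vec.head (orbits b)

bareState-big : ∀ c → big (bareState c) ≡ false
bareState-big nothing  = refl
bareState-big (just i) = refl

-- Only the Petersen structure fails, and if one side of an edge is big then the other side is not.
failures : Table → List Orbits → List Bundle → List Limb → Bool
failures table big bs es =
  -- No colour outside means that the bundle is the whole tree; `2` is the code of `centre`.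
  allᵇ (λ b → not (recall (safe b) ∅) ∨ (zeroIn b ∨ (Bundle.big b ∨ (code (tok b) ≡ᵇ 2)))) bs ∧
  allᵇ (λ e → not (isBig big e) ∨ inner (rows table (L.orbits e)) e) es
  where
  inner : Vec Orbits 15 → Limb → Bool
  inner rs e = allᵇ (λ b → fine (attachWith big rs b e) b) bs
    where
    fine : Bundle → Bundle → Bool
    fine x b = not (recall (safe x) ∅) ∨ (zeroIn x ∨ not (isBig big (close b)))

allColours : List (Maybe (Fin 3))
allColours = nothing ∷ just (# 0) ∷ just (# 1) ∷ just (# 2) ∷ []

check : Table → List Orbits → List Bundle → Trie 15 → List Limb → Bool
check table big bs t es = closedUnder table big bs t es ∧ (failures table big bs es ∧
  allᵇ (λ c → anyᵇ (eqBundle (bareState c)) bs) allColours)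

-- From Boolean tests to equalities and memberships

kinds : List Kind
kinds = mono (# 0) ∷ mono (# 1) ∷ mono (# 2) ∷ cherry (# 0) ∷ cherry (# 1) ∷ cherry (# 2) ∷
        branch (# 0) ∷ branch (# 1) ∷ branch (# 2) ∷ []

decodeK : ℕ → Kind
decodeK = nth (mono (# 0)) kinds

decode : ℕ → Tok
decode = nth none (none ∷ empty ∷ centre ∷ map one kinds ++ many (# 0) ∷ many (# 1) ∷ many (# 2) ∷
  pair (# 0) ∷ pair (# 1) ∷ pair (# 2) ∷ fork (# 0) ∷ fork (# 1) ∷ fork (# 2) ∷
  branches (# 0) ∷ branches (# 1) ∷ branches (# 2) ∷ [])

all-Fin3 : ∀ {P : Fin 3 → Set} → P (# 0) → P (# 1) → P (# 2) → ∀ i → P i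
all-Fin3 p q r zero             = p
all-Fin3 p q r (suc zero)       = q
all-Fin3 p q r (suc (suc zero)) = r

decode-codeK : ∀ κ → decodeK (codeK κ) ≡ κ
decode-codeK (mono i)   = all-Fin3 {λ i → decodeK (codeK (mono i)) ≡ mono i} refl refl refl i
decode-codeK (cherry i) = all-Fin3 {λ i → decodeK (codeK (cherry i)) ≡ cherry i} refl refl refl i
decode-codeK (branch i) = all-Fin3 {λ i → decodeK (codeK (branch i)) ≡ branch i} refl refl refl i

decode-code : ∀ t → decode (code t) ≡ t
decode-code none   = refl
decode-code empty  = refl
decode-code centre = refl
decode-code (one (mono i))   = all-Fin3 {λ i → decode (code (one (mono i))) ≡ one (mono i)} refl refl refl i
decode-code (one (cherry i)) = all-Fin3 {λ i → decode (code (one (cherry i))) ≡ one (cherry i)} refl refl refl i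
decode-code (one (branch i)) = all-Fin3 {λ i → decode (code (one (branch i))) ≡ one (branch i)} refl refl refl i
decode-code (many i)     = all-Fin3 {λ i → decode (code (many i)) ≡ many i} refl refl refl i
decode-code (pair i)     = all-Fin3 {λ i → decode (code (pair i)) ≡ pair i} refl refl refl i
decode-code (fork i)     = all-Fin3 {λ i → decode (code (fork i)) ≡ fork i} refl refl refl i
decode-code (branches i) = all-Fin3 {λ i → decode (code (branches i)) ≡ branches i} refl refl refl i

≡ᵇ-sound : ∀ {k l} → (k ≡ᵇ l) ≡ true → k ≡ l
≡ᵇ-sound {k} {l} p = ≡ᵇ⇒≡ k l (subst T (sym p) tt)

code-injective : ∀ {s t} → code s ≡ code t → s ≡ t
code-injective {s} {t} p = trans (sym (decode-code s)) (trans (cong decode p) (decode-code t))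

codeM-injective : ∀ {s t} → codeM s ≡ codeM t → s ≡ t
codeM-injective {nothing} {nothing} p = refl
codeM-injective {just κ} {just κ'} p = cong just (trans (sym (decode-codeK κ)) (trans (cong decodeK (pred p)) (decode-codeK κ')))
  where
  pred : ∀ {k l} → suc k ≡ suc l → k ≡ l
  pred refl = refl

eqVec-sound : ∀ {k} (v w : Vec Bool k) → eqVec v w ≡ true → v ≡ w
eqVec-sound []      []      p = refl
eqVec-sound (a ∷ v) (b ∷ w) p = cong₂ _∷_ (eqB-sound a b (proj₁ (∧-split p))) (eqVec-sound v w (proj₂ (∧-split {eqB a b} p)))

eqCS-sound : ∀ x y → eqCS x y ≡ true → x ≡ y
eqCS-sound (a , b , c) (a' , b' , c') p with ∧-split {eqB a a'} p
... | p₁ , q with ∧-split {eqB b b'} q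
...   | p₂ , p₃ rewrite eqB-sound a a' p₁ | eqB-sound b b' p₂ | eqB-sound c c' p₃ = refl

eqBundle-sound : ∀ x y → eqBundle x y ≡ true → x ≡ y
eqBundle-sound ⟨ r , q , s , h , t ⟩ ⟨ r' , q' , s' , h' , t' ⟩ p with ∧-split {eqVec r r'} p
... | p₁ , p with ∧-split {eqB h h'} p
...   | p₂ , p with ∧-split {code t ≡ᵇ code t'} p
...     | p₃ , p with ∧-split {eqCS q q'} p
...       | p₄ , p₅ rewrite eqVec-sound r r' p₁ | eqB-sound h h' p₂ | code-injective {t} {t'} (≡ᵇ-sound p₃)
                          | eqCS-sound q q' p₄ | eqVec-sound s s' p₅ = refl

eqLimb-sound : ∀ x y → eqLimb x y ≡ true → x ≡ y
eqLimb-sound ⟪ r , q , s , t ⟫ ⟪ r' , q' , s' , t' ⟫ p with ∧-split {eqVec r r'} p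
... | p₁ , p with ∧-split {codeM t ≡ᵇ codeM t'} p
...   | p₃ , p with ∧-split {eqCS q q'} p
...     | p₄ , p₅ rewrite eqVec-sound r r' p₁ | codeM-injective {t} {t'} (≡ᵇ-sound p₃)
                        | eqCS-sound q q' p₄ | eqVec-sound s s' p₅ = refl

tails-sound : ∀ {k} c (xs : List (Vec Bool (suc k) × Bundle)) {v y} → (v , y) ∈ tails c xs → ∃ λ v' → (v' , y) ∈ xs
tails-sound c ((b ∷ v , x) ∷ xs) i with eqB b c
tails-sound c ((b ∷ v , x) ∷ xs) (here refl) | true = (b ∷ v) , here refl
tails-sound c ((b ∷ v , x) ∷ xs) (there i)   | true with tails-sound c xs i
... | v' , j = v' , there j
tails-sound c ((b ∷ v , x) ∷ xs) i           | false with tails-sound c xs i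
... | v' , j = v' , there j

map-proj₂-∈ : ∀ {A : Set} {xs : List (A × Bundle)} {y} → y ∈ map proj₂ xs → ∃ λ a → (a , y) ∈ xs
map-proj₂-∈ {xs = (a , x) ∷ xs} (here refl) = a , here refl
map-proj₂-∈ {xs = (a , x) ∷ xs} (there i) with map-proj₂-∈ i
... | a' , j = a' , there j

find-build : ∀ k xs (v : Vec Bool k) {y} → y ∈ find (build k xs) v → ∃ λ v' → (v' , y) ∈ xs
find-build zero    xs []          i = map-proj₂-∈ i
find-build (suc k) xs (true  ∷ v) i = tails-sound true xs (proj₂ (find-build k (tails true xs) v i))
find-build (suc k) xs (false ∷ v) i = tails-sound false xs (proj₂ (find-build k (tails false xs) v i))

pairs-∈ : ∀ {A : Set} (key : Bundle → A) bs {v y} → (v , y) ∈ map (λ b → key b , b) bs → y ∈ bs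
pairs-∈ key (x ∷ bs) (here refl) = here refl
pairs-∈ key (x ∷ bs) (there i)   = there (pairs-∈ key bs i)

find-trie : ∀ k key bs v {y} → y ∈ find (trie k key bs) v → y ∈ bs
find-trie k key bs v i = pairs-∈ key bs (proj₂ (find-build k _ v i))

-- The data of the check are parameters, so that its consequences are derived without evaluating any
-- table.
module Checked (table : Table) (bigs : List Orbits) (bs : List Bundle) (t : Trie 15) (es : List Limb)
               (⊆bs : ∀ v {y} → y ∈ find t v → y ∈ bs) (passed : check table bigs bs t es ≡ true) where

  infixl 5 _▹′_
  _▹′_ : Bundle → Bundle → Bundle
  b ▹′ c = attach table bigs b (close c)

  private
    parts = ∧-split {closedUnder table bigs bs t es} passed
    parts₁ = ∧-split {allᵇ (λ b → anyᵇ (eqLimb (close b)) es) bs} (proj₁ parts)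
    parts₂ = ∧-split {failures table bigs bs es} (proj₂ parts)
    parts₃ = ∧-split {allᵇ (λ b → not (recall (safe b) ∅) ∨ (zeroIn b ∨ (Bundle.big b ∨ (code (tok b) ≡ᵇ 2)))) bs} (proj₁ parts₂)

    limb-∈ : ∀ {b} → b ∈ bs → close b ∈ es
    limb-∈ {b} i with anyᵇ-sound _ es (allᵇ-sound _ bs (proj₁ parts₁) i)
    ... | e , j , q = subst (_∈ es) (sym (eqLimb-sound (close b) e q)) j

    colour-∈ : ∀ c → c ∈ allColours
    colour-∈ nothing                 = here refl
    colour-∈ (just zero)             = there (here refl)
    colour-∈ (just (suc zero))       = there (there (here refl))
    colour-∈ (just (suc (suc zero))) = there (there (there (here refl)))

    ∨-elim : ∀ {a b} → not a ∨ b ≡ true → a ≡ true → b ≡ true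
    ∨-elim {true} p _ = p

  bare-∈′ : ∀ c → bareState c ∈ bs
  bare-∈′ c with anyᵇ-sound (eqBundle (bareState c)) bs
      (allᵇ-sound (λ c → anyᵇ (eqBundle (bareState c)) bs) allColours (proj₂ parts₂) (colour-∈ c))
  ... | x , i , q = subst (_∈ bs) (sym (eqBundle-sound (bareState c) x q)) i

  ▹-∈′ : ∀ {b c} → b ∈ bs → c ∈ bs → (b ▹′ c) ∈ bs
  ▹-∈′ {b} {c} i j with anyᵇ-sound _ (find t (orbits (b ▹′ c)))
      (allᵇ-sound _ bs (allᵇ-sound _ es (proj₂ parts₁) (limb-∈ j)) i)
  ... | x , k , q = subst (_∈ bs) (sym (eqBundle-sound (b ▹′ c) x q)) (⊆bs (orbits (b ▹′ c)) k)

  failing-centre′ : ∀ {b} → b ∈ bs → recall (safe b) ∅ ≡ true → zeroIn b ≡ false → big b ≡ false → tok b ≡ centre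
  failing-centre′ {b} i s z h with allᵇ-sound _ bs (proj₁ parts₃) i
  ... | p rewrite s | z | h = code-injective {tok b} {centre} (≡ᵇ-sound p)

  failing-big′ : ∀ {b c} → b ∈ bs → c ∈ bs → isBig bigs (close c) ≡ true →
    recall (safe (b ▹′ c)) ∅ ≡ true → zeroIn (b ▹′ c) ≡ false → isBig bigs (close b) ≡ false
  failing-big′ {b} {c} i j h s z =
    conclude (recall (safe (b ▹′ c)) ∅) (zeroIn (b ▹′ c)) (isBig bigs (close b)) s z
      (allᵇ-sound _ bs (∨-elim (allᵇ-sound _ es (proj₂ parts₃) (limb-∈ j)) h) i)
    where
    conclude : ∀ x y w → x ≡ true → y ≡ false → not x ∨ (y ∨ not w) ≡ true → w ≡ false
    conclude true false false _ _ _ = refl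

infixl 5 _▹_
_▹_ : Bundle → Bundle → Bundle
b ▹ c = attach sums bigOrbits b (close c)

abstract
  states : List Bundle
  states = statesFrom sums bigOrbits

  -- One evaluation settles the whole case analysis. Outside this block `states` is known only
  -- through the four facts that follow.
  all-checks : check sums bigOrbits states (trie 15 orbits states) (limbsOf states) ≡ true
  all-checks = refl

  private
    module C = Checked sums bigOrbits states (trie 15 orbits states) (limbsOf states) (find-trie 15 orbits states) all-checks

  bare-∈ : ∀ c → bareState c ∈ states
  bare-∈ = C.bare-∈′

  ▹-∈ : ∀ {b c} → b ∈ states → c ∈ states → (b ▹ c) ∈ states
  ▹-∈ = C.▹-∈′

  failing-centre : ∀ {b} → b ∈ states → recall (safe b) ∅ ≡ true → zeroIn b ≡ false → big b ≡ false → tok b ≡ centre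
  failing-centre = C.failing-centre′

  failing-big : ∀ {b c} → b ∈ states → c ∈ states → isBig bigOrbits (close c) ≡ true →
    recall (safe (b ▹ c)) ∅ ≡ true → zeroIn (b ▹ c) ≡ false → isBig bigOrbits (close b) ≡ false
  failing-big = C.failing-big′

-- Soundness of the orbit sums; the action of GL(2,2) on patterns

choose-sound : ∀ {k} (A : Vec Bool k) rs o → lookup (choose A rs) o ≡ true →
  ∃ λ a → (lookup A a ≡ true) × (lookup (lookup rs a) o ≡ true)
choose-sound [] [] o p = ⊥-elim (true≢false (trans (sym p) (lookup-replicate o false)))
choose-sound (false ∷ A) (r ∷ rs) o p with choose-sound A rs o p
... | a , q , q' = suc a , q , q'
choose-sound (true ∷ A) (r ∷ rs) o p with ∨-true⁻ (lookup r o) (trans (sym (lookup-zipWith _∨_ o r (choose A rs))) p)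
... | inj₁ q = zero , refl , q
... | inj₂ q with choose-sound A rs o q
...   | a , q , q' = suc a , q , q'

lookup-map³ : ∀ {A B C D : Set} {k l n} (f : A → B → C → D) (xs : Vec A k) (ys : Vec B l) (zs : Vec C n) a b c →
  lookup (lookup (lookup (Vec.map (λ x → Vec.map (λ y → Vec.map (f x y) zs) ys) xs) a) b) c ≡ f (lookup xs a) (lookup ys b) (lookup zs c)
lookup-map³ f xs ys zs a b c = trans (cong (λ r → lookup (lookup r b) c) (lookup-map a _ xs))
  (trans (cong (λ r → lookup r c) (lookup-map b _ ys)) (lookup-map c _ zs))

∣⊞∣ : ∀ s t → ∣ s ⊞ t ∣ₚ ≡ ∣ s ∣ₚ ⊕ ∣ t ∣ₚ
∣⊞∣ ((a , b) , (c , d) , (e , f)) ((a' , b') , (c' , d') , (e' , f')) = cong₂ _,_ (identity a c e a' c' e') (identity b d f b' d' f')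
  where
  identity : ∀ a b c x y z → ((a xor x) xor (b xor y)) xor (c xor z) ≡ ((a xor b) xor c) xor ((x xor y) xor z)
  identity = solve 6 (λ a b c x y z → ((a :+ x) :+ (b :+ y)) :+ (c :+ z) := ((a :+ b) :+ c) :+ ((x :+ y) :+ z)) refl

∣single∣ : ∀ i x → ∣ single i x ∣ₚ ≡ x
∣single∣ zero             (a , b) = cong₂ _,_ (trans (xor-identityʳ _) (xor-identityʳ a)) (trans (xor-identityʳ _) (xor-identityʳ b))
∣single∣ (suc zero)       (a , b) = cong₂ _,_ (xor-identityʳ a) (xor-identityʳ b)
∣single∣ (suc (suc zero)) x       = refl

coord-⊞ : ∀ s t i → coord (s ⊞ t) i ≡ coord s i ⊕ coord t i
coord-⊞ s t zero             = refl
coord-⊞ s t (suc zero)       = refl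
coord-⊞ s t (suc (suc zero)) = refl

coord-single : ∀ i j x → coord (single i x) j ≡ (if δ i j then x else 𝟎)
coord-single zero             zero             x = refl
coord-single zero             (suc zero)       x = refl
coord-single zero             (suc (suc zero)) x = refl
coord-single (suc zero)       zero             x = refl
coord-single (suc zero)       (suc zero)       x = refl
coord-single (suc zero)       (suc (suc zero)) x = refl
coord-single (suc (suc zero)) zero             x = refl
coord-single (suc (suc zero)) (suc zero)       x = refl
coord-single (suc (suc zero)) (suc (suc zero)) x = refl

act-⊕ : ∀ γ x y → act γ (x ⊕ y) ≡ act γ x ⊕ act γ y
act-⊕ ((a , b) , (c , d)) (x , y) (x' , y') = cong₂ _,_ (identity a c x y x' y') (identity b d x y x' y')
  where
  identity : ∀ a c x y x' y' → (a ∧ (x xor x')) xor (c ∧ (y xor y')) ≡ ((a ∧ x) xor (c ∧ y)) xor ((a ∧ x') xor (c ∧ y'))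
  identity = solve 6 (λ a c x y x' y' → (a :* (x :+ x')) :+ (c :* (y :+ y')) := ((a :* x) :+ (c :* y)) :+ ((a :* x') :+ (c :* y'))) refl

act-𝟎 : ∀ γ → act γ 𝟎 ≡ 𝟎
act-𝟎 ((a , b) , (c , d)) = cong₂ _,_ (cong₂ _xor_ (∧-zeroʳ a) (∧-zeroʳ c)) (cong₂ _xor_ (∧-zeroʳ b) (∧-zeroʳ d))

actₚ-single : ∀ γ i x → actₚ γ (single i x) ≡ single i (act γ x)
actₚ-single γ zero             x = cong₂ _,_ refl (cong₂ _,_ (act-𝟎 γ) (act-𝟎 γ))
actₚ-single γ (suc zero)       x = cong₂ _,_ (act-𝟎 γ) (cong₂ _,_ refl (act-𝟎 γ))
actₚ-single γ (suc (suc zero)) x = cong₂ _,_ (act-𝟎 γ) (cong₂ _,_ (act-𝟎 γ) refl)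

actₚ-⊞ : ∀ γ s t → actₚ γ (s ⊞ t) ≡ actₚ γ s ⊞ actₚ γ t
actₚ-⊞ γ (x , y , z) (x' , y' , z') = cong₂ _,_ (act-⊕ γ x x') (cong₂ _,_ (act-⊕ γ y y') (act-⊕ γ z z'))

∣actₚ∣ : ∀ γ s → ∣ actₚ γ s ∣ₚ ≡ act γ ∣ s ∣ₚ
∣actₚ∣ γ (x , y , z) = sym (trans (act-⊕ γ (x ⊕ y) z) (cong (_⊕ act γ z) (act-⊕ γ x y)))

not-eqV4 : ∀ {x} → not (eqV4 x 𝟎) ≡ true → x ≢ 𝟎
not-eqV4 () refl

act-faithful : ∀ {γ} → γ ∈ GL → ∀ x → act γ x ≡ 𝟎 → x ≡ 𝟎
act-faithful {γ} i (false , false) p = refl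
act-faithful {γ} i 𝟏 p = ⊥-elim (not-eqV4 (allᵇ-sound (λ γ → not (eqV4 (act γ 𝟏) 𝟎)) GL refl i) p)
act-faithful {γ} i 𝟐 p = ⊥-elim (not-eqV4 (allᵇ-sound (λ γ → not (eqV4 (act γ 𝟐) 𝟎)) GL refl i) p)
act-faithful {γ} i 𝟑 p = ⊥-elim (not-eqV4 (allᵇ-sound (λ γ → not (eqV4 (act γ 𝟑) 𝟎)) GL refl i) p)

-- Flows on rooted trees

module Dynamic (G : Graph) (col : Fin (n G) → Maybe (Fin 3)) where
  open Boundary G
  open Bushes G

  st : ∀ {u} → Bush u → Bundle
  st (bare u)        = bareState (col u)
  st (graft b e j c) = st b ▹ st c

  st-∈ : ∀ {u} (b : Bush u) → st b ∈ states
  st-∈ (bare u)        = bare-∈ (col u)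
  st-∈ (graft b e j c) = ▹-∈ (st-∈ b) (st-∈ c)

  -- A nowhere-zero flow on a bush: coloured vertices absorb arbitrary values, summing to the given pattern.
  data Flow : ∀ {u} → Bush u → Pat → Set where
    bare₀ : ∀ {u} → col u ≡ nothing → Flow (bare u) (𝟎 , 𝟎 , 𝟎)
    bare₁ : ∀ {u i} → col u ≡ just i → ∀ x → Flow (bare u) (single i x)
    graft : ∀ {u w} {b : Bush u} {e} {j : Joins G e u w} {c : Bush w} {s t} →
      Flow b s → Flow c t → ∣ t ∣ₚ ≢ 𝟎 → Flow (graft b e j c) (s ⊞ t)

  flow-act : ∀ {γ u} {b : Bush u} {s} → γ ∈ GL → Flow b s → Flow b (actₚ γ s)
  flow-act {γ} i (bare₀ p) = subst (Flow _) (sym (cong₂ _,_ (act-𝟎 γ) (cong₂ _,_ (act-𝟎 γ) (act-𝟎 γ)))) (bare₀ p)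
  flow-act {γ} i (bare₁ {i = k} p x) = subst (Flow _) (sym (actₚ-single γ k x)) (bare₁ p (act γ x))
  flow-act {γ} i (graft {s = s} {t} F F' h) = subst (Flow _) (sym (actₚ-⊞ γ s t))
    (graft (flow-act i F) (flow-act i F') (λ q → h (act-faithful i ∣ t ∣ₚ (trans (sym (∣actₚ∣ γ t)) q))))

  -- An orbit enters a sum only through two group elements that move representatives of the summands
  -- onto a decomposition of its own representative; the flows of both sides are moved by the same
  -- elements, which keeps them nowhere zero.
  orbits-sound : ∀ {u} (b : Bush u) o → lookup (orbits (st b)) o ≡ true → Flow b (lookup rep o)
  orbits-sound (bare u) o p with col u in eq
  ... | nothing = subst (Flow (bare u)) (sym (eqPat-sound _ _ (trans (sym (lookup∘tabulate (λ o → eqPat (lookup rep o) (𝟎 , 𝟎 , 𝟎)) o)) p))) (bare₀ eq)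
  ... | just i with anyᵇ-sound (λ x → eqPat (lookup rep o) (single i x)) (𝟎 ∷ 𝟏 ∷ [])
                     (trans (sym (lookup∘tabulate (λ o → anyᵇ (λ x → eqPat (lookup rep o) (single i x)) (𝟎 ∷ 𝟏 ∷ [])) o)) p)
  ...   | x , _ , q = subst (Flow (bare u)) (sym (eqPat-sound _ _ q)) (bare₁ eq x)
  orbits-sound (graft b e j c) o p = combine (choose-sound (orbits (st b)) (rows sums (L.orbits (close (st c)))) o p)
    where
    B : Orbits
    B = L.orbits (close (st c))
    summed : V4 × V4 → V4 × V4 → Pat → Pat → Pat → Bool
    summed γ γ' s t r = eqPat (actₚ γ s ⊞ actₚ γ' t) r
    combine : (∃ λ a → (lookup (orbits (st b)) a ≡ true) × (lookup (lookup (rows sums B) a) o ≡ true)) →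
      Flow (graft b e j c) (lookup rep o)
    combine (a , pa , q) = combine₁ (choose-sound B (lookup sums a) o (trans (sym (cong (λ r → lookup r o) (lookup-map a (choose B) sums))) q))
      where
      combine₁ : (∃ λ a' → (lookup B a' ≡ true) × (lookup (lookup (lookup sums a) a') o ≡ true)) → Flow (graft b e j c) (lookup rep o)
      combine₁ (a' , pa' , q') = combine₂ (anyᵇ-sound (λ γ → anyᵇ (λ γ' → summed γ γ' (lookup rep a) (lookup rep a') (lookup rep o)) GL) GL (trans (sym (lookup-map³ (λ s t r → anyᵇ (λ γ → anyᵇ (λ γ' → summed γ γ' s t r) GL) GL) rep rep rep a a' o)) q'))
        where
        nz : (lookup nonzero a' ≡ true) × (lookup (orbits (st c)) a' ≡ true)
        nz = ∧-split (trans (sym (lookup-zipWith _∧_ a' nonzero (orbits (st c)))) pa')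
        combine₂ : (∃ λ γ → (γ ∈ GL) × (anyᵇ (λ γ' → summed γ γ' (lookup rep a) (lookup rep a') (lookup rep o)) GL ≡ true)) → Flow (graft b e j c) (lookup rep o)
        combine₂ (γ , i , r) with anyᵇ-sound (λ γ' → summed γ γ' (lookup rep a) (lookup rep a') (lookup rep o)) GL r
        ... | γ' , i' , r' = subst (Flow _) (eqPat-sound _ _ r')
          (graft (flow-act i (orbits-sound b a pa)) (flow-act i' (orbits-sound c a' (proj₂ nz)))
            (λ z → not-eqV4 (trans (sym (lookup-map a' (λ s → not (eqV4 ∣ s ∣ₚ 𝟎)) rep)) (proj₁ nz))
              (act-faithful i' _ (trans (sym (∣actₚ∣ γ' (lookup rep a'))) z))))

  -- The value absorbed at each vertex, that is, the boundary which the flow demands there from a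
  -- lift to `C`.
  abs : ∀ {u} {b : Bush u} {s} → Flow b s → V → V4
  abs (bare₀ _)            v = 𝟎
  abs (bare₁ {u = u} _ x)  v = if δ u v then x else 𝟎
  abs (graft F F' _)       v = abs F v ⊕ abs F' v

  abs-uncoloured : ∀ {u} {b : Bush u} {s} (F : Flow b s) v → col v ≡ nothing → abs F v ≡ 𝟎
  abs-uncoloured (bare₀ _) v p = refl
  abs-uncoloured (bare₁ {u = u} q x) v p with u ≟ v
  ... | no _ = refl
  ... | yes refl with () ← trans (sym p) q
  abs-uncoloured (graft F F' _) v p = cong₂ _⊕_ (abs-uncoloured F v p) (abs-uncoloured F' v p)

  abs-off : ∀ {u} {b : Bush u} {s} (F : Flow b s) v → cntV b v ≡ 0 → abs F v ≡ 𝟎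
  abs-off (bare₀ _) v p = refl
  abs-off (bare₁ {u = u} q x) v p with u ≟ v
  ... | no _ = refl
  abs-off (graft {b = b} {c = c} F F' _) v p with cntV b v in p₁ | cntV c v in p₂
  ... | zero | zero = cong₂ _⊕_ (abs-off F v p₁) (abs-off F' v p₂)

  isCol : Fin 3 → V → Bool
  isCol i v with col v
  ... | nothing = false
  ... | just k  = δ k i

  isCol-just : ∀ {i v k} → col v ≡ just k → isCol i v ≡ δ k i
  isCol-just {i} {v} p with col v
  isCol-just refl | just k = refl

  isCol-sound : ∀ {i v} → isCol i v ≡ true → col v ≡ just i
  isCol-sound {i} {v} p with col v
  ... | just k = cong just (δ-sound p)

  abs-sum : ∀ ψ → Additive ψ → ∀ {u} {b : Bush u} {s} (F : Flow b s) i →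
    xsum (λ v → isCol i v ∧ ψ (abs F v)) ≡ ψ (coord s i)
  abs-sum ψ add F i = go F
    where
    ψ0 : ψ 𝟎 ≡ false
    ψ0 = additive-𝟎 ψ add
    go : ∀ {u} {b : Bush u} {s} (F : Flow b s) → xsum (λ v → isCol i v ∧ ψ (abs F v)) ≡ ψ (coord s i)
    go (bare₀ _) = trans (xsum-zero (λ v → trans (cong (isCol i v ∧_) ψ0) (∧-zeroʳ (isCol i v)))) (sym (trans (cong ψ (coord-zero i)) ψ0))
    go (bare₁ {u = u} {k} p x) = trans (xsum-cong term) (trans (xsum-δ u _) (trans here-value (cong ψ (sym (coord-single k i x)))))
      where
      term : ∀ v → isCol i v ∧ ψ (if δ u v then x else 𝟎) ≡ δ u v ∧ (isCol i v ∧ ψ x)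
      term v with u ≟ v
      ... | yes _ = refl
      ... | no  _ = trans (cong (isCol i v ∧_) ψ0) (∧-zeroʳ (isCol i v))
      here-value : isCol i u ∧ ψ x ≡ ψ (if δ k i then x else 𝟎)
      here-value rewrite isCol-just {i} p with δ k i
      ... | true  = refl
      ... | false = sym ψ0
    go (graft {s = s} {t} F F' _) = trans (xsum-cong (λ v → trans (cong (isCol i v ∧_) (add (abs F v) (abs F' v))) (∧-distribˡ-xor (isCol i v) _ _)))
      (trans (xsum-xor _ _) (trans (cong₂ _xor_ (go F) (go F')) (trans (sym (add (coord s i) (coord t i))) (cong ψ (sym (coord-⊞ s t i))))))

  sum4 : (V → V4) → ∀ {u} → Bush u → V4
  sum4 a b = sumB (λ v → proj₁ (a v)) b , sumB (λ v → proj₂ (a v)) b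

  NonzeroCuts : (V → V4) → ∀ {u} → Bush u → Set
  NonzeroCuts a = AllCuts (λ c → sum4 a c ≢ 𝟎)

  -- The value on an edge is what is absorbed beyond it. No vertex occurs twice, so what one side
  -- absorbs vanishes on the other and the sides can be treated separately. Agreement of `a` with
  -- the flow is asked on `b` alone, which lets the lemma act on a piece of a larger assignment.
  abs-cuts : ∀ (a : V → V4) {u} {b : Bush u} {s} (F : Flow b s) → (∀ v → cntV b v ≤ 1) →
    (∀ v → 1 ≤ cntV b v → a v ≡ abs F v) → NonzeroCuts a b × (sum4 a b ≡ ∣ s ∣ₚ)
  abs-cuts a (bare₀ {u} _) once h = tt , cong₂ _,_ (cong proj₁ (h u (root∈ (bare u)))) (cong proj₂ (h u (root∈ (bare u))))
  abs-cuts a (bare₁ {u} {i} _ x) once h = tt , trans (cong₂ _,_ (cong proj₁ here-value) (cong proj₂ here-value)) (sym (∣single∣ i x))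
    where
    here-value : a u ≡ x
    here-value = trans (h u (root∈ (bare u))) (cong (λ d → if d then x else 𝟎) (δ-refl u))
  abs-cuts a (graft {b = b} {c = c} {s = s} {t} F F' nz) once h =
    (proj₁ left , proj₁ right , (λ z → nz (trans (sym (proj₂ right)) z))) ,
    trans (cong₂ _⊕_ (proj₂ left) (proj₂ right)) (sym (∣⊞∣ s t))
    where
    apart : ∀ v → 1 ≤ cntV b v → 1 ≤ cntV c v → ⊥
    apart v = +≤1-disjoint (once v)
    left = abs-cuts a F (λ v → ≤-trans (m≤m+n _ _) (once v)) (λ v p → trans (h v (≤-trans p (m≤m+n _ _)))
      (trans (cong (abs F v ⊕_) (abs-off F' v (¬1≤⇒0 _ (apart v p)))) (⊕-identityʳ (abs F v))))
    right = abs-cuts a F' (λ v → ≤-trans (m≤n+m _ _) (once v)) (λ v p → trans (h v (≤-trans p (m≤n+m _ _)))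
      (cong (_⊕ abs F' v) (abs-off F v (¬1≤⇒0 _ (λ q → apart v q p)))))

  cols : ∀ {u} → Bush u → CS
  cols (bare u)        = colourSet (col u)
  cols (graft b e j c) = cols b ∪ cols c

  good : ∀ {u} → Bush u → CS → Bool
  good (bare u)        S = true
  good (graft b e j c) S = good b (S ∪ cols c) ∧ (good c (S ∪ cols b) ∧ meets (cols c) (S ∪ cols b))

  st-colours : ∀ {u} (b : Bush u) → colours (st b) ≡ cols b
  st-colours (bare u) with col u
  ... | nothing = refl
  ... | just i  = refl
  st-colours (graft b e j c) = cong₂ _∪_ (st-colours b) (st-colours c)

  st-safe : ∀ {u} (b : Bush u) S → recall (safe (st b)) S ≡ good b S
  st-safe (bare u) S with col u
  ... | nothing = recall-memo (λ _ → true) S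
  ... | just i  = recall-memo (λ _ → true) S
  st-safe (graft b e j c) S = trans (recall-memo (λ S → recall (safe (st b)) (S ∪ colours (st c)) ∧ recall (L.safe (close (st c))) (S ∪ colours (st b))) S) (cong₂ _∧_
    (trans (cong (λ Q → recall (safe (st b)) (S ∪ Q)) (st-colours c)) (st-safe b _))
    (trans (recall-memo (λ S → recall (safe (st c)) S ∧ meets (colours (st c)) S) (S ∪ colours (st b))) (cong₂ _∧_
      (trans (cong (λ Q → recall (safe (st c)) (S ∪ Q)) (st-colours b)) (st-safe c _))
      (cong₂ (λ P Q → meets P (S ∪ Q)) (st-colours c) (st-colours b)))))

has-∪ : ∀ P Q i → has (P ∪ Q) i ≡ has P i ∨ has Q i
has-∪ P Q zero             = refl
has-∪ P Q (suc zero)       = refl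
has-∪ P Q (suc (suc zero)) = refl

has-∪ˡ : ∀ P Q i → has P i ≡ true → has (P ∪ Q) i ≡ true
has-∪ˡ P Q i p = trans (has-∪ P Q i) (cong (_∨ has Q i) p)

has-∪ʳ : ∀ P Q i → has Q i ≡ true → has (P ∪ Q) i ≡ true
has-∪ʳ P Q i p = trans (has-∪ P Q i) (trans (cong (has P i ∨_) p) (∨-zeroʳ (has P i)))

meets-intro : ∀ P Q i → has P i ≡ true → has Q i ≡ true → meets P Q ≡ true
meets-intro (true , _) (true , _) zero refl refl = refl
meets-intro (a , true , _) (a' , true , _) (suc zero) refl refl = ∨-zeroʳ (a ∧ a')
meets-intro (a , b , true) (a' , b' , true) (suc (suc zero)) refl refl =
  trans (cong ((a ∧ a') ∨_) (∨-zeroʳ (b ∧ b'))) (∨-zeroʳ (a ∧ a'))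

has-colourSet : ∀ i → has (colourSet (just i)) i ≡ true
has-colourSet zero             = refl
has-colourSet (suc zero)       = refl
has-colourSet (suc (suc zero)) = refl

1≤⇒≢0 : ∀ {k} → 1 ≤ k → k ≢ 0
1≤⇒≢0 () refl

+≡0 : ∀ {k l} → k ≡ 0 → l ≡ 0 → k + l ≡ 0
+≡0 refl refl = refl

-- Colourings, and what 2-edge-connectedness says about tree edges

Incident : (G : Graph) → Fin (m G) → Fin (n G) → Set
Incident G e v = (src G e ≡ v) ⊎ (tgt G e ≡ v)

record Colouring (G : Graph) (C : EdgeSet G) (col : Fin (n G) → Maybe (Fin 3)) : Set where
  field
    onEdge    : ∀ e → C e ≡ true → ∃ λ i → (col (src G e) ≡ just i) × (col (tgt G e) ≡ just i)
    incident  : ∀ v i → col v ≡ just i → ∃ λ e → (C e ≡ true) × Incident G e v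
    connected : ∀ u v i → col u ≡ just i → col v ≡ just i → Reach G C u v

module Coloured (G : Graph) (T C : EdgeSet G) (dec : Decomposition G T C) (cyc : IsCycle G C)
                (col : Fin (n G) → Maybe (Fin 3)) (colouring : Colouring G C col) where
  open Boundary G
  open Trails G using (euler-lift)
  open Bushes G
  open Dynamic G col
  open Colouring colouring

  incident-col : ∀ {e v i} → C e ≡ true → Incident G e v → col (src G e) ≡ just i → col v ≡ just i
  incident-col Ce (inj₁ refl) p = p
  incident-col {e} Ce (inj₂ refl) p with onEdge e Ce
  ... | k , q , r = trans r (trans (sym q) p)

  col-incident : ∀ {e v i} → C e ≡ true → Incident G e v → col v ≡ just i → col (src G e) ≡ just i
  col-incident Ce (inj₁ refl) p = p
  col-incident {e} Ce (inj₂ refl) p with onEdge e Ce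
  ... | k , q , r = trans q (trans (sym r) p)

  cols-∋ : ∀ {u} (b : Bush u) v i → 1 ≤ cntV b v → col v ≡ just i → has (cols b) i ≡ true
  cols-∋ (bare u) v i p q = subst (λ x → has (colourSet x) i ≡ true) (sym (trans (cong col (δ-sound (1≤bit p))) q)) (has-colourSet i)
  cols-∋ (graft b e j c) v i p q with 1≤+ (cntV b v) p
  ... | inj₁ p' = has-∪ˡ (cols b) (cols c) i (cols-∋ b v i p' q)
  ... | inj₂ p' = has-∪ʳ (cols b) (cols c) i (cols-∋ c v i p' q)

  -- How a limb sits in the graph: tree edges outside it attach only at its root, and `S` contains
  -- the colour of every vertex outside it that carries a tree edge.
  record Context {u} (b : Bush u) (S : CS) : Set where
    field
      once     : ∀ v → cntV b v ≤ 1
      attached : ∀ f v → T f ≡ true → cntE b f ≡ 0 → Incident G f v → 1 ≤ cntV b v → v ≡ u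
      outside  : ∀ f v i → T f ≡ true → Incident G f v → cntV b v ≡ 0 → col v ≡ just i → has S i ≡ true
  open Context

  module _ (2ec : ∀ e u v → Reach G (without G e) u v) where

    module Split {u w} {b : Bush u} {e} {j : Joins G e u w} {c : Bush w} {S} (ctx : Context (graft b e j c) S) where

      apart : ∀ v → 1 ≤ cntV b v → 1 ≤ cntV c v → ⊥
      apart v = +≤1-disjoint (once ctx v)

      own-edges : ∀ f v → T f ≡ true → Incident G f v → 1 ≤ cntV c v → e ≢ f → 1 ≤ cntE c f
      own-edges f v Tf i p e≢f with 0-or-1≤ (cntE c f)
      ... | inj₂ q = q
      ... | inj₁ q with 0-or-1≤ (cntE b f)
      ...   | inj₂ q' = ⊥-elim (apart v (edge-ends∈ b f q' i) p)
      ...   | inj₁ q' = ⊥-elim (apart v (subst (λ x → 1 ≤ cntV b x)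
                (sym (attached ctx f v Tf (+≡0 (cong ⟦_⟧ (δ-≢ e≢f)) (+≡0 q' q)) i (≤-trans p (m≤n+m _ (cntV b v))))) (root∈ b)) p)

      right : Context c (S ∪ cols b)
      right = record
        { once = λ v → ≤-trans (m≤n+m _ _) (once ctx v)
        ; attached = λ f v Tf q i p → at f v Tf q i p (e ≟ f)
        ; outside = λ f v i Tf inc q r → out f v i Tf inc q r (0-or-1≤ (cntV b v)) }
        where
        at : ∀ f v → T f ≡ true → cntE c f ≡ 0 → Incident G f v → 1 ≤ cntV c v → Dec (e ≡ f) → v ≡ w
        at f v Tf q i p (no e≢f) = ⊥-elim (1≤⇒≢0 (own-edges f v Tf i p e≢f) q)
        at f v Tf q i p (yes refl) with incident-end j i
        ... | inj₁ refl = ⊥-elim (apart v (root∈ b) p)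
        ... | inj₂ x    = x
        out : ∀ f v i → T f ≡ true → Incident G f v → cntV c v ≡ 0 → col v ≡ just i → (cntV b v ≡ 0) ⊎ (1 ≤ cntV b v) → has (S ∪ cols b) i ≡ true
        out f v i Tf inc q r (inj₁ z) = has-∪ˡ S (cols b) i (outside ctx f v i Tf inc (+≡0 z q) r)
        out f v i Tf inc q r (inj₂ p) = has-∪ʳ S (cols b) i (cols-∋ b v i p r)

      left : Context b (S ∪ cols c)
      left = record
        { once = λ v → ≤-trans (m≤m+n _ _) (once ctx v)
        ; attached = λ f v Tf q i p → at f v Tf q i p (e ≟ f)
        ; outside = λ f v i Tf inc q r → out f v i Tf inc q r (0-or-1≤ (cntV c v)) }
        where
        at : ∀ f v → T f ≡ true → cntE b f ≡ 0 → Incident G f v → 1 ≤ cntV b v → Dec (e ≡ f) → v ≡ u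
        at f v Tf q i p (yes refl) with incident-end j i
        ... | inj₁ x    = x
        ... | inj₂ refl = ⊥-elim (apart v p (root∈ c))
        at f v Tf q i p (no e≢f) with 0-or-1≤ (cntE c f)
        ... | inj₂ q' = ⊥-elim (apart v p (edge-ends∈ c f q' i))
        ... | inj₁ q' = attached ctx f v Tf (+≡0 (cong ⟦_⟧ (δ-≢ e≢f)) (+≡0 q q')) i (≤-trans p (m≤m+n _ _))
        out : ∀ f v i → T f ≡ true → Incident G f v → cntV b v ≡ 0 → col v ≡ just i → (cntV c v ≡ 0) ⊎ (1 ≤ cntV c v) → has (S ∪ cols c) i ≡ true
        out f v i Tf inc q r (inj₁ z) = has-∪ˡ S (cols c) i (outside ctx f v i Tf inc (+≡0 q z) r)
        out f v i Tf inc q r (inj₂ p) = has-∪ʳ S (cols c) i (cols-∋ c v i p r)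

      -- The limb `c` together with all components of `C` that it touches. If no colour were shared
      -- across `e`, no edge other than `e` would leave this set, while `u` lies outside it: `e`
      -- would be a bridge.
      Inside : V → Set
      Inside v = (1 ≤ cntV c v) ⊎ (∃ λ i → (col v ≡ just i) × (has (cols c) i ≡ true))

      module _ (sep : meets (cols c) (S ∪ cols b) ≡ false) where

        no-shared : ∀ i → has (cols c) i ≡ true → has (S ∪ cols b) i ≡ true → ⊥
        no-shared i p q = true≢false (trans (sym (meets-intro (cols c) (S ∪ cols b) i p q)) sep)

        stays : ∀ {f v v'} → e ≢ f → Joins G f v v' → Inside v → Inside v'
        stays {f} {v} {v'} e≢f i h with proj₂ dec f
        stays {f} {v} {v'} e≢f i h | inj₂ Cf with onEdge f Cf
        ... | k , p , _ = inj₂ (k , incident-col Cf (joins-incident (joins-sym i)) p , coloured h)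
          where
          coloured : Inside v → has (cols c) k ≡ true
          coloured (inj₁ q) = cols-∋ c v k q (incident-col Cf (joins-incident i) p)
          coloured (inj₂ (k' , q , r)) = subst (λ x → has (cols c) x ≡ true)
            (just-injective (trans (sym q) (incident-col Cf (joins-incident i) p))) r
        stays {f} {v} {v'} e≢f i (inj₁ q) | inj₁ Tf =
          inj₁ (edge-ends∈ c f (own-edges f v Tf (joins-incident i) q e≢f) (joins-incident (joins-sym i)))
        stays {f} {v} {v'} e≢f i (inj₂ (k , q , r)) | inj₁ Tf with 0-or-1≤ (cntV c v)
        ... | inj₂ p = inj₁ (edge-ends∈ c f (own-edges f v Tf (joins-incident i) p e≢f) (joins-incident (joins-sym i)))
        ... | inj₁ z = ⊥-elim (no-shared k r (outside right f v k Tf (joins-incident i) z q))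

        travels : ∀ {v v'} → Reach G (without G e) v v' → Inside v → Inside v'
        travels here h = h
        travels (step f s i p) h = travels p (stays (differ s) i h)
          where
          differ : ∀ {f} → without G e f ≡ true → e ≢ f
          differ {f} s q with e ≟ f
          differ () q | yes _
          ... | no r = r q

        contradictory : ⊥
        contradictory with travels (2ec e w u) (inj₁ (root∈ c))
        ... | inj₁ p = apart u (root∈ b) p
        ... | inj₂ (k , q , r) = no-shared k r (has-∪ʳ S (cols b) k (cols-∋ b u k (root∈ b) q))

      shared : meets (cols c) (S ∪ cols b) ≡ true
      shared with meets (cols c) (S ∪ cols b) in eq
      ... | true  = refl
      ... | false = ⊥-elim (contradictory eq)

    good-context : ∀ {u} (b : Bush u) S → Context b S → good b S ≡ true
    good-context (bare u)        S ctx = refl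
    good-context (graft b e j c) S ctx = cong₂ _∧_ (good-context b _ (Split.left ctx))
      (cong₂ _∧_ (good-context c _ (Split.right ctx)) (Split.shared ctx))

    good-span : ∀ {u} (b : Bush u) → Spans T b → good b ∅ ≡ true
    good-span b span = good-context b ∅ record
      { once = Spans.verts span
      ; attached = λ f v Tf q _ _ → ⊥-elim (1≤⇒≢0 (inB f Tf) q)
      ; outside = λ f v i Tf inc q _ → ⊥-elim (1≤⇒≢0 (edge-ends∈ b f (inB f Tf) inc) q) }
      where
      inB : ∀ f → T f ≡ true → 1 ≤ cntE b f
      inB f Tf = subst (1 ≤_) (sym (Spans.edges span f)) (bit-true Tf)

  -- Lifting absorbed values to the cycle

  record Lift (a : V → V4) : Set where
    field
      g       : E → V4
      offC    : ∀ e → C e ≡ false → g e ≡ 𝟎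
      ∂₁      : ∀ v → ∂ (λ e → proj₁ (g e)) v ≡ proj₁ (a v)
      ∂₂      : ∀ v → ∂ (λ e → proj₂ (g e)) v ≡ proj₂ (a v)
      ∂-quad  : ∀ v → a v ≡ 𝟎 → ∂ (λ e → quad (g e)) v ≡ false

  ∂-local : ∀ {S S'} v → (∀ e → Incident G e v → S e ≡ S' e) → ∂ S v ≡ ∂ S' v
  ∂-local {S} {S'} v h = xsum-cong term
    where
    term : ∀ e → S e ∧ (δ (src G e) v xor δ (tgt G e) v) ≡ S' e ∧ (δ (src G e) v xor δ (tgt G e) v)
    term e with src G e ≟ v | tgt G e ≟ v
    ... | yes p | _     = cong (_∧ _) (h e (inj₁ p))
    ... | no _  | yes q = cong (_∧ _) (h e (inj₂ q))
    ... | no _  | no _  = trans (∧-zeroʳ (S e)) (sym (∧-zeroʳ (S' e)))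

  module Lifting (a : V → V4) (uncoloured : ∀ v → col v ≡ nothing → a v ≡ 𝟎)
                 (balanced : ∀ ψ → Additive ψ → ∀ i → xsum (λ v → isCol i v ∧ ψ (a v)) ≡ false) where

    D : Fin 3 → E → Bool
    D i e = C e ∧ isCol i (src G e)

    part : Fin 3 → V → V4
    part i v = if isCol i v then a v else 𝟎

    isCol-true : ∀ {i v} → col v ≡ just i → isCol i v ≡ true
    isCol-true {i} p = trans (isCol-just p) (δ-refl i)

    D-true : ∀ {i e v} → C e ≡ true → Incident G e v → col v ≡ just i → D i e ≡ true
    D-true Ce inc p = cong₂ _∧_ Ce (isCol-true (col-incident Ce inc p))

    D-even : ∀ i v → ∂ (D i) v ≡ false
    -- All edges of `C` at `v` have the colour of `v`, so near `v` the set `D i` is either all of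
    -- `C` or empty.
    D-even i v = trans (∂-local v local) (trans (∂-∧ (isCol i v) C v) (trans (cong (isCol i v ∧_) (cycle⇒∂ cyc v)) (∧-zeroʳ (isCol i v))))
      where
      local : ∀ e → Incident G e v → D i e ≡ isCol i v ∧ C e
      local e inc with C e in Ce
      ... | false = sym (∧-zeroʳ (isCol i v))
      ... | true with onEdge e Ce
      ...   | k , p , _ = trans (isCol-just p) (trans (sym (isCol-just (incident-col Ce inc p))) (sym (∧-identityʳ (isCol i v))))

    D-reach : ∀ {i x y} → Reach G C x y → col x ≡ just i → Reach G (D i) x y
    D-reach here p = here
    D-reach (step f s j r) p = step f (D-true s (joins-incident j) p) j
      (D-reach r (incident-col s (joins-incident (joins-sym j)) (col-incident s (joins-incident j) p)))

    part-nonzero : ∀ i v → part i v ≢ 𝟎 → col v ≡ just i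
    part-nonzero i v h with isCol i v in eq
    ... | true  = isCol-sound eq
    ... | false = ⊥-elim (h refl)

    part-incident : ∀ i v → part i v ≢ 𝟎 → ∃ λ e → (D i e ≡ true) × Incident G e v
    part-incident i v h with incident v i (part-nonzero i v h)
    ... | e , Ce , inc = e , D-true Ce inc (part-nonzero i v h) , inc

    ψ-part : ∀ ψ → Additive ψ → ∀ i v → ψ (part i v) ≡ isCol i v ∧ ψ (a v)
    ψ-part ψ add i v with isCol i v
    ... | true  = refl
    ... | false = additive-𝟎 ψ add

    record PartLift (i : Fin 3) : Set where
      field
        g      : E → V4
        off    : ∀ e → D i e ≡ false → g e ≡ 𝟎
        ∂₁     : ∀ v → ∂ (λ e → proj₁ (g e)) v ≡ proj₁ (part i v)
        ∂₂     : ∀ v → ∂ (λ e → proj₂ (g e)) v ≡ proj₂ (part i v)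
        ∂-quad : ∀ v → part i v ≡ 𝟎 → ∂ (λ e → quad (g e)) v ≡ false

    partLift : ∀ i → PartLift i
    partLift i with any? (λ e → D i e 𝔹.≟ true)
    ... | yes (e₀ , p₀) = record { g = proj₁ L ; off = proj₁ (proj₂ L) ; ∂₁ = proj₁ (proj₂ (proj₂ L))
                                 ; ∂₂ = proj₁ (proj₂ (proj₂ (proj₂ L))) ; ∂-quad = proj₂ (proj₂ (proj₂ (proj₂ L))) }
      where
      src-col : ∀ e → D i e ≡ true → col (src G e) ≡ just i
      src-col e p = isCol-sound (proj₂ (∧-split {C e} p))
      L = euler-lift (D i) (D-even i) (src G e₀)
        (λ e p → D-reach (connected (src G e₀) (src G e) i (src-col e₀ p₀) (src-col e p)) (src-col e₀ p₀))
        (part i) (part-incident i)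
        (λ ψ add → trans (xsum-cong (ψ-part ψ add i)) (balanced ψ add i))
    ... | no absent = record { g = λ _ → 𝟎 ; off = λ _ _ → refl
        ; ∂₁ = λ v → trans (∂-zero (λ _ → refl) v) (cong proj₁ (sym (vanish v)))
        ; ∂₂ = λ v → trans (∂-zero (λ _ → refl) v) (cong proj₂ (sym (vanish v)))
        ; ∂-quad = λ v _ → ∂-zero (λ _ → refl) v }
      where
      vanish : ∀ v → part i v ≡ 𝟎
      vanish v with zero-or-not (part i v)
      ... | inj₁ z = z
      ... | inj₂ h = ⊥-elim (absent (let e , p , _ = part-incident i v h in e , p))

    g₀ g₁ g₂ : E → V4
    g₀ = PartLift.g (partLift (# 0))
    g₁ = PartLift.g (partLift (# 1))
    g₂ = PartLift.g (partLift (# 2))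

    parts-sum : ∀ v → part (# 0) v ⊕ (part (# 1) v ⊕ part (# 2) v) ≡ a v
    parts-sum v with col v in eq
    ... | nothing                 = sym (uncoloured v eq)
    ... | just zero               = ⊕-identityʳ (a v)
    ... | just (suc zero)         = ⊕-identityʳ (a v)
    ... | just (suc (suc zero))   = refl

    exclusive : ∀ e → (g₁ e ≡ 𝟎 × g₂ e ≡ 𝟎) ⊎ (g₀ e ≡ 𝟎 × g₂ e ≡ 𝟎) ⊎ (g₀ e ≡ 𝟎 × g₁ e ≡ 𝟎)
    exclusive e with C e in Ce
    ... | false = inj₁ (PartLift.off (partLift (# 1)) e (cong (_∧ _) Ce) , PartLift.off (partLift (# 2)) e (cong (_∧ _) Ce))
    ... | true with onEdge e Ce
    ...   | zero , p , _ = inj₁ (PartLift.off (partLift (# 1)) e (cong₂ _∧_ Ce (isCol-just p)) , PartLift.off (partLift (# 2)) e (cong₂ _∧_ Ce (isCol-just p)))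
    ...   | suc zero , p , _ = inj₂ (inj₁ (PartLift.off (partLift (# 0)) e (cong₂ _∧_ Ce (isCol-just p)) , PartLift.off (partLift (# 2)) e (cong₂ _∧_ Ce (isCol-just p))))
    ...   | suc (suc zero) , p , _ = inj₂ (inj₂ (PartLift.off (partLift (# 0)) e (cong₂ _∧_ Ce (isCol-just p)) , PartLift.off (partLift (# 1)) e (cong₂ _∧_ Ce (isCol-just p))))

    -- The product is not additive in general; it is here because at every edge at least two of the
    -- three summands vanish.
    quad-sum : ∀ e → quad (g₀ e ⊕ (g₁ e ⊕ g₂ e)) ≡ quad (g₀ e) xor (quad (g₁ e) xor quad (g₂ e))
    quad-sum e with exclusive e
    ... | inj₁ (p , q) rewrite p | q = trans (cong quad (⊕-identityʳ (g₀ e))) (sym (xor-identityʳ _))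
    ... | inj₂ (inj₁ (p , q)) rewrite p | q = trans (cong quad (⊕-identityʳ (g₁ e))) (sym (xor-identityʳ _))
    ... | inj₂ (inj₂ (p , q)) rewrite p | q = refl

    ∂-sum₃ : ∀ S₀ S₁ S₂ v → ∂ (λ e → S₀ e xor (S₁ e xor S₂ e)) v ≡ ∂ S₀ v xor (∂ S₁ v xor ∂ S₂ v)
    ∂-sum₃ S₀ S₁ S₂ v = trans (∂-xor S₀ _ v) (cong (∂ S₀ v xor_) (∂-xor S₁ S₂ v))

    lift : Lift a
    lift = record
      { g = λ e → g₀ e ⊕ (g₁ e ⊕ g₂ e)
      ; offC = λ e p → cong₂ _⊕_ (PartLift.off (partLift (# 0)) e (cong (_∧ _) p))
          (cong₂ _⊕_ (PartLift.off (partLift (# 1)) e (cong (_∧ _) p)) (PartLift.off (partLift (# 2)) e (cong (_∧ _) p)))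
      ; ∂₁ = λ v → trans (∂-sum₃ _ _ _ v) (trans (cong₂ _xor_ (PartLift.∂₁ (partLift (# 0)) v)
          (cong₂ _xor_ (PartLift.∂₁ (partLift (# 1)) v) (PartLift.∂₁ (partLift (# 2)) v))) (cong proj₁ (parts-sum v)))
      ; ∂₂ = λ v → trans (∂-sum₃ _ _ _ v) (trans (cong₂ _xor_ (PartLift.∂₂ (partLift (# 0)) v)
          (cong₂ _xor_ (PartLift.∂₂ (partLift (# 1)) v) (PartLift.∂₂ (partLift (# 2)) v))) (cong proj₂ (parts-sum v)))
      ; ∂-quad = λ v p → trans (∂-cong quad-sum v) (trans (∂-sum₃ _ _ _ v)
          (cong₂ _xor_ (PartLift.∂-quad (partLift (# 0)) v (zero-part p))
            (cong₂ _xor_ (PartLift.∂-quad (partLift (# 1)) v (zero-part p)) (PartLift.∂-quad (partLift (# 2)) v (zero-part p))))) }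
      where
      zero-part : ∀ {i v} → a v ≡ 𝟎 → part i v ≡ 𝟎
      zero-part {i} {v} p with isCol i v
      ... | true  = p
      ... | false = refl

-- The four even sets of a flow x with a free even set y.
enc : V4 → Bool → Fin 4 → Bool
enc (a , b) y zero                   = y
enc (a , b) y (suc zero)             = y xor a
enc (a , b) y (suc (suc zero))       = y xor b
enc (a , b) y (suc (suc (suc zero))) = y xor (a xor b)

-- Among 0, a, b, a + b exactly two are 1 as soon as (a , b) is nonzero, and complementing all four
-- keeps the number two.
enc-weight : ∀ x y → x ≢ 𝟎 → sumFin 4 (λ l → ⟦ enc x y l ⟧) ≡ 2
enc-weight (false , false) y     h = ⊥-elim (h refl)
enc-weight 𝟏               false h = refl
enc-weight 𝟏               true  h = refl
enc-weight 𝟐               false h = refl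
enc-weight 𝟐               true  h = refl
enc-weight 𝟑               false h = refl
enc-weight 𝟑               true  h = refl

encSlot : Maybe (Fin 4) → V4 → Bool → Bool
encSlot nothing  x y = false
encSlot (just k) x y = enc x y k

last : Maybe (Fin 4) → Bool
last nothing  = false
last (just k) = δ k (# 3)

-- On `C` the free bit is the product `ab`, and `C` itself is added in the last place, which changes
-- no boundary because `C` is even. The four places then hold `ab`, `a(b+1)`, `(a+1)b` and
-- `(a+1)(b+1)`, the indicators of the four values, so each edge receives one label.
onCycle : Maybe (Fin 4) → V4 → Bool
onCycle s x = encSlot s x (quad x) xor last s

-- Double covers from lifts

module Labelled (G : Graph) (T C : EdgeSet G) (dec : Decomposition G T C) (cyc : IsCycle G C)
                (col : Fin (n G) → Maybe (Fin 3)) (colouring : Colouring G C col) where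
  open Boundary G
  open Bushes G
  open Dynamic G col
  open Colouring colouring
  open Coloured G T C dec cyc col colouring

  sumB-enc : ∀ (a : V → V4) (J : V → Bool) k {u} (c : Bush u) →
    sumB (λ v → enc (a v) (J v) k) c ≡ enc (sum4 a c) (sumB J c) k
  sumB-enc a J zero                   c = refl
  sumB-enc a J (suc zero)             c = sumB-xor J _ c
  sumB-enc a J (suc (suc zero))       c = sumB-xor J _ c
  sumB-enc a J (suc (suc (suc zero))) c = trans (sumB-xor J _ c) (cong (sumB J c xor_) (sumB-xor _ _ c))

  AllCuts-map : ∀ {P Q : ∀ {w} → Bush w → Set} → (∀ {w} (c : Bush w) → P c → Q c) → ∀ {u} (b : Bush u) → AllCuts P b → AllCuts Q b
  AllCuts-map h (bare u)        _             = tt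
  AllCuts-map h (graft b e j c) (p , q , r)   = AllCuts-map h b p , AllCuts-map h c q , h c r

  -- `slot i l` is the role that label `l` plays around colour `i`: one of the four places of `enc`,
  -- or none. The roles may differ between colours because the components of `C` are disjoint.
  module FromLift {a : V → V4} (uncoloured : ∀ v → col v ≡ nothing → a v ≡ 𝟎) (lift : Lift a)
                  {N} (slot : Fin 3 → Fin N → Maybe (Fin 4)) where
    open Lift lift

    J : V → Bool
    J = ∂ (λ e → quad (g e))

    atVertex : Maybe (Fin 3) → Fin N → V4 → Bool → Bool
    atVertex nothing  l x y = false
    atVertex (just i) l x y = encSlot (slot i l) x y

    α : Fin N → V → Bool
    α l v = atVertex (col v) l (a v) (J v)

    atEdge : Maybe (Fin 3) → Fin N → V4 → Bool
    atEdge nothing  l x = false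
    atEdge (just i) l x = onCycle (slot i l) x

    ℓ : Fin N → E → Bool
    ℓ l e = C e ∧ atEdge (col (src G e)) l (g e)

    ∂-slot : ∀ s v → ∂ (λ e → C e ∧ onCycle s (g e)) v ≡ encSlot s (a v) (J v)
    ∂-slot nothing  v = ∂-zero (λ e → ∧-zeroʳ (C e)) v
    ∂-slot (just k) v = trans (∂-cong split v) (trans (∂-xor _ _ v)
      (trans (cong₂ _xor_ (by k) (trans (∂-cong (λ e → ∧-comm (C e) (δ k (# 3))) v) (trans (∂-∧ (δ k (# 3)) C v)
        (trans (cong (δ k (# 3) ∧_) (cycle⇒∂ cyc v)) (∧-zeroʳ (δ k (# 3))))))) (xor-identityʳ _)))
      where
      enc-𝟎 : ∀ k → enc 𝟎 false k ≡ false
      enc-𝟎 zero                   = refl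
      enc-𝟎 (suc zero)             = refl
      enc-𝟎 (suc (suc zero))       = refl
      enc-𝟎 (suc (suc (suc zero))) = refl
      split : ∀ e → C e ∧ onCycle (just k) (g e) ≡ enc (g e) (quad (g e)) k xor (C e ∧ δ k (# 3))
      split e with C e in Ce
      ... | true  = refl
      ... | false rewrite offC e Ce = sym (trans (xor-identityʳ _) (enc-𝟎 k))
      by : ∀ k → ∂ (λ e → enc (g e) (quad (g e)) k) v ≡ enc (a v) (J v) k
      by zero                   = refl
      by (suc zero)             = trans (∂-xor _ _ v) (cong (J v xor_) (∂₁ v))
      by (suc (suc zero))       = trans (∂-xor _ _ v) (cong (J v xor_) (∂₂ v))
      by (suc (suc (suc zero))) = trans (∂-xor _ _ v) (cong (J v xor_) (trans (∂-xor _ _ v) (cong₂ _xor_ (∂₁ v) (∂₂ v))))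

    ∂ℓ : ∀ l v → ∂ (ℓ l) v ≡ α l v
    ∂ℓ l v with col v in eq
    ... | just i = trans (∂-local v local) (∂-slot (slot i l) v)
      where
      local : ∀ e → Incident G e v → ℓ l e ≡ C e ∧ onCycle (slot i l) (g e)
      local e inc with C e in Ce
      ... | false = refl
      ... | true  = cong (λ k → atEdge k l (g e)) (col-incident Ce inc eq)
    ... | nothing = trans (∂-local {S' = λ _ → false} v local) (∂-zero (λ _ → refl) v)
      where
      local : ∀ e → Incident G e v → ℓ l e ≡ false
      local e inc with C e in Ce
      ... | false = refl
      ... | true  with onEdge e Ce
      ...   | i , p , _ with () ← trans (sym (incident-col Ce inc p)) eq

    α-zero : ∀ l v → a v ≡ 𝟎 → α l v ≡ false
    α-zero l v p rewrite p | ∂-quad v p = at-zero (col v)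
      where
      at-zero : ∀ k → atVertex k l 𝟎 false ≡ false
      at-zero nothing  = refl
      at-zero (just i) with slot i l
      ... | nothing                       = refl
      ... | just zero                     = refl
      ... | just (suc zero)               = refl
      ... | just (suc (suc zero))         = refl
      ... | just (suc (suc (suc zero)))   = refl

    lift⇒CDC : (∀ i x → sumFin N (λ l → ⟦ onCycle (slot i l) x ⟧) ≡ 1) → ∀ {r} (b : Bush r) → Spans T b →
      (∀ v → cntV b v ≡ 0 → a v ≡ 𝟎) → AllCuts (λ c → sumFin N (λ l → ⟦ sumB (α l) c ⟧) ≡ 2) b → HasCDCWith G (suc N) C
    lift⇒CDC partition b span offB cuts = labels⇒CDC dec cyc b span N α ℓ
      (λ l e p → cong (_∧ atEdge (col (src G e)) l (g e)) p) ∂ℓ (λ l v p → α-zero l v (offB v p)) one-each cuts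
      where
      one-each : ∀ e → C e ≡ true → sumFin N (λ l → ⟦ ℓ l e ⟧) ≡ 1
      one-each e Ce with onEdge e Ce
      ... | i , p , _ = trans (sumFin-cong N (λ l → cong ⟦_⟧ (cong₂ _∧_ Ce (cong (λ k → atEdge k l (g e)) p)))) (partition i (g e))

  -- With the same roles around every colour, limb sums commute with `enc`: the labels across a tree
  -- edge are `enc` of its nonzero flow value and of some parity, and that parity does not affect
  -- the weight.
  flow⇒5-CDC : ∀ {r} (b : Bush r) → Spans T b → Flow b (𝟎 , 𝟎 , 𝟎) → HasCDCWith G 5 C
  flow⇒5-CDC b span F = lift⇒CDC partition b span (abs-off F)
    (AllCuts-map (λ c h → trans (sumFin-cong 4 (λ l → cong ⟦_⟧ (trans (sumB-cong c (λ v _ → α≡enc l v)) (sumB-enc (abs F) J l c))))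
        (enc-weight (sum4 (abs F) c) (sumB J c) h))
      b (proj₁ (abs-cuts (abs F) F (Spans.verts span) (λ _ _ → refl))))
    where
    balanced : ∀ ψ → Additive ψ → ∀ i → xsum (λ v → isCol i v ∧ ψ (abs F v)) ≡ false
    balanced ψ add i = trans (abs-sum ψ add F i) (trans (cong ψ (coord-zero i)) (additive-𝟎 ψ add))
    lift : Lift (abs F)
    lift = Lifting.lift (abs F) (abs-uncoloured F) balanced
    open FromLift (abs-uncoloured F) lift {4} (λ _ l → just l)
    partition : ∀ i x → sumFin 4 (λ l → ⟦ onCycle (just l) x ⟧) ≡ 1
    partition i (false , false) = refl
    partition i 𝟏               = refl
    partition i 𝟐               = refl
    partition i 𝟑               = refl
    α≡enc : ∀ l v → α l v ≡ enc (abs F v) (J v) l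
    α≡enc l v with col v in eq
    ... | just i  = refl
    ... | nothing rewrite abs-uncoloured F v eq | Lift.∂-quad lift v (abs-uncoloured F v eq) = sym (zero-enc l)
      where
      zero-enc : ∀ l → enc 𝟎 false l ≡ false
      zero-enc zero                   = refl
      zero-enc (suc zero)             = refl
      zero-enc (suc (suc zero))       = refl
      zero-enc (suc (suc (suc zero))) = refl

-- Colouring the vertices by the components of `C`

module Components (G : Graph) (C : EdgeSet G) {k} (comp : HasComponents G C k) (k≤3 : k ≤ 3) where
  open Boundary G

  f : (e : E) → C e ≡ true → Fin k
  f = proj₁ comp

  At : V → E → Bool
  At v e = C e ∧ (δ (src G e) v ∨ δ (tgt G e) v)

  at-sound : ∀ {v e} → At v e ≡ true → (C e ≡ true) × Incident G e v
  at-sound {v} {e} p with ∧-split {C e} p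
  ... | Ce , q with ∨-true⁻ (δ (src G e) v) q
  ...   | inj₁ r = Ce , inj₁ (δ-sound r)
  ...   | inj₂ r = Ce , inj₂ (δ-sound r)

  at-complete : ∀ {v e} → C e ≡ true → Incident G e v → At v e ≡ true
  at-complete {v} {e} Ce (inj₁ refl) rewrite Ce | δ-refl (src G e) = refl
  at-complete {v} {e} Ce (inj₂ refl) rewrite Ce | δ-refl (tgt G e) = ∨-zeroʳ (δ (src G e) (tgt G e))

  pick : ∀ v → Dec (∃ λ e → At v e ≡ true)
  pick v = any? (λ e → At v e 𝔹.≟ true)

  colourOf : ∀ {v} → Dec (∃ λ e → At v e ≡ true) → Maybe (Fin 3)
  colourOf (yes (e , p)) = just (inject≤ (f e (proj₁ (at-sound p))) k≤3)
  colourOf (no _)        = nothing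

  col : V → Maybe (Fin 3)
  col v = colourOf (pick v)

  to-src : ∀ {e v} → C e ≡ true → Incident G e v → Reach G C (src G e) v
  to-src Ce (inj₁ refl) = here
  to-src Ce (inj₂ refl) = reach-end Ce

  same : ∀ {e e' v} (p : C e ≡ true) (p' : C e' ≡ true) → Incident G e v → Incident G e' v → f e p ≡ f e' p'
  same {e} {e'} p p' i i' = proj₂ (proj₂ (proj₂ comp) e e' p p') (reach-trans (to-src p i) (reach-sym (to-src p' i')))

  -- The edge found by `pick` is arbitrary, but two edges of `C` at one vertex lie in the same
  -- component, so the colour does not depend on it.
  col-edge : ∀ {e v} (p : C e ≡ true) → Incident G e v → col v ≡ just (inject≤ (f e p) k≤3)
  col-edge {e} {v} p i with pick v
  ... | yes (e' , q) = cong (λ x → just (inject≤ x k≤3)) (same (proj₁ (at-sound q)) p (proj₂ (at-sound q)) i)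
  ... | no h = ⊥-elim (h (e , at-complete p i))

  col-witness : ∀ {v i} → col v ≡ just i → ∃ λ e → Σ (C e ≡ true) λ p → Incident G e v × (i ≡ inject≤ (f e p) k≤3)
  col-witness {v} h with pick v
  ... | yes (e , q) = e , proj₁ (at-sound q) , proj₂ (at-sound q) , sym (just-injective h)

  colouring : Colouring G C col
  colouring = record
    { onEdge = λ e p → inject≤ (f e p) k≤3 , col-edge p (inj₁ refl) , col-edge p (inj₂ refl)
    ; incident = λ v i h → let e , p , inc , _ = col-witness h in e , p , inc
    ; connected = λ u v i h h' → conn (col-witness h) (col-witness h') }
    where
    conn : ∀ {u v i} → (∃ λ e → Σ (C e ≡ true) λ p → Incident G e u × (i ≡ inject≤ (f e p) k≤3)) →
      (∃ λ e → Σ (C e ≡ true) λ p → Incident G e v × (i ≡ inject≤ (f e p) k≤3)) → Reach G C u v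
    conn (e , p , inc , q) (e' , p' , inc' , q') = reach-trans (reach-sym (to-src p inc))
      (reach-trans (proj₁ (proj₂ (proj₂ comp) e e' p p') (inject≤-injective k≤3 k≤3 _ _ (trans (sym q) q'))) (to-src p' inc'))

  -- With at most two components the third colour does not occur, which rules out the Petersen
  -- structure.
  col-bound : ∀ {v i} → col v ≡ just i → toℕ i < k
  col-bound h with col-witness h
  ... | e , p , _ , refl = subst (_< k) (sym (toℕ-inject≤ (f e p) k≤3)) (toℕ<n (f e p))

-- Recognising the Petersen structure in a tree

nextC prevC : Fin 3 → Fin 3
nextC zero             = # 1
nextC (suc zero)       = # 2
nextC (suc (suc zero)) = # 0
prevC zero             = # 2
prevC (suc zero)       = # 0
prevC (suc (suc zero)) = # 1

single-⊞ : ∀ i x y → single i x ⊞ single i y ≡ single i (x ⊕ y)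
single-⊞ zero             x y = refl
single-⊞ (suc zero)       x y = refl
single-⊞ (suc (suc zero)) x y = refl

nonzero-split : ∀ x → ∃ λ y → ∃ λ z → (y ≢ 𝟎) × (z ≢ 𝟎) × (y ⊕ z ≡ x)
nonzero-split (false , false) = 𝟏 , 𝟏 , (λ ()) , (λ ()) , refl
nonzero-split 𝟏               = 𝟐 , 𝟑 , (λ ()) , (λ ()) , refl
nonzero-split 𝟐               = 𝟏 , 𝟑 , (λ ()) , (λ ()) , refl
nonzero-split 𝟑               = 𝟏 , 𝟐 , (λ ()) , (λ ()) , refl

module Structures (G : Graph) (col : Fin (n G) → Maybe (Fin 3)) where
  open Boundary G
  open Bushes G
  open Dynamic G col

  infix 4 _≈_
  -- Spanning is a statement about counts, so within one class children may be reordered and the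
  -- root may be moved.
  record _≈_ {u w} (b : Bush u) (c : Bush w) : Set where
    constructor same-counts
    field
      countV : ∀ v → cntV b v ≡ cntV c v
      countE : ∀ e → cntE b e ≡ cntE c e
  open _≈_

  ≈-refl : ∀ {u} {b : Bush u} → b ≈ b
  ≈-refl = same-counts (λ _ → refl) (λ _ → refl)

  ≈-trans : ∀ {u v w} {b : Bush u} {c : Bush v} {d : Bush w} → b ≈ c → c ≈ d → b ≈ d
  ≈-trans p q = same-counts (λ v → trans (countV p v) (countV q v)) (λ e → trans (countE p e) (countE q e))

  ≈-graft : ∀ {u w} {b b' : Bush u} {e} {j : Joins G e u w} {c c' : Bush w} → b ≈ b' → c ≈ c' → graft b e j c ≈ graft b' e j c'
  ≈-graft {e = e} p q = same-counts (λ v → cong₂ _+_ (countV p v) (countV q v))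
    (λ f → cong (⟦ δ e f ⟧ +_) (cong₂ _+_ (countE p f) (countE q f)))

  +-swap : ∀ a b c → (a + b) + c ≡ (a + c) + b
  +-swap a b c = trans (+-assoc a b c) (trans (cong (a +_) (+-comm b c)) (sym (+-assoc a c b)))

  ≈-swap : ∀ {u w w'} {b : Bush u} {e e'} {j : Joins G e u w} {j' : Joins G e' u w'} {c : Bush w} {c' : Bush w'} →
    graft (graft b e j c) e' j' c' ≈ graft (graft b e' j' c') e j c
  ≈-swap {b = b} {e} {e'} {c = c} {c'} = same-counts (λ v → +-swap (cntV b v) (cntV c v) (cntV c' v))
    (λ f → edges ⟦ δ e f ⟧ ⟦ δ e' f ⟧ (cntE b f) (cntE c f) (cntE c' f))
    where
    edges : ∀ e e' b c c' → e' + ((e + (b + c)) + c') ≡ e + ((e' + (b + c')) + c)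
    edges e e' b c c' = trans (cong (e' +_) (+-assoc e (b + c) c')) (trans (sym (+-assoc e' e _))
      (trans (cong₂ _+_ (+-comm e' e) (+-swap b c c')) (trans (+-assoc e e' _) (cong (e +_) (sym (+-assoc e' (b + c') c))))))

  spans-≈ : ∀ {T u w} {b : Bush u} {c : Bush w} → b ≈ c → Spans T b → Spans T c
  spans-≈ p s = record { edges = λ e → trans (sym (countE p e)) (Spans.edges s e) ; verts = λ v → subst (_≤ 1) (countV p v) (Spans.verts s v) }

  -- Zero is left out of `flows`: a root with a single child has only nonzero values to offer, and
  -- the edge above the piece carries a nonzero value anyway.
  record Mono (i : Fin 3) {u} (c : Bush u) : Set where
    field
      only  : ∀ v k → 1 ≤ cntV c v → col v ≡ just k → k ≡ i
      some  : ∃ λ v → (1 ≤ cntV c v) × (col v ≡ just i)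
      flows : ∀ x → x ≢ 𝟎 → Flow c (single i x)

  -- `chain` admits uncoloured vertices with a single child above the tip; their edges will be
  -- contracted. The order of the two pieces is a normal form, reached by swapping children.
  data Cherry (i : Fin 3) : ∀ {u} → Bush u → Set where
    tip   : ∀ {u w w'} {e e'} {j : Joins G e u w} {j' : Joins G e' u w'} {c : Bush w} {c' : Bush w'} → col u ≡ nothing →
      Mono (nextC i) c → Mono (prevC i) c' → Cherry i (graft (graft (bare u) e j c) e' j' c')
    chain : ∀ {u w e} {j : Joins G e u w} {c : Bush w} → col u ≡ nothing → Cherry i c → Cherry i (graft (bare u) e j c)

  data Branch (i : Fin 3) : ∀ {u} → Bush u → Set where
    tip   : ∀ {u w w'} {e e'} {j : Joins G e u w} {j' : Joins G e' u w'} {c : Bush w} {c' : Bush w'} → col u ≡ nothing →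
      Mono i c → Cherry i c' → Branch i (graft (graft (bare u) e j c) e' j' c')
    chain : ∀ {u w e} {j : Joins G e u w} {c : Bush w} → col u ≡ nothing → Branch i c → Branch i (graft (bare u) e j c)

  data Centre : ∀ {u} → Bush u → Set where
    centre : ∀ {u w₀ w₁ w₂ e₀ e₁ e₂} {j₀ : Joins G e₀ u w₀} {j₁ : Joins G e₁ u w₁} {j₂ : Joins G e₂ u w₂}
      {c₀ : Bush w₀} {c₁ : Bush w₁} {c₂ : Bush w₂} → col u ≡ nothing → Branch (# 0) c₀ → Branch (# 1) c₁ → Branch (# 2) c₂ →
      Centre (graft (graft (graft (bare u) e₀ j₀ c₀) e₁ j₁ c₁) e₂ j₂ c₂)

  Up : (∀ {w} → Bush w → Set) → ∀ {u} → Bush u → Set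
  Up P {u} b = Σ (Bush u) λ b' → (b ≈ b') × P b'

  Shape : Kind → ∀ {u} → Bush u → Set
  Shape (mono i)   c = Mono i c
  Shape (cherry i) c = Cherry i c
  Shape (branch i) c = Branch i c

  HasKind : Maybe Kind → ∀ {u} → Bush u → Set
  HasKind nothing             c = ⊤
  HasKind (just (mono i))     c = Mono i c
  HasKind (just (cherry i))   c = Up (Cherry i) c
  HasKind (just (branch i))   c = Up (Branch i) c

  OneChild : Kind → ∀ {u} → Bush u → Set
  OneChild κ {u} b = ∃ λ w → ∃ λ e → Σ (Joins G e u w) λ j → Σ (Bush w) λ c → (b ≈ graft (bare u) e j c) × Shape κ c

  TwoBranches : Fin 3 → Fin 3 → ∀ {u} → Bush u → Set
  TwoBranches i k {u} b = ∃ λ w → ∃ λ w' → ∃ λ e → ∃ λ e' → Σ (Joins G e u w) λ j → Σ (Joins G e' u w') λ j' →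
    Σ (Bush w) λ c → Σ (Bush w') λ c' → (b ≈ graft (graft (bare u) e j c) e' j' c') × Branch i c × Branch k c'

  HasTok : Tok → ∀ {u} → Bush u → Set
  HasTok none             b = ⊤
  HasTok empty    {u}     b = (col u ≡ nothing) × (b ≡ bare u)
  HasTok centre           b = Up Centre b
  -- Such a root may still become the tip of a cherry or of a branch, or stay a piece of colour `i`;
  -- both readings are kept.
  HasTok (one (mono i)) {u} b = (col u ≡ nothing) × OneChild (mono i) b × Mono i b
  HasTok (one κ)  {u}     b = (col u ≡ nothing) × OneChild κ b
  HasTok (many i)         b = Mono i b × (∀ x → Flow b (single i x))
  HasTok (pair i)         b = Up (Cherry i) b
  HasTok (fork i)         b = Up (Branch i) b
  HasTok (branches i) {u} b = (col u ≡ nothing) × TwoBranches (nextC i) (prevC i) b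

  kind-sound : ∀ t {u} (b : Bush u) → HasTok t b → HasKind (kind t) b
  kind-sound none             b _ = tt
  kind-sound empty            b _ = tt
  kind-sound centre           b _ = tt
  kind-sound (one (mono i))   b (_ , _ , p) = p
  kind-sound (one (cherry i)) b (p , _ , _ , _ , _ , q , s) = _ , q , chain p s
  kind-sound (one (branch i)) b (p , _ , _ , _ , _ , q , s) = _ , q , chain p s
  kind-sound (many i)         b (p , _) = p
  kind-sound (pair i)         b p = p
  kind-sound (fork i)         b p = p
  kind-sound (branches i)     b _ = tt

  if-δ : ∀ {i j : Fin 3} {t u} {b : Bush u} → (i ≡ j → HasTok t b) → HasTok (if δ i j then t else none) b
  if-δ {i} {j} h with i ≟ j
  ... | yes p = h p
  ... | no _  = tt

  bare∋ : ∀ {u v} → 1 ≤ cntV (bare u) v → u ≡ v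
  bare∋ p = δ-sound (1≤bit p)

  mono-graft : ∀ {i u w} {b : Bush u} {e} {j : Joins G e u w} {c : Bush w} → Mono i c →
    (∀ v k → 1 ≤ cntV b v → col v ≡ just k → k ≡ i) → (∀ x → x ≢ 𝟎 → Flow (graft b e j c) (single i x)) → Mono i (graft b e j c)
  mono-graft {b = b} M h F = record
    { only = λ v k p q → split v k (1≤+ (cntV b v) p) q
    ; some = let v , p , q = Mono.some M in v , ≤-trans p (m≤n+m _ _) , q
    ; flows = F }
    where
    split : ∀ v k → _ → col v ≡ just k → k ≡ _
    split v k (inj₁ p) q = h v k p q
    split v k (inj₂ p) q = Mono.only M v k p q

  mono+mono : ∀ {i u w} {b : Bush u} {e} {j : Joins G e u w} {c : Bush w} → Mono i b → Mono i c → HasTok (many i) (graft b e j c)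
  mono+mono {i} M M' = mono-graft M' (Mono.only M) (λ x _ → F x) , F
    where
    F : ∀ x → Flow _ (single i x)
    F x with nonzero-split x
    ... | y , z , p , q , r = subst (Flow _) (trans (single-⊞ i y z) (cong (single i) r))
      (graft (Mono.flows M y p) (Mono.flows M' z q) (λ s → q (trans (sym (∣single∣ i z)) s)))

  one-mono : ∀ {i u w} {e} {j : Joins G e u w} {c : Bush w} → col u ≡ nothing → Mono i c → Mono i (graft (bare u) e j c)
  one-mono {i} {u} p M = mono-graft M only F
    where
    only : ∀ v k → 1 ≤ cntV (bare u) v → col v ≡ just k → k ≡ i
    only v k q r with bare∋ {u} {v} q
    ... | refl with () ← trans (sym p) r
    F : ∀ x → x ≢ 𝟎 → Flow _ (single i x)
    F x h = (graft (bare₀ p) (Mono.flows M x h) (λ s → h (trans (sym (∣single∣ i x)) s)))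

  two-monos : ∀ i k {u w w'} {e e'} {j : Joins G e u w} {j' : Joins G e' u w'} {c : Bush w} {c' : Bush w'} → i ≢ k → col u ≡ nothing →
    Mono i c → Mono k c' → Up (Cherry (third i k)) (graft (graft (bare u) e j c) e' j' c')
  two-monos zero zero h = ⊥-elim (h refl)
  two-monos zero (suc zero) h p M M' = _ , ≈-refl , tip p M M'
  two-monos zero (suc (suc zero)) h p M M' = _ , ≈-swap , tip p M' M
  two-monos (suc zero) zero h p M M' = _ , ≈-swap , tip p M' M
  two-monos (suc zero) (suc zero) h = ⊥-elim (h refl)
  two-monos (suc zero) (suc (suc zero)) h p M M' = _ , ≈-refl , tip p M M'
  two-monos (suc (suc zero)) zero h p M M' = _ , ≈-refl , tip p M M'
  two-monos (suc (suc zero)) (suc zero) h p M M' = _ , ≈-swap , tip p M' M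
  two-monos (suc (suc zero)) (suc (suc zero)) h = ⊥-elim (h refl)

  two-branches : ∀ i k {u w w'} {e e'} {j : Joins G e u w} {j' : Joins G e' u w'} {c : Bush w} {c' : Bush w'} → i ≢ k →
    Branch i c → Branch k c' → TwoBranches (nextC (third i k)) (prevC (third i k)) (graft (graft (bare u) e j c) e' j' c')
  two-branches zero zero h = ⊥-elim (h refl)
  two-branches zero (suc zero) h M M' = _ , _ , _ , _ , _ , _ , _ , _ , ≈-refl , M , M'
  two-branches zero (suc (suc zero)) h M M' = _ , _ , _ , _ , _ , _ , _ , _ , ≈-swap , M' , M
  two-branches (suc zero) zero h M M' = _ , _ , _ , _ , _ , _ , _ , _ , ≈-swap , M' , M
  two-branches (suc zero) (suc zero) h = ⊥-elim (h refl)
  two-branches (suc zero) (suc (suc zero)) h M M' = _ , _ , _ , _ , _ , _ , _ , _ , ≈-refl , M , M'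
  two-branches (suc (suc zero)) zero h M M' = _ , _ , _ , _ , _ , _ , _ , _ , ≈-refl , M , M'
  two-branches (suc (suc zero)) (suc zero) h M M' = _ , _ , _ , _ , _ , _ , _ , _ , ≈-swap , M' , M
  two-branches (suc (suc zero)) (suc (suc zero)) h = ⊥-elim (h refl)

  ≈-graftˡ : ∀ {u w} {b b' : Bush u} {e} {j : Joins G e u w} {c : Bush w} → b ≈ b' → graft b e j c ≈ graft b' e j c
  ≈-graftˡ p = ≈-graft p ≈-refl

  three-branches : ∀ i {u} {b : Bush u} {w e} {j : Joins G e u w} {c : Bush w} → col u ≡ nothing →
    TwoBranches (nextC i) (prevC i) b → Branch i c → Up Centre (graft b e j c)
  three-branches zero p (_ , _ , _ , _ , _ , _ , _ , _ , q , B , B') B'' =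
    _ , ≈-trans (≈-graftˡ q) (≈-trans ≈-swap (≈-graftˡ ≈-swap)) , centre p B'' B B'
  three-branches (suc zero) p (_ , _ , _ , _ , _ , _ , _ , _ , q , B , B') B'' =
    _ , ≈-trans (≈-graftˡ q) (≈-trans (≈-graftˡ ≈-swap) ≈-swap) , centre p B' B'' B
  three-branches (suc (suc zero)) p (_ , _ , _ , _ , _ , _ , _ , _ , q , B , B') B'' =
    _ , ≈-graftˡ q , centre p B B' B''

  join-sound : ∀ t k {u w} (b : Bush u) e (j : Joins G e u w) (c : Bush w) → HasTok t b → HasKind k c → HasTok (join t k) (graft b e j c)
  join-sound none  k b e j c _ _ = tt
  join-sound empty nothing b e j c _ _ = tt
  join-sound empty (just (mono i))   b e j c (p , refl) M = p , (_ , _ , _ , _ , ≈-refl , M) , one-mono p M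
  join-sound empty (just (cherry i)) b e j c (p , refl) (_ , q , M) = p , _ , _ , _ , _ , ≈-graft ≈-refl q , M
  join-sound empty (just (branch i)) b e j c (p , refl) (_ , q , M) = p , _ , _ , _ , _ , ≈-graft ≈-refl q , M
  join-sound centre k b e j c _ _ = tt
  join-sound (one (mono i)) nothing b e j c _ _ = tt
  join-sound (one (mono i)) (just (mono k)) b e j c (p , (_ , _ , _ , _ , q , M) , MB) M' with i ≟ k
  ... | yes refl = mono+mono MB M'
  ... | no i≢k with two-monos i k {j = _} {j} i≢k p M M'
  ...   | b' , r , Ch = b' , ≈-trans (≈-graftˡ q) r , Ch
  join-sound (one (mono i)) (just (cherry k)) b e j c (p , (_ , _ , _ , _ , q , M) , _) (_ , r , Ch) =
    if-δ {i} {k} {fork i} λ { refl → _ , ≈-graft q r , tip p M Ch }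
  join-sound (one (mono i)) (just (branch k)) b e j c _ _ = tt
  join-sound (one (cherry i)) nothing b e j c _ _ = tt
  join-sound (one (cherry i)) (just (mono k)) b e j c (p , _ , _ , _ , _ , q , Ch) M =
    if-δ {i} {k} {fork i} λ { refl → _ , ≈-trans (≈-graftˡ q) ≈-swap , tip p M Ch }
  join-sound (one (cherry i)) (just (cherry k)) b e j c _ _ = tt
  join-sound (one (cherry i)) (just (branch k)) b e j c _ _ = tt
  join-sound (one (branch i)) nothing b e j c _ _ = tt
  join-sound (one (branch i)) (just (mono k)) b e j c _ _ = tt
  join-sound (one (branch i)) (just (cherry k)) b e j c _ _ = tt
  join-sound (one (branch i)) (just (branch k)) b e j c (p , _ , _ , _ , _ , q , B) (_ , r , B') with i ≟ k
  ... | yes _ = tt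
  ... | no i≢k with two-branches i k {j = _} {j} i≢k B B'
  ...   | _ , _ , _ , _ , _ , _ , _ , _ , s , X , Y = p , _ , _ , _ , _ , _ , _ , _ , _ , ≈-trans (≈-graft q r) s , X , Y
  join-sound (many i) nothing b e j c _ _ = tt
  join-sound (many i) (just (mono k)) b e j c h M = if-δ {i} {k} {many i} λ { refl → mono+mono (proj₁ h) M }
  join-sound (many i) (just (cherry k)) b e j c _ _ = tt
  join-sound (many i) (just (branch k)) b e j c _ _ = tt
  join-sound (pair i) k b e j c _ _ = tt
  join-sound (fork i) k b e j c _ _ = tt
  join-sound (branches i) nothing b e j c _ _ = tt
  join-sound (branches i) (just (mono k)) b e j c _ _ = tt
  join-sound (branches i) (just (cherry k)) b e j c _ _ = tt
  join-sound (branches i) (just (branch k)) b e j c (p , TB) (_ , r , B) =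
    if-δ {i} {k} {centre} λ { refl → let b' , s , X = three-branches i {j = j} p TB B in b' , ≈-trans (≈-graft ≈-refl r) s , X }

  tok-sound : ∀ {u} (b : Bush u) → HasTok (tok (st b)) b
  tok-sound (bare u) with col u in eq
  ... | nothing = eq , refl
  ... | just i  = record { only = only ; some = u , root∈ (bare u) , eq ; flows = λ x _ → bare₁ eq x } , bare₁ eq
    where
    only : ∀ v k → 1 ≤ cntV (bare u) v → col v ≡ just k → k ≡ i
    only v k p q with bare∋ {u} {v} p
    ... | refl = just-injective (trans (sym q) eq)
  tok-sound (graft b e j c) = join-sound (tok (st b)) (kind (tok (st c))) b e j c (tok-sound b) (kind-sound (tok (st c)) c (tok-sound c))

  infixr 5 _⊔_
  -- Two bushes merged at their common root: `K` replaces the bare root of the first one. During the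
  -- search the first holds the limbs still to be inspected, `K` those already inspected.
  _⊔_ : ∀ {u} → Bush u → Bush u → Bush u
  bare u        ⊔ K = K
  graft b e j c ⊔ K = graft (b ⊔ K) e j c

  ⊔-graft : ∀ {u w} (b K : Bush u) {e} {j : Joins G e u w} {c : Bush w} → graft (b ⊔ K) e j c ≈ b ⊔ graft K e j c
  ⊔-graft (bare u)        K = ≈-refl
  ⊔-graft (graft b f i d) K = ≈-trans ≈-swap (≈-graftˡ (⊔-graft b K))

  -- Seen from `w`, everything on the old side of `e` is one more limb at the new root.
  reroot : ∀ {u w} (B : Bush u) {e} (j : Joins G e u w) (c : Bush w) → graft B e j c ≈ c ⊔ graft (bare w) e (joins-sym j) B
  reroot B {e} j (bare w) = same-counts (λ v → +-comm (cntV B v) _) (λ f → cong (⟦ δ e f ⟧ +_) (+-comm (cntE B f) 0))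
  reroot B {e} j (graft c f i d) = same-counts
    (λ v → trans (sym (+-assoc (cntV B v) _ _)) (cong (_+ cntV d v) (countV (reroot B j c) v)))
    (λ g → trans (edges g) (cong (λ k → ⟦ δ f g ⟧ + (k + cntE d g)) (countE (reroot B j c) g)))
    where
    edges : ∀ g → ⟦ δ e g ⟧ + (cntE B g + (⟦ δ f g ⟧ + (cntE c g + cntE d g))) ≡ ⟦ δ f g ⟧ + ((⟦ δ e g ⟧ + (cntE B g + cntE c g)) + cntE d g)
    edges g = lemma ⟦ δ e g ⟧ (cntE B g) ⟦ δ f g ⟧ (cntE c g) (cntE d g)
      where
      lemma : ∀ e b f c d → e + (b + (f + (c + d))) ≡ f + ((e + (b + c)) + d)
      lemma e b f c d = begin
        e + (b + (f + (c + d))) ≡⟨ cong (e +_) (trans (sym (+-assoc b f (c + d))) (trans (cong (_+ (c + d)) (+-comm b f)) (+-assoc f b (c + d)))) ⟩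
        e + (f + (b + (c + d))) ≡⟨ trans (sym (+-assoc e f _)) (trans (cong (_+ (b + (c + d))) (+-comm e f)) (+-assoc f e _)) ⟩
        f + (e + (b + (c + d))) ≡⟨ cong (f +_) (trans (cong (e +_) (sym (+-assoc b c d))) (sym (+-assoc e (b + c) d))) ⟩
        f + ((e + (b + c)) + d) ∎
        where open ≡-Reasoning

  zero-flow : ∀ {u} (b : Bush u) → zeroIn (st b) ≡ true → Flow b (𝟎 , 𝟎 , 𝟎)
  zero-flow b p = orbits-sound b zero (head-lookup (orbits (st b)) p)
    where
    head-lookup : ∀ (v : Orbits) → Vec.head v ≡ true → lookup v zero ≡ true
    head-lookup (x ∷ v) q = q

  module Walk (T : EdgeSet G) (safe-span : ∀ {u} (b : Bush u) → Spans T b → good b ∅ ≡ true) where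

    Outcome : Set
    Outcome = (∃ λ r → Σ (Bush r) λ b → Spans T b × Flow b (𝟎 , 𝟎 , 𝟎)) ⊎ (∃ λ r → Σ (Bush r) λ b → Spans T b × Centre b)

    -- Invariant: no limb of K is big. A failing tree is entered through a big limb, which leaves a small one behind.
    walk : ∀ {u} (b K : Bush u) → Spans T (b ⊔ K) → big (st K) ≡ false → Outcome
    walk (bare u) K span h with zeroIn (st K) in z
    ... | true  = inj₁ (u , K , span , zero-flow K z)
    -- All limbs are inspected and none is big, the tree has no bridge and no zero flow is listed:
    -- the check leaves only the token `centre`.
    ... | false = at-centre (subst (λ t → HasTok t K) (failing-centre (st-∈ K) (trans (st-safe K ∅) (safe-span K span)) z h) (tok-sound K))
      where
      at-centre : Up Centre K → Outcome
      at-centre (b' , q , X) = inj₂ (u , b' , spans-≈ q span , X)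
    walk (graft {u} {w} b e j c) K span h = decide (zeroIn (st total)) refl (isBig bigOrbits (close (st c))) refl
      where
      B : Bush u
      B = b ⊔ K
      total : Bush u
      total = graft B e j c
      decide : ∀ z → zeroIn (st total) ≡ z → ∀ s → isBig bigOrbits (close (st c)) ≡ s → Outcome
      decide true  z s     q = inj₁ (u , total , span , zero-flow total z)
      decide false z false q = walk b (graft K e j c) (spans-≈ (⊔-graft b K) span) (cong₂ _∨_ h q)
      -- The recursion is on the part still to be inspected, here `c`, which shrinks although the
      -- tree keeps its size.
      decide false z true  q = walk c (graft (bare w) e (joins-sym j) B) (spans-≈ (reroot B j c) span)
        (cong₂ _∨_ (bareState-big (col w)) (failing-big (st-∈ B) (st-∈ c) q (trans (st-safe total ∅) (safe-span total span)) z))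

    explore : ∀ {u} (b : Bush u) → Spans T b → Outcome
    explore {u} b span = walk b (bare u) (spans-≈ (unit b) span) (bareState-big (col u))
      where
      unit : ∀ {u} (b : Bush u) → b ≈ b ⊔ bare u
      unit (bare u)        = ≈-refl
      unit (graft b e j c) = ≈-graftˡ (unit b)

-- The Petersen graph as a tree on the independent vertices cV: centre 0, then branch vertices bV and cherry vertices hV.
zV : Fin 10
zV = # 0

bV hV cV : Fin 3 → Fin 10
bV = lookup (# 1 ∷ # 4 ∷ # 5 ∷ [])
hV = lookup (# 2 ∷ # 9 ∷ # 8 ∷ [])
cV = lookup (# 6 ∷ # 3 ∷ # 7 ∷ [])

kB kM kH kN kP : Fin 3 → Fin 15
kB = lookup (# 0 ∷ # 4 ∷ # 5 ∷ [])
kM = lookup (# 6 ∷ # 3 ∷ # 10 ∷ [])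
kH = lookup (# 1 ∷ # 9 ∷ # 14 ∷ [])
kN = lookup (# 2 ∷ # 11 ∷ # 13 ∷ [])
kP = lookup (# 7 ∷ # 12 ∷ # 8 ∷ [])

-- The tree edge that leads into a vertex from the side of the centre. There is none for the centre,
-- whose fibre holds the root, and none for the three `cV`, whose fibres are held together by `C`.
entry : Fin 10 → Maybe (Fin 15)
entry = lookup (nothing ∷ just (# 0) ∷ just (# 1) ∷ nothing ∷ just (# 4) ∷ just (# 5) ∷ nothing ∷ nothing ∷ just (# 14) ∷ just (# 9) ∷ [])

PetJoins : Fin 15 → Fin 10 → Fin 10 → Set
PetJoins k a a' = ((proj₁ (petEdge k) ≡ a) × (proj₂ (petEdge k) ≡ a')) ⊎ ((proj₁ (petEdge k) ≡ a') × (proj₂ (petEdge k) ≡ a))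

pet-simple : ∀ k k' → ((proj₁ (petEdge k) ≡ proj₁ (petEdge k')) × (proj₂ (petEdge k) ≡ proj₂ (petEdge k'))) ⊎
  ((proj₁ (petEdge k) ≡ proj₂ (petEdge k')) × (proj₂ (petEdge k) ≡ proj₁ (petEdge k'))) → k ≡ k'
pet-simple = toWitness {a? = all? λ k → all? λ k' →
  (((proj₁ (petEdge k) ≟ proj₁ (petEdge k')) ×-dec (proj₂ (petEdge k) ≟ proj₂ (petEdge k'))) ⊎-dec
   ((proj₁ (petEdge k) ≟ proj₂ (petEdge k')) ×-dec (proj₂ (petEdge k) ≟ proj₁ (petEdge k')))) →-dec (k ≟ k')} tt

pet-loopless : ∀ k → proj₁ (petEdge k) ≢ proj₂ (petEdge k)
pet-loopless = toWitness {a? = all? λ k → ¬? (proj₁ (petEdge k) ≟ proj₂ (petEdge k))} tt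

pet-vertex : ∀ a → ∃ λ k → (proj₁ (petEdge k) ≡ a) ⊎ (proj₂ (petEdge k) ≡ a)
pet-vertex = toWitness {a? = all? λ a → any? λ k → (proj₁ (petEdge k) ≟ a) ⊎-dec (proj₂ (petEdge k) ≟ a)} tt

cV-injective : ∀ i k → cV i ≡ cV k → i ≡ k
cV-injective = toWitness {a? = all? λ i → all? λ k → (cV i ≟ cV k) →-dec (i ≟ k)} tt

entry-cV : ∀ i → entry (cV i) ≡ nothing
entry-cV zero             = refl
entry-cV (suc zero)       = refl
entry-cV (suc (suc zero)) = refl

zV≢cV : ∀ i → zV ≢ cV i
zV≢cV zero             ()
zV≢cV (suc zero)       ()
zV≢cV (suc (suc zero)) ()

petJoins? : ∀ k a a' → Dec (PetJoins k a a')
petJoins? k a a' = ((proj₁ (petEdge k) ≟ a) ×-dec (proj₂ (petEdge k) ≟ a')) ⊎-dec ((proj₁ (petEdge k) ≟ a') ×-dec (proj₂ (petEdge k) ≟ a))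

pet-B : ∀ i → PetJoins (kB i) zV (bV i)
pet-B = toWitness {a? = all? λ i → petJoins? (kB i) zV (bV i)} tt

pet-M : ∀ i → PetJoins (kM i) (bV i) (cV i)
pet-M = toWitness {a? = all? λ i → petJoins? (kM i) (bV i) (cV i)} tt

pet-H : ∀ i → PetJoins (kH i) (bV i) (hV i)
pet-H = toWitness {a? = all? λ i → petJoins? (kH i) (bV i) (hV i)} tt

pet-N : ∀ i → PetJoins (kN i) (hV i) (cV (nextC i))
pet-N = toWitness {a? = all? λ i → petJoins? (kN i) (hV i) (cV (nextC i))} tt

pet-P : ∀ i → PetJoins (kP i) (hV i) (cV (prevC i))
pet-P = toWitness {a? = all? λ i → petJoins? (kP i) (hV i) (cV (prevC i))} tt

entry-hV : ∀ i → entry (hV i) ≡ just (kH i)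
entry-hV zero             = refl
entry-hV (suc zero)       = refl
entry-hV (suc (suc zero)) = refl

-- Contraction to the Petersen graph

module Contraction (G : Graph) (T C : EdgeSet G) (dec : Decomposition G T C)
                   (col : Fin (n G) → Maybe (Fin 3)) (colouring : Colouring G C col) (conn : Connected G) where
  open Boundary G
  open Bushes G
  open Structures G col
  open Colouring colouring

  module Labelling (g : Fin 15 → E) where

    -- A tree cut into fibres: edges of `inP` are contracted, those of `nodeP` and `leafP` become
    -- edges of the Petersen graph. A piece of colour `i` goes to `cV i` as a whole.
    data Part : Fin 10 → ∀ {u} → Bush u → Set where
      bareP : ∀ {a u} → col u ≡ nothing → Part a (bare u)
      inP   : ∀ {a u w e} {b : Bush u} {j : Joins G e u w} {c : Bush w} → Part a b → Part a c → Part a (graft b e j c)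
      nodeP : ∀ {a a' u w} {b : Bush u} k {j : Joins G (g k) u w} {c : Bush w} → Part a b → PetJoins k a a' → entry a' ≡ just k →
        Part a' c → Part a (graft b (g k) j c)
      leafP : ∀ {a u w} {b : Bush u} k i {j : Joins G (g k) u w} {c : Bush w} → Part a b → PetJoins k a (cV i) →
        Mono i c → Part a (graft b (g k) j c)

    pick : ∀ {A : Set} {k} → (k ≡ 0) ⊎ (1 ≤ k) → A → A → A
    pick (inj₁ _) x y = y
    pick (inj₂ _) x y = x

    pick-∈ : ∀ {A : Set} {k} (d : (k ≡ 0) ⊎ (1 ≤ k)) {x y : A} → 1 ≤ k → pick d x y ≡ x
    pick-∈ (inj₁ refl) ()
    pick-∈ (inj₂ _)    p = refl

    pick-∉ : ∀ {A : Set} {k} (d : (k ≡ 0) ⊎ (1 ≤ k)) {x y : A} → (1 ≤ k → ⊥) → pick d x y ≡ y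
    pick-∉ (inj₁ _) h = refl
    pick-∉ (inj₂ p) h = ⊥-elim (h p)

    look : ∀ {a u} {b : Bush u} → Part a b → V → Fin 10
    look {a} (bareP _)                v = a
    look (inP {c = c} p q)            v = pick (0-or-1≤ (cntV c v)) (look q v) (look p v)
    look (nodeP k {c = c} p _ _ q)    v = pick (0-or-1≤ (cntV c v)) (look q v) (look p v)
    look (leafP k i {c = c} p _ _)    v = pick (0-or-1≤ (cntV c v)) (cV i) (look p v)

    used : ∀ {a u} {b : Bush u} → Part a b → List (Fin 15)
    used (bareP _)       = []
    used (inP p q)       = used p ++ used q
    used (nodeP k p _ _ q) = k ∷ (used p ++ used q)
    used (leafP k i p _ _) = k ∷ used p

    look-coloured : ∀ {a u} {b : Bush u} (p : Part a b) v i → 1 ≤ cntV b v → col v ≡ just i → look p v ≡ cV i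
    look-coloured {u = u} (bareP q) v i h r with bare∋ {u} {v} h
    ... | refl with () ← trans (sym q) r
    look-coloured (inP {b = b} {c = c} p q) v i h r with 0-or-1≤ (cntV c v)
    ... | inj₂ h' = look-coloured q v i h' r
    ... | inj₁ z  = look-coloured p v i (subst (1 ≤_) (trans (cong (cntV b v +_) z) (+-comm (cntV b v) 0)) h) r
    look-coloured (nodeP {b = b} k {c = c} p _ _ q) v i h r with 0-or-1≤ (cntV c v)
    ... | inj₂ h' = look-coloured q v i h' r
    ... | inj₁ z  = look-coloured p v i (subst (1 ≤_) (trans (cong (cntV b v +_) z) (+-comm (cntV b v) 0)) h) r
    look-coloured (leafP {b = b} k i' {c = c} p _ M) v i h r with 0-or-1≤ (cntV c v)
    ... | inj₂ h' = cong cV (sym (Mono.only M v i h' r))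
    ... | inj₁ z  = look-coloured p v i (subst (1 ≤_) (trans (cong (cntV b v +_) z) (+-comm (cntV b v) 0)) h) r

    module Fibres (φ : V → Fin 10) where

      inside : E → Bool
      inside e = does (φ (src G e) ≟ φ (tgt G e))

      inside-joins : ∀ {e u w} → Joins G e u w → φ u ≡ φ w → inside e ≡ true
      inside-joins (inj₁ (refl , refl)) p = dec-true (_ ≟ _) p
      inside-joins (inj₂ (refl , refl)) p = dec-true (_ ≟ _) (sym p)

      bush-connected : ∀ {u} (b : Bush u) {x} → (∀ v → 1 ≤ cntV b v → φ v ≡ x) → ∀ v → 1 ≤ cntV b v → Reach G inside v u
      bush-connected (bare u) h v p with bare∋ {u} {v} p
      ... | refl = here
      bush-connected (graft {w = w} b e j c) h v p with 1≤+ (cntV b v) p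
      ... | inj₁ q = bush-connected b (λ v q → h v (≤-trans q (m≤m+n _ _))) v q
      ... | inj₂ q = reach-trans (bush-connected c (λ v q → h v (≤-trans q (m≤n+m _ _))) v q)
        (step e (inside-joins j (trans (h _ (≤-trans (root∈ b) (m≤m+n _ _))) (sym (h w (≤-trans (root∈ c) (m≤n+m _ _)))))) (joins-sym j) here)

      -- An anchor to which `v` is joined within its fibre: the root, the far end of the entering
      -- edge, or a vertex of colour `i`. The fibre determines the anchor, up to moving along one
      -- component of `C`, so two vertices of a fibre are connected through it.
      Position : Fin 10 → V → V → Set
      Position a u v = ((φ v ≡ a) × Reach G inside v u) ⊎
        (∃ λ k → (entry (φ v) ≡ just k) × ∃ λ w → Incident G (g k) w × (φ w ≡ φ v) × Reach G inside v w) ⊎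
        (∃ λ i → (φ v ≡ cV i) × ∃ λ w → (col w ≡ just i) × Reach G inside v w)

      record Labels {u} (a : Fin 10) (b : Bush u) (ks : List (Fin 15)) : Set where
        field
          top      : φ u ≡ a
          edges    : ∀ f → 1 ≤ cntE b f → (inside f ≡ true) ⊎ (∃ λ k → g k ≡ f)
          ends     : ∀ k → k ∈ ks → ∃ λ x → ∃ λ y → Joins G (g k) x y × PetJoins k (φ x) (φ y)
          position : ∀ v → 1 ≤ cntV b v → Position a u v
      open Labels

      cases-E : ∀ {u w e} {b : Bush u} {j : Joins G e u w} {c : Bush w} {P : E → Set} → P e →
        (∀ f → 1 ≤ cntE b f → P f) → (∀ f → 1 ≤ cntE c f → P f) → ∀ f → 1 ≤ cntE (graft b e j c) f → P f
      cases-E {e = e} {b} {c = c} {P} pe pb pc f h with 1≤+ ⟦ δ e f ⟧ h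
      ... | inj₁ q = subst P (δ-sound (1≤bit q)) pe
      ... | inj₂ q with 1≤+ (cntE b f) q
      ...   | inj₁ r = pb f r
      ...   | inj₂ r = pc f r

      labels : ∀ {a u} {b : Bush u} (p : Part a b) → (∀ v → cntV b v ≤ 1) → (∀ v → 1 ≤ cntV b v → φ v ≡ look p v) → Labels a b (used p)
      labels {u = u} (bareP _) once agree = record
        { top = agree u (root∈ (bare u)) ; edges = λ f () ; ends = λ k ()
        ; position = λ v h → inj₁ (agree v h , subst (λ x → Reach G inside x u) (bare∋ {u} {v} h) here) }
      labels {a} {u} (inP {w = w} {e = e} {b = b} {j} {c} p q) once agree = record
        { top = top L
        ; edges = cases-E {b = b} {j} {c} (inj₁ (inside-joins j same)) (edges L) (edges R)
        ; ends = λ k i → [_,_]′ (ends L k) (ends R k) (∈-++⁻ (used p) i)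
        ; position = λ v h → [_,_]′ (position L v) (λ h' → move (position R v h')) (1≤+ (cntV b v) h) }
        where
        L = labels p (λ v → ≤-trans (m≤m+n _ _) (once v)) (λ v h → trans (agree v (≤-trans h (m≤m+n _ _)))
              (pick-∉ (0-or-1≤ (cntV c v)) (+≤1-disjoint (once v) h)))
        R = labels q (λ v → ≤-trans (m≤n+m _ _) (once v)) (λ v h → trans (agree v (≤-trans h (m≤n+m _ _)))
              (pick-∈ (0-or-1≤ (cntV c v)) h))
        same : φ u ≡ φ w
        same = trans (top L) (sym (top R))
        move : ∀ {v} → Position a w v → Position a u v
        move (inj₁ (x , r)) = inj₁ (x , reach-trans r (step e (inside-joins j same) (joins-sym j) here))
        move (inj₂ x)       = inj₂ x
      labels {a} {u} (nodeP {a' = a'} {w = w} {b = b} k {j} {c} p pj en q) once agree = record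
        { top = top L
        ; edges = cases-E {b = b} {j} {c} (inj₂ (k , refl)) (edges L) (edges R)
        ; ends = λ { k (here refl) → u , w , j , subst₂ (PetJoins k) (sym (top L)) (sym (top R)) pj
                   ; k (there i) → [_,_]′ (ends L k) (ends R k) (∈-++⁻ (used p) i) }
        ; position = λ v h → [_,_]′ (position L v) (λ h' → move (position R v h')) (1≤+ (cntV b v) h) }
        where
        L = labels p (λ v → ≤-trans (m≤m+n _ _) (once v)) (λ v h → trans (agree v (≤-trans h (m≤m+n _ _)))
              (pick-∉ (0-or-1≤ (cntV c v)) (+≤1-disjoint (once v) h)))
        R = labels q (λ v → ≤-trans (m≤n+m _ _) (once v)) (λ v h → trans (agree v (≤-trans h (m≤n+m _ _)))
              (pick-∈ (0-or-1≤ (cntV c v)) h))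
        move : ∀ {v} → Position a' w v → Position a u v
        move (inj₁ (x , r)) = inj₂ (inj₁ (k , trans (cong entry x) en , w , joins-incident (joins-sym j) , trans (top R) (sym x) , r))
        move (inj₂ x)       = inj₂ x
      labels {a} {u} (leafP {w = w} {b = b} k i {j} {c} p pj M) once agree = record
        { top = top L
        ; edges = cases-E {b = b} {j} {c} (inj₂ (k , refl)) (edges L) (λ f h → inj₁ (own-edge f h))
        ; ends = λ { k (here refl) → u , w , j , subst₂ (PetJoins k) (sym (top L)) (sym (own w (root∈ c))) pj
                   ; k (there i) → ends L k i }
        ; position = λ v h → [_,_]′ (position L v) (λ h' → inj₂ (inj₂ (i , own v h' , proj₁ (Mono.some M) , proj₂ (proj₂ (Mono.some M)) ,
            reach-trans (bush-connected c own v h') (reach-sym (bush-connected c own _ (proj₁ (proj₂ (Mono.some M)))))))) (1≤+ (cntV b v) h) }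
        where
        L = labels p (λ v → ≤-trans (m≤m+n _ _) (once v)) (λ v h → trans (agree v (≤-trans h (m≤m+n _ _)))
              (pick-∉ (0-or-1≤ (cntV c v)) (+≤1-disjoint (once v) h)))
        own : ∀ v → 1 ≤ cntV c v → φ v ≡ cV i
        own v h = trans (agree v (≤-trans h (m≤n+m _ _))) (pick-∈ (0-or-1≤ (cntV c v)) h)
        own-edge : ∀ f → 1 ≤ cntE c f → inside f ≡ true
        own-edge f h = inside-joins (inj₁ (refl , refl)) (trans (own _ (edge-ends∈ c f h (inj₁ refl))) (sym (own _ (edge-ends∈ c f h (inj₂ refl)))))

    part⇒contractible : ∀ {r} (b : Bush r) → Spans T b → (p : Part zV b) → (∀ k → k ∈ used p) → ContractibleToPetersen G
    part⇒contractible {r} b span p all-used = φ , onto , fibres , g , injective , ends′ , outer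
      where
      φcol : Maybe (Fin 3) → Fin 10 → Fin 10
      φcol nothing  x = x
      φcol (just i) x = cV i
      φ : V → Fin 10
      -- The colour decides first, because a vertex of `C` may lie off the tree.
      φ v = φcol (col v) (look p v)
      open Fibres φ
      agree : ∀ v → 1 ≤ cntV b v → φ v ≡ look p v
      agree v h with col v in eq
      ... | nothing = refl
      ... | just i  = sym (look-coloured p v i h eq)
      L : Labels zV b (used p)
      L = labels p (Spans.verts span) agree
      ends′ : ∀ j → (φ (src G (g j)) ≡ proj₁ (petEdge j) × φ (tgt G (g j)) ≡ proj₂ (petEdge j))
                  ⊎ (φ (src G (g j)) ≡ proj₂ (petEdge j) × φ (tgt G (g j)) ≡ proj₁ (petEdge j))
      ends′ j with Labels.ends L j (all-used j)
      ... | x , y , inj₁ (refl , refl) , inj₁ (q , r) = inj₁ (sym q , sym r)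
      ... | x , y , inj₁ (refl , refl) , inj₂ (q , r) = inj₂ (sym r , sym q)
      ... | x , y , inj₂ (refl , refl) , inj₁ (q , r) = inj₂ (sym r , sym q)
      ... | x , y , inj₂ (refl , refl) , inj₂ (q , r) = inj₁ (sym q , sym r)
      onto : ∀ a → ∃ λ v → φ v ≡ a
      onto a with pet-vertex a
      ... | k , h with ends′ k
      onto a | k , inj₁ h | inj₁ (q , _) = _ , trans q h
      onto a | k , inj₂ h | inj₁ (_ , q) = _ , trans q h
      onto a | k , inj₁ h | inj₂ (_ , q) = _ , trans q h
      onto a | k , inj₂ h | inj₂ (q , _) = _ , trans q h
      injective : Injective _≡_ _≡_ g
      injective {x} {y} q = pet-simple x y (combine (ends′ x) (subst (λ e → (φ (src G e) ≡ proj₁ (petEdge y) × φ (tgt G e) ≡ proj₂ (petEdge y))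
                  ⊎ (φ (src G e) ≡ proj₂ (petEdge y) × φ (tgt G e) ≡ proj₁ (petEdge y))) (sym q) (ends′ y)))
        where
        combine : ∀ {s t a b c d : Fin 10} → (s ≡ a × t ≡ b) ⊎ (s ≡ b × t ≡ a) → (s ≡ c × t ≡ d) ⊎ (s ≡ d × t ≡ c) →
          (a ≡ c × b ≡ d) ⊎ (a ≡ d × b ≡ c)
        combine (inj₁ (refl , refl)) (inj₁ (refl , refl)) = inj₁ (refl , refl)
        combine (inj₁ (refl , refl)) (inj₂ (refl , refl)) = inj₂ (refl , refl)
        combine (inj₂ (refl , refl)) (inj₁ (refl , refl)) = inj₂ (refl , refl)
        combine (inj₂ (refl , refl)) (inj₂ (refl , refl)) = inj₁ (refl , refl)
      φ-coloured : ∀ {v i} → col v ≡ just i → φ v ≡ cV i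
      φ-coloured {v} q = cong (λ k → φcol k (look p v)) q
      inside-C : ∀ e → C e ≡ true → inside e ≡ true
      inside-C e Ce with onEdge e Ce
      ... | i , q , r = inside-joins (inj₁ (refl , refl)) (trans (φ-coloured q) (sym (φ-coloured r)))
      inB : ∀ f → T f ≡ true → 1 ≤ cntE b f
      inB f Tf = subst (1 ≤_) (sym (Spans.edges span f)) (bit-true Tf)
      outer : ∀ e → inside e ≡ false → ∃ λ j → g j ≡ e
      outer e h with proj₂ dec e
      ... | inj₂ Ce = ⊥-elim (true≢false (trans (sym (inside-C e Ce)) h))
      ... | inj₁ Te with Labels.edges L e (inB e Te)
      ...   | inj₁ q = ⊥-elim (true≢false (trans (sym q) h))
      ...   | inj₂ q = q
      located : ∀ v → Position zV r v
      located v with 0-or-1≤ (cntV b v)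
      ... | inj₂ h = Labels.position L v h
      -- A vertex off the tree has an edge, as it is joined to the root, and this edge lies in `C`;
      -- hence the vertex is coloured.
      ... | inj₁ z = first (conn v r) refl
        where
        first : ∀ {x} → Reach G (everything G) x r → x ≡ v → Position zV r v
        first here refl = ⊥-elim (1≤⇒≢0 (root∈ b) z)
        first (step e _ j _) refl with proj₂ dec e
        ... | inj₁ Te = ⊥-elim (1≤⇒≢0 (edge-ends∈ b e (inB e Te) (joins-incident j)) z)
        ... | inj₂ Ce with onEdge e Ce
        ...   | i , q , q' = inj₂ (inj₂ (i , φ-coloured (own (joins-incident j)) , v , own (joins-incident j) , here))
          where
          own : Incident G e v → col v ≡ just i
          own (inj₁ refl) = q
          own (inj₂ refl) = q'
      apart : ∀ {k} {s t : Fin 10} → (s ≡ proj₁ (petEdge k) × t ≡ proj₂ (petEdge k)) ⊎ (s ≡ proj₂ (petEdge k) × t ≡ proj₁ (petEdge k)) → s ≢ t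
      apart {k} (inj₁ (refl , refl)) s = pet-loopless k s
      apart {k} (inj₂ (refl , refl)) s = pet-loopless k (sym s)
      one-end : ∀ k {x y} → Incident G (g k) x → Incident G (g k) y → φ x ≡ φ y → x ≡ y
      one-end k (inj₁ refl) (inj₁ refl) q = refl
      one-end k (inj₂ refl) (inj₂ refl) q = refl
      one-end k (inj₁ refl) (inj₂ refl) q = ⊥-elim (apart {k} (ends′ k) q)
      one-end k (inj₂ refl) (inj₁ refl) q = ⊥-elim (apart {k} (ends′ k) (sym q))
      nothing≢just : ∀ {k : Fin 15} → nothing ≢ just k
      nothing≢just ()
      fibres : ∀ u v → φ u ≡ φ v → Reach G inside u v
      fibres u v q = link (located u) (located v)
        where
        link : Position zV r u → Position zV r v → Reach G inside u v
        link (inj₁ (_ , x)) (inj₁ (_ , y)) = reach-trans x (reach-sym y)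
        link (inj₁ (s , _)) (inj₂ (inj₁ (k , t , _))) = ⊥-elim (nothing≢just (trans (cong entry (trans (sym s) q)) t))
        link (inj₁ (s , _)) (inj₂ (inj₂ (i , t , _))) = ⊥-elim (zV≢cV i (trans (sym s) (trans q t)))
        link (inj₂ (inj₁ (k , t , _))) (inj₁ (s , _)) = ⊥-elim (nothing≢just (trans (cong entry (trans (sym s) (sym q))) t))
        link (inj₂ (inj₁ (k , t , w , iw , s , x))) (inj₂ (inj₁ (k' , t' , w' , iw' , s' , y))) with just-injective (trans (sym t) (trans (cong entry q) t'))
        ... | refl = reach-trans x (subst (λ z → Reach G inside z v) (sym (one-end k iw iw' (trans s (trans q (sym s'))))) (reach-sym y))
        link (inj₂ (inj₁ (k , t , _))) (inj₂ (inj₂ (i , s , _))) = ⊥-elim (nothing≢just (trans (trans (sym (entry-cV i)) (cong entry (trans (sym s) (sym q)))) t))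
        link (inj₂ (inj₂ (i , s , _))) (inj₁ (t , _)) = ⊥-elim (zV≢cV i (trans (sym t) (trans (sym q) s)))
        link (inj₂ (inj₂ (i , s , _))) (inj₂ (inj₁ (k , t , _))) = ⊥-elim (nothing≢just (trans (trans (sym (entry-cV i)) (cong entry (trans (sym s) q))) t))
        link (inj₂ (inj₂ (i , s , w , cw , x))) (inj₂ (inj₂ (i' , s' , w' , cw' , y))) with cV-injective i i' (trans (sym s) (trans q s'))
        ... | refl = reach-trans x (reach-trans (reach-mono inside-C (connected w w' i cw cw')) (reach-sym y))

  cherryN cherryP : ∀ {i u} {b : Bush u} → Cherry i b → E
  cherryN (tip {e = e} _ _ _) = e
  cherryN (chain _ X)         = cherryN X
  cherryP (tip {e' = e} _ _ _) = e
  cherryP (chain _ X)          = cherryP X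

  branchM branchH branchN branchP : ∀ {i u} {b : Bush u} → Branch i b → E
  branchM (tip {e = e} _ _ _) = e
  branchM (chain _ X)         = branchM X
  branchH (tip {e' = e} _ _ _) = e
  branchH (chain _ X)          = branchH X
  branchN (tip _ _ X) = cherryN X
  branchN (chain _ X) = branchN X
  branchP (tip _ _ X) = cherryP X
  branchP (chain _ X) = branchP X

  module _ (g : Fin 15 → E) where
    open Labelling g

    cherry-part : ∀ {i u} {b : Bush u} (X : Cherry i b) → g (kN i) ≡ cherryN X → g (kP i) ≡ cherryP X →
      Σ (Part (hV i) b) λ p → used p ≡ kP i ∷ kN i ∷ []
    cherry-part {i} (tip h M M') refl refl = leafP (kP i) (prevC i) (leafP (kN i) (nextC i) (bareP h) (pet-N i) M) (pet-P i) M' , refl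
    cherry-part (chain h X) p q with cherry-part X p q
    ... | r , s = inP (bareP h) r , s

    branch-part : ∀ {i u} {b : Bush u} (X : Branch i b) → g (kM i) ≡ branchM X → g (kH i) ≡ branchH X →
      g (kN i) ≡ branchN X → g (kP i) ≡ branchP X → Σ (Part (bV i) b) λ p → used p ≡ kH i ∷ kM i ∷ kP i ∷ kN i ∷ []
    branch-part {i} (tip h M X) refl refl p q with cherry-part X p q
    ... | r , s = nodeP (kH i) (leafP (kM i) i (bareP h) (pet-M i) M) (pet-H i) (entry-hV i) r , cong (λ l → kH i ∷ kM i ∷ l) s
    branch-part (chain h X) p q p' q' with branch-part X p q p' q'
    ... | r , s = inP (bareP h) r , s

  centre⇒contractible : ∀ {r} {b : Bush r} → Spans T b → Centre b → ContractibleToPetersen G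
  centre⇒contractible span (centre {e₀ = e₀} {e₁} {e₂} h X₀ X₁ X₂) =
    part⇒contractible _ span (nodeP (# 5) (nodeP (# 4) (nodeP (# 0) (bareP h) (pet-B (# 0)) refl (proj₁ P₀)) (pet-B (# 1)) refl (proj₁ P₁)) (pet-B (# 2)) refl (proj₁ P₂))
      all-used
    where
    g : Fin 15 → E
    -- In the order of `petEdge`: position `kB i` holds the edge from the centre, positions `kM i`,
    -- `kH i`, `kN i`, `kP i` the four edges of branch `i`.
    g = lookup (e₀ ∷ branchH X₀ ∷ branchN X₀ ∷ branchM X₁ ∷ e₁ ∷ e₂ ∷ branchM X₀ ∷ branchP X₀ ∷ branchP X₂ ∷ branchH X₁ ∷
                branchM X₂ ∷ branchN X₁ ∷ branchP X₁ ∷ branchN X₂ ∷ branchH X₂ ∷ [])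
    open Labelling g
    P₀ = branch-part g X₀ refl refl refl refl
    P₁ = branch-part g X₁ refl refl refl refl
    P₂ = branch-part g X₂ refl refl refl refl
    ks : List (Fin 15) → List (Fin 15) → List (Fin 15) → List (Fin 15)
    ks x y z = # 5 ∷ ((# 4 ∷ ((# 0 ∷ x) ++ y)) ++ z)
    everywhere : ∀ k → k ∈ ks (kH (# 0) ∷ kM (# 0) ∷ kP (# 0) ∷ kN (# 0) ∷ []) (kH (# 1) ∷ kM (# 1) ∷ kP (# 1) ∷ kN (# 1) ∷ [])
      (kH (# 2) ∷ kM (# 2) ∷ kP (# 2) ∷ kN (# 2) ∷ [])
    everywhere = toWitness {a? = all? λ k → DecMembership._∈?_ _≟_ k _} tt
    all-used : ∀ k → k ∈ ks (used (proj₁ P₀)) (used (proj₁ P₁)) (used (proj₁ P₂))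
    all-used k rewrite proj₂ P₀ | proj₂ P₁ | proj₂ P₂ = everywhere k

-- The four labels used around each colour of the Petersen structure, read off a 5-cycle double cover of the Petersen graph.
slot : Fin 3 → Fin 5 → Maybe (Fin 4)
slot zero             = lookup (just (# 2) ∷ just (# 3) ∷ just (# 0) ∷ just (# 1) ∷ nothing ∷ [])
slot (suc zero)       = lookup (just (# 2) ∷ just (# 3) ∷ just (# 0) ∷ nothing ∷ just (# 1) ∷ [])
slot (suc (suc zero)) = lookup (just (# 2) ∷ just (# 3) ∷ just (# 1) ∷ just (# 0) ∷ nothing ∷ [])

slot-partition : ∀ i x → sumFin 5 (λ l → ⟦ onCycle (slot i l) x ⟧) ≡ 1
slot-partition i (false , false) = all-Fin3 {λ i → sumFin 5 (λ l → ⟦ onCycle (slot i l) 𝟎 ⟧) ≡ 1} refl refl refl i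
slot-partition i 𝟏               = all-Fin3 {λ i → sumFin 5 (λ l → ⟦ onCycle (slot i l) 𝟏 ⟧) ≡ 1} refl refl refl i
slot-partition i 𝟐               = all-Fin3 {λ i → sumFin 5 (λ l → ⟦ onCycle (slot i l) 𝟐 ⟧) ≡ 1} refl refl refl i
slot-partition i 𝟑               = all-Fin3 {λ i → sumFin 5 (λ l → ⟦ onCycle (slot i l) 𝟑 ⟧) ≡ 1} refl refl refl i

Weight2 : (Fin 5 → Bool) → Set
Weight2 ω = sumFin 5 (λ l → ⟦ ω l ⟧) ≡ 2

slot-weight : ∀ i x y → x ≢ 𝟎 → Weight2 (λ l → encSlot (slot i l) x y)
slot-weight i (false , false) y     h = ⊥-elim (h refl)
slot-weight i 𝟏               false h = all-Fin3 {λ i → Weight2 (λ l → encSlot (slot i l) 𝟏 false)} refl refl refl i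
slot-weight i 𝟏               true  h = all-Fin3 {λ i → Weight2 (λ l → encSlot (slot i l) 𝟏 true)} refl refl refl i
slot-weight i 𝟐               false h = all-Fin3 {λ i → Weight2 (λ l → encSlot (slot i l) 𝟐 false)} refl refl refl i
slot-weight i 𝟐               true  h = all-Fin3 {λ i → Weight2 (λ l → encSlot (slot i l) 𝟐 true)} refl refl refl i
slot-weight i 𝟑               false h = all-Fin3 {λ i → Weight2 (λ l → encSlot (slot i l) 𝟑 false)} refl refl refl i
slot-weight i 𝟑               true  h = all-Fin3 {λ i → Weight2 (λ l → encSlot (slot i l) 𝟑 true)} refl refl refl i

-- The three pieces at each colour carry `𝟏`, `𝟐` and `𝟑`, which sum to zero. In a single
-- GF(2)²-flow the edge from the centre into a branch would carry `𝟏 ⊕ 𝟐 ⊕ 𝟑`, that is zero; as the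
-- roles of the labels vary with the colour, the label vectors of the three pieces still add up to
-- weight two.
cherryLabel branchLabel : Fin 3 → Fin 5 → Bool
cherryLabel i l = encSlot (slot (nextC i) l) 𝟐 false xor encSlot (slot (prevC i) l) 𝟑 false
branchLabel i l = encSlot (slot i l) 𝟏 false xor cherryLabel i l

cherryLabel-weight : ∀ i → Weight2 (cherryLabel i)
cherryLabel-weight = all-Fin3 refl refl refl

branchLabel-weight : ∀ i → Weight2 (branchLabel i)
branchLabel-weight = all-Fin3 refl refl refl

-- The polar form of `quad`. It measures how the parity of a piece reacts to a constant added to
-- `g`.
symp : V4 → V4 → Bool
symp (a , b) (c , d) = (d ∧ a) xor (c ∧ b)

quad-⊕ : ∀ x y → quad (x ⊕ y) ≡ quad x xor (quad y xor symp x y)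
quad-⊕ (a , b) (c , d) = solve 4 (λ a b c d → (a :+ c) :* (b :+ d) := (a :* b) :+ ((c :* d) :+ ((d :* a) :+ (c :* b)))) refl a b c d

symp-𝟎 : ∀ π → symp 𝟎 π ≡ false
symp-𝟎 (c , d) = cong₂ _xor_ (∧-zeroʳ d) (∧-zeroʳ c)

-- Parities and cuts in the Petersen structure

module SixCover (G : Graph) (T C : EdgeSet G) (dec : Decomposition G T C) (cyc : IsCycle G C)
                (col : Fin (n G) → Maybe (Fin 3)) (colouring : Colouring G C col) where
  open Boundary G
  open Bushes G
  open Dynamic G col
  open Colouring colouring
  open Coloured G T C dec cyc col colouring
  open Labelled G T C dec cyc col colouring
  open Structures G col

  -- Adding π i to a lift around colour i changes the parity of a piece with total x by symp x (π i).
  module Shift {a : V → V4} (uncoloured : ∀ v → col v ≡ nothing → a v ≡ 𝟎) (L : Lift a) (π : Fin 3 → V4) where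
    open Lift L

    πcol : Maybe (Fin 3) → V4
    πcol nothing  = 𝟎
    πcol (just i) = π i

    mask : Bool → V4 → V4
    mask c (x , y) = c ∧ x , c ∧ y

    g′ : E → V4
    g′ e = g e ⊕ mask (C e) (πcol (col (src G e)))

    J J′ : V → Bool
    J  = ∂ (λ e → quad (g e))
    J′ = ∂ (λ e → quad (g′ e))

    constant : ∀ (p : V4 → Bool) v → ∂ (λ e → C e ∧ p (πcol (col (src G e)))) v ≡ false
    constant p v = trans (∂-local {S' = λ e → p (πcol (col v)) ∧ C e} v local) (trans (∂-∧ _ C v) (trans (cong (p (πcol (col v)) ∧_) (cycle⇒∂ cyc v)) (∧-zeroʳ _)))
      where
      local : ∀ e → Incident G e v → C e ∧ p (πcol (col (src G e))) ≡ p (πcol (col v)) ∧ C e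
      local e inc with C e in Ce
      ... | false = sym (∧-zeroʳ _)
      ... | true with onEdge e Ce
      ...   | i , q , _ = trans (cong (λ k → p (πcol k)) (trans q (sym (incident-col Ce inc q)))) (sym (∧-identityʳ _))

    -- Near `v` the added constant is a fixed `p`, so `quad` changes by `quad p` on `C` and by
    -- `symp` of `g` and `p`. The first part has no boundary because `C` is even; the second is
    -- linear in `g`.
    J′-formula : ∀ v → J′ v ≡ J v xor symp (a v) (πcol (col v))
    J′-formula v = trans (∂-local {S' = λ e → quad (g e) xor ((quad p ∧ C e) xor ((proj₂ p ∧ proj₁ (g e)) xor (proj₁ p ∧ proj₂ (g e))))} v local)
      (trans (∂-xor _ _ v) (cong (J v xor_) (trans (∂-xor _ _ v) (cong₂ _xor_
        (trans (∂-∧ (quad p) C v) (trans (cong (quad p ∧_) (cycle⇒∂ cyc v)) (∧-zeroʳ (quad p))))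
        (trans (∂-xor _ _ v) (cong₂ _xor_ (trans (∂-∧ (proj₂ p) _ v) (cong (proj₂ p ∧_) (∂₁ v))) (trans (∂-∧ (proj₁ p) _ v) (cong (proj₁ p ∧_) (∂₂ v)))))))))
      where
      p : V4
      p = πcol (col v)
      local : ∀ e → Incident G e v → quad (g′ e) ≡ quad (g e) xor ((quad p ∧ C e) xor symp (g e) p)
      local e inc = go (C e) refl
        where
        go : ∀ c → C e ≡ c → quad (g e ⊕ mask c (πcol (col (src G e)))) ≡ quad (g e) xor ((quad p ∧ c) xor symp (g e) p)
        go false Ce rewrite offC e Ce = sym (cong₂ _xor_ (∧-zeroʳ (quad p)) (symp-𝟎 p))
        go true Ce with onEdge e Ce
        ... | i , q , _ = trans (cong (λ k → quad (g e ⊕ πcol k)) (trans q (sym (incident-col Ce inc q))))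
          (trans (quad-⊕ (g e) p) (cong (λ x → quad (g e) xor (x xor symp (g e) p)) (sym (∧-identityʳ (quad p)))))

    shifted : Lift a
    shifted = record
      { g = g′
      ; offC = λ e p → trans (cong (λ z → z ⊕ mask (C e) (πcol (col (src G e)))) (offC e p)) (cong (λ c → mask c (πcol (col (src G e)))) p)
      ; ∂₁ = λ v → trans (∂-xor _ _ v) (trans (cong₂ _xor_ (∂₁ v) (constant proj₁ v)) (xor-identityʳ _))
      ; ∂₂ = λ v → trans (∂-xor _ _ v) (trans (cong₂ _xor_ (∂₂ v) (constant proj₂ v)) (xor-identityʳ _))
      ; ∂-quad = λ v p → trans (J′-formula v) (cong₂ _xor_ (∂-quad v p) (trans (cong (λ x → symp x (πcol (col v))) p) (symp-𝟎 (πcol (col v))))) }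

  record Agree (a a' : V → V4) {u} (b : Bush u) : Set where
    constructor agreeing
    field same : ∀ v → 1 ≤ cntV b v → a v ≡ a' v
  open Agree

  record Once {u} (b : Bush u) : Set where
    constructor at-most
    field bound : ∀ v → cntV b v ≤ 1
  open Once

  onceˡ : ∀ {u w} {b : Bush u} {e} {j : Joins G e u w} {c : Bush w} → Once (graft b e j c) → Once b
  onceˡ h = at-most λ v → ≤-trans (m≤m+n _ _) (bound h v)

  onceʳ : ∀ {u w} {b : Bush u} {e} {j : Joins G e u w} {c : Bush w} → Once (graft b e j c) → Once c
  onceʳ {b = b} h = at-most λ v → ≤-trans (m≤n+m _ (cntV b v)) (bound h v)

  agreeˡ : ∀ {a u w} (a₁ a₂ : V → V4) {b : Bush u} {e} {j : Joins G e u w} {c : Bush w} → Once (graft b e j c) →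
    (∀ v → cntV c v ≡ 0 → a₂ v ≡ 𝟎) → Agree a (λ v → a₁ v ⊕ a₂ v) (graft b e j c) → Agree a a₁ b
  agreeˡ a₁ a₂ {c = c} o off h = agreeing λ v p → trans (same h v (≤-trans p (m≤m+n _ _)))
    (trans (cong (a₁ v ⊕_) (off v (¬1≤⇒0 (cntV c v) (+≤1-disjoint (bound o v) p)))) (⊕-identityʳ (a₁ v)))

  agreeʳ : ∀ {a u w} (a₁ a₂ : V → V4) {b : Bush u} {e} {j : Joins G e u w} {c : Bush w} → Once (graft b e j c) →
    (∀ v → cntV b v ≡ 0 → a₁ v ≡ 𝟎) → Agree a (λ v → a₁ v ⊕ a₂ v) (graft b e j c) → Agree a a₂ c
  agreeʳ a₁ a₂ {b = b} o off h = agreeing λ v p → trans (same h v (≤-trans p (m≤n+m _ (cntV b v))))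
    (cong (_⊕ a₂ v) (off v (¬1≤⇒0 (cntV b v) (λ q → +≤1-disjoint (bound o v) q p))))

  agree-limb : ∀ {a a' u w} {b : Bush u} {e} {j : Joins G e u w} {c : Bush w} → Agree a a' (graft b e j c) → Agree a a' c
  agree-limb {b = b} h = agreeing λ v p → same h v (≤-trans p (m≤n+m _ (cntV b v)))

  +≡0⁻ : ∀ k {l} → k + l ≡ 0 → (k ≡ 0) × (l ≡ 0)
  +≡0⁻ zero p = refl , p

  𝟏≢𝟎 : 𝟏 ≢ 𝟎
  𝟏≢𝟎 ()
  𝟐≢𝟎 : 𝟐 ≢ 𝟎
  𝟐≢𝟎 ()
  𝟑≢𝟎 : 𝟑 ≢ 𝟎
  𝟑≢𝟎 ()

  pieceFlow : ∀ {i u} {c : Bush u} → Mono i c → ∀ x → x ≢ 𝟎 → V → V4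
  pieceFlow M x h = abs (Mono.flows M x h)

  cherryFlow : ∀ {i u} {b : Bush u} → Cherry i b → V → V4
  cherryFlow (tip _ M M') v = pieceFlow M 𝟐 𝟐≢𝟎 v ⊕ pieceFlow M' 𝟑 𝟑≢𝟎 v
  cherryFlow (chain _ X)  v = cherryFlow X v

  branchFlow : ∀ {i u} {b : Bush u} → Branch i b → V → V4
  branchFlow (tip _ M X)  v = pieceFlow M 𝟏 𝟏≢𝟎 v ⊕ cherryFlow X v
  branchFlow (chain _ X)  v = branchFlow X v

  cherry-off : ∀ {i u} {b : Bush u} (X : Cherry i b) v → cntV b v ≡ 0 → cherryFlow X v ≡ 𝟎
  cherry-off (tip {u} {e = e} {j = j} {c = c} _ M M') v p = let q , r = +≡0⁻ (cntV (graft (bare u) e j c) v) p ; _ , s = +≡0⁻ (cntV (bare u) v) q in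
    cong₂ _⊕_ (abs-off (Mono.flows M 𝟐 𝟐≢𝟎) v s) (abs-off (Mono.flows M' 𝟑 𝟑≢𝟎) v r)
  cherry-off (chain {u} {j = j} _ X) v p = cherry-off X v (proj₂ (+≡0⁻ (cntV (bare u) v) p))

  branch-off : ∀ {i u} {b : Bush u} (X : Branch i b) v → cntV b v ≡ 0 → branchFlow X v ≡ 𝟎
  branch-off (tip {u} {e = e} {j = j} {c = c} _ M X) v p = let q , r = +≡0⁻ (cntV (graft (bare u) e j c) v) p ; _ , s = +≡0⁻ (cntV (bare u) v) q in
    cong₂ _⊕_ (abs-off (Mono.flows M 𝟏 𝟏≢𝟎) v s) (cherry-off X v r)
  branch-off (chain {u} {j = j} _ X) v p = branch-off X v (proj₂ (+≡0⁻ (cntV (bare u) v) p))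

  cherry-uncoloured : ∀ {i u} {b : Bush u} (X : Cherry i b) v → col v ≡ nothing → cherryFlow X v ≡ 𝟎
  cherry-uncoloured (tip _ M M') v p = cong₂ _⊕_ (abs-uncoloured (Mono.flows M 𝟐 𝟐≢𝟎) v p) (abs-uncoloured (Mono.flows M' 𝟑 𝟑≢𝟎) v p)
  cherry-uncoloured (chain _ X) v p = cherry-uncoloured X v p

  branch-uncoloured : ∀ {i u} {b : Bush u} (X : Branch i b) v → col v ≡ nothing → branchFlow X v ≡ 𝟎
  branch-uncoloured (tip _ M X) v p = cong₂ _⊕_ (abs-uncoloured (Mono.flows M 𝟏 𝟏≢𝟎) v p) (cherry-uncoloured X v p)
  branch-uncoloured (chain _ X) v p = branch-uncoloured X v p

  module ColourSum (ψ : V4 → Bool) (add : Additive ψ) (k : Fin 3) where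

    total : (V → V4) → Bool
    total a = xsum (λ v → isCol k v ∧ ψ (a v))

    total-⊕ : ∀ a a' → total (λ v → a v ⊕ a' v) ≡ total a xor total a'
    total-⊕ a a' = trans (xsum-cong (λ v → trans (cong (isCol k v ∧_) (add (a v) (a' v))) (∧-distribˡ-xor (isCol k v) _ _))) (xsum-xor _ _)

    total-cherry : ∀ {i u} {b : Bush u} (X : Cherry i b) → total (cherryFlow X) ≡ ψ (coord (single (nextC i) 𝟐) k) xor ψ (coord (single (prevC i) 𝟑) k)
    total-cherry (tip _ M M') = trans (total-⊕ _ _) (cong₂ _xor_ (abs-sum ψ add (Mono.flows M 𝟐 𝟐≢𝟎) k) (abs-sum ψ add (Mono.flows M' 𝟑 𝟑≢𝟎) k))
    total-cherry (chain _ X)  = total-cherry X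

    total-branch : ∀ {i u} {b : Bush u} (X : Branch i b) →
      total (branchFlow X) ≡ ψ (coord (single i 𝟏) k) xor (ψ (coord (single (nextC i) 𝟐) k) xor ψ (coord (single (prevC i) 𝟑) k))
    total-branch (tip _ M X) = trans (total-⊕ _ _) (cong₂ _xor_ (abs-sum ψ add (Mono.flows M 𝟏 𝟏≢𝟎) k) (total-cherry X))
    total-branch (chain _ X) = total-branch X

  cherryN-sum cherryP-sum : (V → Bool) → ∀ {i u} {b : Bush u} → Cherry i b → Bool
  cherryN-sum J (tip {c = c} _ _ _)   = sumB J c
  cherryN-sum J (chain _ X)           = cherryN-sum J X
  cherryP-sum J (tip {c' = c'} _ _ _) = sumB J c'
  cherryP-sum J (chain _ X)           = cherryP-sum J X

  branchM-sum branchN-sum branchP-sum : (V → Bool) → ∀ {i u} {b : Bush u} → Branch i b → Bool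
  branchM-sum J (tip {c = c} _ _ _) = sumB J c
  branchM-sum J (chain _ X)         = branchM-sum J X
  branchN-sum J (tip _ _ X) = cherryN-sum J X
  branchN-sum J (chain _ X) = branchN-sum J X
  branchP-sum J (tip _ _ X) = cherryP-sum J X
  branchP-sum J (chain _ X) = branchP-sum J X

  module Restricted (J : V → Bool) (J-uncoloured : ∀ v → col v ≡ nothing → J v ≡ false) (k : Fin 3) where

    Jk : V → Bool
    Jk v = isCol k v ∧ J v

    at-uncoloured : ∀ {v} → col v ≡ nothing → Jk v ≡ false
    at-uncoloured {v} p = trans (cong (isCol k v ∧_) (J-uncoloured v p)) (∧-zeroʳ (isCol k v))

    mono-restricted : ∀ {i u} {c : Bush u} → Mono i c → sumB Jk c ≡ δ i k ∧ sumB J c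
    mono-restricted {i} {c = c} M = trans (sumB-cong c at) (sumB-∧ (δ i k) J c)
      where
      at : ∀ v → 1 ≤ cntV c v → Jk v ≡ δ i k ∧ J v
      at v p with col v in eq
      ... | nothing = sym (trans (cong (δ i k ∧_) (J-uncoloured v eq)) (∧-zeroʳ (δ i k)))
      ... | just i' = cong (λ x → δ x k ∧ J v) (Mono.only M v i' p eq)

    cherry-restricted : ∀ {i u} {b : Bush u} (X : Cherry i b) → sumB Jk b ≡ (δ (nextC i) k ∧ cherryN-sum J X) xor (δ (prevC i) k ∧ cherryP-sum J X)
    cherry-restricted (tip h M M') = cong₂ _xor_ (cong₂ _xor_ (at-uncoloured h) (mono-restricted M)) (mono-restricted M')
    cherry-restricted (chain h X)  = cong₂ _xor_ (at-uncoloured h) (cherry-restricted X)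

    branch-restricted : ∀ {i u} {b : Bush u} (X : Branch i b) →
      sumB Jk b ≡ (δ i k ∧ branchM-sum J X) xor ((δ (nextC i) k ∧ branchN-sum J X) xor (δ (prevC i) k ∧ branchP-sum J X))
    branch-restricted (tip h M X)  = cong₂ _xor_ (cong₂ _xor_ (at-uncoloured h) (mono-restricted M)) (cherry-restricted X)
    branch-restricted (chain h X)  = cong₂ _xor_ (at-uncoloured h) (branch-restricted X)

  module Shifted {a : V → V4} (uncoloured : ∀ v → col v ≡ nothing → a v ≡ 𝟎) (L : Lift a) (π : Fin 3 → V4) where
    open Shift uncoloured L π

    sumB-symp : ∀ p {u} (c : Bush u) → sumB (λ v → symp (a v) p) c ≡ symp (sum4 a c) p
    sumB-symp (p , q) c = trans (sumB-xor _ _ c) (cong₂ _xor_ (sumB-∧ q _ c) (sumB-∧ p _ c))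

    mono-shift : ∀ {i u} {c : Bush u} (M : Mono i c) x (h : x ≢ 𝟎) → Once c → Agree a (pieceFlow M x h) c →
      sumB J′ c ≡ sumB J c xor symp x (π i)
    mono-shift {i} {c = c} M x h once agree = trans (sumB-cong c at) (trans (sumB-xor J _ c) (cong (sumB J c xor_)
      (trans (sumB-symp (π i) c) (cong (λ y → symp y (π i)) (trans (proj₂ (abs-cuts a (Mono.flows M x h) (bound once) (same agree))) (∣single∣ i x))))))
      where
      at : ∀ v → 1 ≤ cntV c v → J′ v ≡ J v xor symp (a v) (π i)
      at v p = trans (J′-formula v) (cong (J v xor_) colour)
        where
        colour : symp (a v) (πcol (col v)) ≡ symp (a v) (π i)
        colour with col v in eq
        ... | nothing rewrite uncoloured v eq = trans (symp-𝟎 𝟎) (sym (symp-𝟎 (π i)))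
        ... | just i' = cong (λ k → symp (a v) (π k)) (Mono.only M v i' p eq)

    -- `symp 𝟐` reads off the first coordinate of the constant, and `symp 𝟏` the second. The pieces
    -- with values `𝟐` and `𝟏` at one colour are thus corrected independently of each other.
    cherryN-shift : ∀ {i u} {b : Bush u} (X : Cherry i b) → Once b → Agree a (cherryFlow X) b →
      cherryN-sum J′ X ≡ cherryN-sum J X xor proj₁ (π (nextC i))
    cherryN-shift {i} (tip {u} {e = e} {j = j} {c = c} {c'} _ M M') once agree =
      trans (mono-shift M 𝟐 𝟐≢𝟎 (onceʳ (onceˡ once))
        (agree-limb (agreeˡ (pieceFlow M 𝟐 𝟐≢𝟎) (pieceFlow M' 𝟑 𝟑≢𝟎) once (abs-off (Mono.flows M' 𝟑 𝟑≢𝟎)) agree)))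
        (cong (sumB J c xor_) (𝟐-symp (π (nextC i))))
      where
      𝟐-symp : ∀ p → symp 𝟐 p ≡ proj₁ p
      𝟐-symp (p , q) = cong₂ _xor_ (∧-zeroʳ q) (∧-identityʳ p)
    cherryN-shift (chain {u} {j = j} {c = c} _ X) once agree = cherryN-shift X (onceʳ once) (agree-limb agree)

    branchN-shift : ∀ {i u} {b : Bush u} (X : Branch i b) → Once b → Agree a (branchFlow X) b →
      branchN-sum J′ X ≡ branchN-sum J X xor proj₁ (π (nextC i))
    branchN-shift (tip {u} {e = e} {j = j} {c = c} {c'} h M X) once agree =
      cherryN-shift X (onceʳ once)
        (agreeʳ (pieceFlow M 𝟏 𝟏≢𝟎) (cherryFlow X) once (λ v p → abs-off (Mono.flows M 𝟏 𝟏≢𝟎) v (proj₂ (+≡0⁻ (cntV (bare u) v) p))) agree)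
    branchN-shift (chain {u} {j = j} {c = c} _ X) once agree = branchN-shift X (onceʳ once) (agree-limb agree)

    branchM-shift : ∀ {i u} {b : Bush u} (X : Branch i b) → Once b → Agree a (branchFlow X) b →
      branchM-sum J′ X ≡ branchM-sum J X xor proj₂ (π i)
    branchM-shift {i} (tip {u} {e = e} {j = j} {c = c} {c'} h M X) once agree =
      trans (mono-shift M 𝟏 𝟏≢𝟎 (onceʳ (onceˡ once))
        (agree-limb (agreeˡ (pieceFlow M 𝟏 𝟏≢𝟎) (cherryFlow X) once (cherry-off X) agree)))
        (cong (sumB J c xor_) (𝟏-symp (π i)))
      where
      𝟏-symp : ∀ p → symp 𝟏 p ≡ proj₂ p
      𝟏-symp (p , q) = trans (cong₂ _xor_ (∧-identityʳ q) (∧-zeroʳ p)) (xor-identityʳ q)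
    branchM-shift (chain {u} {j = j} {c = c} _ X) once agree = branchM-shift X (onceʳ once) (agree-limb agree)

  module Cuts {a : V → V4} (uncoloured : ∀ v → col v ≡ nothing → a v ≡ 𝟎) (L : Lift a) where
    open FromLift uncoloured L slot

    W : ∀ {u} → Bush u → Set
    W c = Weight2 (λ l → sumB (α l) c)

    AllCuts-within : ∀ {P Q : ∀ {w} → Bush w → Set} {u} (b : Bush u) →
      (∀ {w} (c : Bush w) → (∀ v → 1 ≤ cntV c v → 1 ≤ cntV b v) → P c → Q c) → AllCuts P b → AllCuts Q b
    AllCuts-within (bare u)        h _           = tt
    AllCuts-within (graft b e j c) h (p , q , r) =
      AllCuts-within b (λ d s → h d (λ v t → ≤-trans (s v t) (m≤m+n _ _))) p ,
      AllCuts-within c (λ d s → h d (λ v t → ≤-trans (s v t) (m≤n+m _ _))) q ,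
      h c (λ v t → ≤-trans t (m≤n+m _ _)) r

    weight-≡ : ∀ {ω ω' : Fin 5 → Bool} → (∀ l → ω l ≡ ω' l) → Weight2 ω' → Weight2 ω
    weight-≡ h w = trans (sumFin-cong 5 (λ l → cong ⟦_⟧ (h l))) w

    α-uncoloured : ∀ l {v} → col v ≡ nothing → α l v ≡ false
    α-uncoloured l {v} p = α-zero l v (uncoloured v p)

    sumB-slot : ∀ s {u} (c : Bush u) → sumB (λ v → encSlot s (a v) (J v)) c ≡ encSlot s (sum4 a c) (sumB J c)
    sumB-slot nothing  c = sumB-zero c (λ _ _ → refl)
    sumB-slot (just k) c = sumB-enc a J k c

    mono-α : ∀ {i u w} {c : Bush u} (M : Mono i c) (d : Bush w) → (∀ v → 1 ≤ cntV d v → 1 ≤ cntV c v) → ∀ l →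
      sumB (α l) d ≡ encSlot (slot i l) (sum4 a d) (sumB J d)
    mono-α {i} M d sub l = trans (sumB-cong d at) (sumB-slot (slot i l) d)
      where
      at : ∀ v → 1 ≤ cntV d v → α l v ≡ encSlot (slot i l) (a v) (J v)
      at v p with col v in eq
      ... | just i' = cong (λ k → encSlot (slot k l) (a v) (J v)) (Mono.only M v i' (sub v p) eq)
      ... | nothing rewrite uncoloured v eq | Lift.∂-quad L v (uncoloured v eq) = sym (zero-slot (slot i l))
        where
        zero-slot : ∀ s → encSlot s 𝟎 false ≡ false
        zero-slot nothing                       = refl
        zero-slot (just zero)                   = refl
        zero-slot (just (suc zero))             = refl
        zero-slot (just (suc (suc zero)))       = refl
        zero-slot (just (suc (suc (suc zero)))) = refl

    -- Within a piece one assignment of roles is in force, so a nonzero value gives weight two with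
    -- any parity. The parity of the whole piece has to vanish, because its label vector is added
    -- further up to those of other pieces, and these sums are known for parity zero.
    mono-cuts : ∀ {i u} {c : Bush u} (M : Mono i c) x (h : x ≢ 𝟎) → Once c → Agree a (pieceFlow M x h) c → sumB J c ≡ false →
      AllCuts W c × W c × (∀ l → sumB (α l) c ≡ encSlot (slot i l) x false)
    mono-cuts {i} {c = c} M x h once agree even =
      AllCuts-within c (λ d s nz → weight-≡ (mono-α M d s) (slot-weight i (sum4 a d) (sumB J d) nz)) (proj₁ cuts) ,
      weight-≡ value (slot-weight i x false h) , value
      where
      cuts = abs-cuts a (Mono.flows M x h) (bound once) (same agree)
      value : ∀ l → sumB (α l) c ≡ encSlot (slot i l) x false
      value l = trans (mono-α M c (λ _ p → p) l) (cong₂ (encSlot (slot i l)) (trans (proj₂ cuts) (∣single∣ i x)) even)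

    cherry-cuts : ∀ {i u} {b : Bush u} (X : Cherry i b) → Once b → Agree a (cherryFlow X) b → cherryN-sum J X ≡ false → cherryP-sum J X ≡ false →
      AllCuts W b × (∀ l → sumB (α l) b ≡ cherryLabel i l)
    cherry-cuts {i} (tip {u} {e = e} {j = j} {c = c} {c'} h M M') once agree p q =
      ((tt , proj₁ left , proj₁ (proj₂ left)) , proj₁ right , proj₁ (proj₂ right)) ,
      λ l → cong₂ _xor_ (cong₂ _xor_ (α-uncoloured l h) (proj₂ (proj₂ left) l)) (proj₂ (proj₂ right) l)
      where
      left = mono-cuts M 𝟐 𝟐≢𝟎 (onceʳ (onceˡ once))
        (agree-limb (agreeˡ (pieceFlow M 𝟐 𝟐≢𝟎) (pieceFlow M' 𝟑 𝟑≢𝟎) once (abs-off (Mono.flows M' 𝟑 𝟑≢𝟎)) agree)) p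
      right = mono-cuts M' 𝟑 𝟑≢𝟎 (onceʳ once)
        (agreeʳ (pieceFlow M 𝟐 𝟐≢𝟎) (pieceFlow M' 𝟑 𝟑≢𝟎) once (λ v p → abs-off (Mono.flows M 𝟐 𝟐≢𝟎) v (proj₂ (+≡0⁻ (cntV (bare u) v) p))) agree) q
    cherry-cuts {i} (chain {u} {j = j} {c = c} h X) once agree p q =
      (tt , proj₁ left , weight-≡ (proj₂ left) (cherryLabel-weight i)) , λ l → cong₂ _xor_ (α-uncoloured l h) (proj₂ left l)
      where
      left = cherry-cuts X (onceʳ once) (agree-limb agree) p q

    branch-cuts : ∀ {i u} {b : Bush u} (X : Branch i b) → Once b → Agree a (branchFlow X) b →
      branchM-sum J X ≡ false → branchN-sum J X ≡ false → branchP-sum J X ≡ false →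
      AllCuts W b × (∀ l → sumB (α l) b ≡ branchLabel i l)
    branch-cuts {i} (tip {u} {e = e} {j = j} {c = c} {c'} h M X) once agree o p q =
      ((tt , proj₁ left , proj₁ (proj₂ left)) , proj₁ right , weight-≡ (proj₂ right) (cherryLabel-weight i)) ,
      λ l → cong₂ _xor_ (cong₂ _xor_ (α-uncoloured l h) (proj₂ (proj₂ left) l)) (proj₂ right l)
      where
      left = mono-cuts M 𝟏 𝟏≢𝟎 (onceʳ (onceˡ once))
        (agree-limb (agreeˡ (pieceFlow M 𝟏 𝟏≢𝟎) (cherryFlow X) once (cherry-off X) agree)) o
      right = cherry-cuts X (onceʳ once)
        (agreeʳ (pieceFlow M 𝟏 𝟏≢𝟎) (cherryFlow X) once (λ v p → abs-off (Mono.flows M 𝟏 𝟏≢𝟎) v (proj₂ (+≡0⁻ (cntV (bare u) v) p))) agree) p q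
    branch-cuts {i} (chain {u} {j = j} {c = c} h X) once agree o p q =
      (tt , proj₁ left , weight-≡ (proj₂ left) (branchLabel-weight i)) , λ l → cong₂ _xor_ (α-uncoloured l h) (proj₂ left l)
      where
      left = branch-cuts X (onceʳ once) (agree-limb agree) o p q

module SixCDC (G : Graph) (T C : EdgeSet G) (dec : Decomposition G T C) (cyc : IsCycle G C)
              (col : Fin (n G) → Maybe (Fin 3)) (colouring : Colouring G C col) where
  open Boundary G
  open Bushes G
  open Dynamic G col
  open Colouring colouring
  open Coloured G T C dec cyc col colouring
  open Labelled G T C dec cyc col colouring
  open Structures G col
  open SixCover G T C dec cyc col colouring

  centre⇒6-CDC : ∀ {r} {b : Bush r} → Spans T b → Centre b → HasCDCWith G 6 C
  centre⇒6-CDC {r} {b} span (centre {e₀ = e₀} {j₀ = j₀} {c₀ = c₀} {c₁} {c₂} h X₀ X₁ X₂) =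
    lift⇒CDC slot-partition b span offB
      (((tt , proj₁ cuts₀ , weight-≡ (proj₂ cuts₀) (branchLabel-weight (# 0))) ,
         proj₁ cuts₁ , weight-≡ (proj₂ cuts₁) (branchLabel-weight (# 1))) ,
         proj₁ cuts₂ , weight-≡ (proj₂ cuts₂) (branchLabel-weight (# 2)))
    where
    F₀ F₁ F₂ F₀₁ a : V → V4
    F₀ = branchFlow X₀
    F₁ = branchFlow X₁
    F₂ = branchFlow X₂
    F₀₁ v = F₀ v ⊕ F₁ v
    a v = F₀₁ v ⊕ F₂ v

    once : Once b
    once = at-most (Spans.verts span)

    off₀ : ∀ v → cntV (graft (bare r) e₀ j₀ c₀) v ≡ 0 → F₀ v ≡ 𝟎
    off₀ v p = branch-off X₀ v (proj₂ (+≡0⁻ (cntV (bare r) v) p))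

    off₀₁ : ∀ v → cntV (graft (bare r) e₀ j₀ c₀) v + cntV c₁ v ≡ 0 → F₀₁ v ≡ 𝟎
    off₀₁ v p = let q , s = +≡0⁻ (cntV (graft (bare r) e₀ j₀ c₀) v) p in cong₂ _⊕_ (off₀ v q) (branch-off X₁ v s)

    offB : ∀ v → cntV b v ≡ 0 → a v ≡ 𝟎
    offB v p = let q , s = +≡0⁻ (cntV (graft (bare r) e₀ j₀ c₀) v + cntV c₁ v) p in cong₂ _⊕_ (off₀₁ v q) (branch-off X₂ v s)

    agree : Agree a a b
    agree = agreeing λ _ _ → refl

    agree₂ : Agree a F₂ c₂
    agree₂ = agreeʳ F₀₁ F₂ once off₀₁ agree
    agree₀₁ = agreeˡ F₀₁ F₂ once (branch-off X₂) agree
    agree₁ : Agree a F₁ c₁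
    agree₁ = agreeʳ F₀ F₁ (onceˡ once) off₀ agree₀₁
    agree₀ : Agree a F₀ c₀
    agree₀ = agree-limb (agreeˡ F₀ F₁ (onceˡ once) (branch-off X₁) agree₀₁)

    once₀ : Once c₀
    once₀ = onceʳ (onceˡ (onceˡ once))
    once₁ : Once c₁
    once₁ = onceʳ (onceˡ once)
    once₂ : Once c₂
    once₂ = onceʳ once

    uncoloured : ∀ v → col v ≡ nothing → a v ≡ 𝟎
    uncoloured v p = cong₂ _⊕_ (cong₂ _⊕_ (branch-uncoloured X₀ v p) (branch-uncoloured X₁ v p)) (branch-uncoloured X₂ v p)

    balanced : ∀ ψ → Additive ψ → ∀ k → xsum (λ v → isCol k v ∧ ψ (a v)) ≡ false
    balanced ψ add k = trans (total-⊕ F₀₁ F₂) (trans (cong₂ _xor_ (trans (total-⊕ F₀ F₁)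
      (cong₂ _xor_ (total-branch X₀) (total-branch X₁))) (total-branch X₂)) (cancel k))
      where
      open ColourSum ψ add k
      part : Fin 3 → Fin 3 → Bool
      part i k = ψ (coord (single i 𝟏) k) xor (ψ (coord (single (nextC i) 𝟐) k) xor ψ (coord (single (prevC i) 𝟑) k))
      identity : ∀ p q → ((p xor (false xor false)) xor (false xor (false xor (p xor q)))) xor (false xor (q xor false)) ≡ false
      identity = solve 2 (λ p q → ((p :+ (con false :+ con false)) :+ (con false :+ (con false :+ (p :+ q)))) :+ (con false :+ (q :+ con false)) := con false) refl
      identity₁ : ∀ p q → ((false xor (q xor false)) xor (p xor (false xor false))) xor (false xor (false xor (p xor q))) ≡ false
      identity₁ = solve 2 (λ p q → ((con false :+ (q :+ con false)) :+ (p :+ (con false :+ con false))) :+ (con false :+ (con false :+ (p :+ q))) := con false) refl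
      identity₂ : ∀ p q → ((false xor (false xor (p xor q))) xor (false xor (q xor false))) xor (p xor (false xor false)) ≡ false
      identity₂ = solve 2 (λ p q → ((con false :+ (con false :+ (p :+ q))) :+ (con false :+ (q :+ con false))) :+ (p :+ (con false :+ con false)) := con false) refl
      cancel : ∀ k → (part (# 0) k xor part (# 1) k) xor part (# 2) k ≡ false
      cancel zero             rewrite add 𝟏 𝟐 | additive-𝟎 ψ add = identity (ψ 𝟏) (ψ 𝟐)
      cancel (suc zero)       rewrite add 𝟏 𝟐 | additive-𝟎 ψ add = identity₁ (ψ 𝟏) (ψ 𝟐)
      cancel (suc (suc zero)) rewrite add 𝟏 𝟐 | additive-𝟎 ψ add = identity₂ (ψ 𝟏) (ψ 𝟐)

    L : Lift a
    L = Lifting.lift a uncoloured balanced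

    J₀ : V → Bool
    J₀ = ∂ (λ e → quad (Lift.g L e))

    -- Around colour `i` the first coordinate cancels the parity of the `𝟐`-piece, which belongs to
    -- branch `prevC i`, the second that of the `𝟏`-piece of branch `i`.
    π : Fin 3 → V4
    π zero             = branchN-sum J₀ X₂ , branchM-sum J₀ X₀
    π (suc zero)       = branchN-sum J₀ X₀ , branchM-sum J₀ X₁
    π (suc (suc zero)) = branchN-sum J₀ X₁ , branchM-sum J₀ X₂

    open Shift uncoloured L π using (shifted; J′; g′)
    open Shifted uncoloured L π
    open FromLift uncoloured shifted slot using (lift⇒CDC)
    open Cuts uncoloured shifted using (branch-cuts; weight-≡)

    J′-uncoloured : ∀ v → col v ≡ nothing → J′ v ≡ false
    J′-uncoloured v p = Lift.∂-quad shifted v (uncoloured v p)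

    M₀ : branchM-sum J′ X₀ ≡ false
    M₀ = trans (branchM-shift X₀ once₀ agree₀) (xor-same (branchM-sum J₀ X₀))
    M₁ : branchM-sum J′ X₁ ≡ false
    M₁ = trans (branchM-shift X₁ once₁ agree₁) (xor-same (branchM-sum J₀ X₁))
    M₂ : branchM-sum J′ X₂ ≡ false
    M₂ = trans (branchM-shift X₂ once₂ agree₂) (xor-same (branchM-sum J₀ X₂))
    N₀ : branchN-sum J′ X₀ ≡ false
    N₀ = trans (branchN-shift X₀ once₀ agree₀) (xor-same (branchN-sum J₀ X₀))
    N₁ : branchN-sum J′ X₁ ≡ false
    N₁ = trans (branchN-shift X₁ once₁ agree₁) (xor-same (branchN-sum J₀ X₁))
    N₂ : branchN-sum J′ X₂ ≡ false
    N₂ = trans (branchN-shift X₂ once₂ agree₂) (xor-same (branchN-sum J₀ X₂))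

    module _ (k : Fin 3) where
      open Restricted J′ J′-uncoloured k

      -- Restricted to colour `k`, `J′` is the boundary of `quad` on the corresponding component of
      -- `C`, so handshaking applies to each colour separately.
      colour-even : xsum Jk ≡ false
      colour-even = trans (xsum-cong (λ v → sym (trans (∂-local v (local v)) (∂-∧ (isCol k v) (λ e → quad (g′ e)) v)))) (handshake S)
        where
        S : E → Bool
        S e = isCol k (src G e) ∧ quad (g′ e)
        local : ∀ v e → Incident G e v → S e ≡ isCol k v ∧ quad (g′ e)
        local v e inc = go (C e) refl
          where
          go : ∀ c → C e ≡ c → S e ≡ isCol k v ∧ quad (g′ e)
          go false Ce = trans (cong (λ x → isCol k (src G e) ∧ quad x) (Lift.offC shifted e Ce))
            (trans (∧-zeroʳ _) (sym (trans (cong (λ x → isCol k v ∧ quad x) (Lift.offC shifted e Ce)) (∧-zeroʳ _))))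
          go true Ce = let _ , q , _ = onEdge e Ce in
            cong (_∧ quad (g′ e)) (trans (isCol-just q) (sym (isCol-just (incident-col Ce inc q))))

      tree-even : sumB Jk b ≡ false
      tree-even = trans (sumB-xsum Jk b) (trans (xsum-cong inTree) colour-even)
        where
        inTree : ∀ v → par (cntV b v) ∧ Jk v ≡ Jk v
        inTree v = at (≤1-cases (Spans.verts span v))
          where
          at : (cntV b v ≡ 0) ⊎ (cntV b v ≡ 1) → par (cntV b v) ∧ Jk v ≡ Jk v
          at (inj₂ p) = cong (λ c → par c ∧ Jk v) p
          at (inj₁ p) = trans (cong (λ c → par c ∧ Jk v) p)
            (sym (trans (cong (isCol k v ∧_) (Lift.∂-quad shifted v (offB v p))) (∧-zeroʳ (isCol k v))))

      -- The pieces with values `𝟏` and `𝟐` are even by the choice of `π`, so of the three pieces at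
      -- colour `k` only the `𝟑`-piece is left, and it is even as well.
      spread : (δ (prevC (# 0)) k ∧ branchP-sum J′ X₀ xor δ (prevC (# 1)) k ∧ branchP-sum J′ X₁) xor δ (prevC (# 2)) k ∧ branchP-sum J′ X₂ ≡ false
      spread = trans (sym (cong₂ _xor_ (cong₂ _xor_ (cong₂ _xor_ (at-uncoloured h) (only X₀ M₀ N₀)) (only X₁ M₁ N₁)) (only X₂ M₂ N₂))) tree-even
        where
        only : ∀ {i u} {c : Bush u} (X : Branch i c) → branchM-sum J′ X ≡ false → branchN-sum J′ X ≡ false →
          sumB Jk c ≡ δ (prevC i) k ∧ branchP-sum J′ X
        only {i} X p q = trans (branch-restricted X) (trans
          (cong₂ (λ x y → (δ i k ∧ x) xor ((δ (nextC i) k ∧ y) xor (δ (prevC i) k ∧ branchP-sum J′ X))) p q)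
          (cong₂ (λ x y → x xor (y xor (δ (prevC i) k ∧ branchP-sum J′ X))) (∧-zeroʳ (δ i k)) (∧-zeroʳ (δ (nextC i) k))))

    P₀ : branchP-sum J′ X₀ ≡ false
    P₀ = trans (sym (trans (xor-identityʳ _) (xor-identityʳ _))) (spread (# 2))
    P₁ : branchP-sum J′ X₁ ≡ false
    P₁ = trans (sym (xor-identityʳ _)) (spread (# 0))
    P₂ : branchP-sum J′ X₂ ≡ false
    P₂ = spread (# 1)

    cuts₀ = branch-cuts X₀ once₀ agree₀ M₀ N₀ P₀
    cuts₁ = branch-cuts X₁ once₁ agree₁ M₁ N₁ P₁
    cuts₂ = branch-cuts X₂ once₂ agree₂ M₂ N₂ P₂

-- The empty set is a cycle. This supplies the sixth cycle when a graph contractible to the Petersen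
-- graph nevertheless gives a flow.
with-empty : ∀ {G C} → HasCDCWith G 5 C → HasCDCWith G 6 C
with-empty {G} (S , (even , twice) , i , h) = S⁺ , (even⁺ , twice) , suc i , h
  where
  open Boundary G
  S⁺ : Fin 6 → EdgeSet G
  S⁺ zero    = λ _ → false
  S⁺ (suc l) = S l
  even⁺ : ∀ l → IsCycle G (S⁺ l)
  even⁺ zero    = ∂⇒cycle (∂-zero (λ _ → refl))
  even⁺ (suc l) = even l

edgeless-CDC : ∀ G {C : EdgeSet G} → IsCycle G C → (Fin (n G) → ⊥) → HasCDCWith G 5 C
edgeless-CDC G {C} cyc no-vertex = (λ _ → C) , ((λ _ → cyc) , λ e → ⊥-elim (no-vertex (src G e))) , zero , λ _ → refl

-- The two outcomes of the search

module Assembly (G : Graph) (2ec : TwoEdgeConnected G) (T C : EdgeSet G) (dec : Decomposition G T C) (tree : IsTree G T) (cyc : IsCycle G C)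
                (k : ℕ) (comp : HasComponents G C k) (k≤3 : k ≤ 3) where
  open Boundary G
  open Bushes G
  open Planting G
  open Components G C comp k≤3
  open Dynamic G col
  open Coloured G T C dec cyc col colouring using (good-span)
  open Labelled G T C dec cyc col colouring using (flow⇒5-CDC)
  open Structures G col
  open Walk T (good-span (proj₂ 2ec))
  open Contraction G T C dec col colouring (proj₁ 2ec)
  open SixCDC G T C dec cyc col colouring

  -- The second alternative carries what contradicts its exclusion: three components and the
  -- contraction itself.
  Result : Set
  Result = HasCDCWith G 5 C ⊎ ((2 < k) × ContractibleToPetersen G × HasCDCWith G 6 C)

  branch-mono : ∀ {i u} {b : Bush u} → Branch i b → ∃ λ v → col v ≡ just i
  branch-mono (tip _ M _) = proj₁ (Mono.some M) , proj₂ (proj₂ (Mono.some M))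
  branch-mono (chain _ X) = branch-mono X

  outcome⇒result : Outcome → Result
  outcome⇒result (inj₁ (r , b , span , F)) = inj₁ (flow⇒5-CDC b span F)
  outcome⇒result (inj₂ (r , b , span , X@(centre _ _ _ X₂))) =
    inj₂ (col-bound (proj₂ (branch-mono X₂)) , centre⇒contractible span X , centre⇒6-CDC span X)

  rooted : ∀ r → (∀ e → T e ≡ true → Reach G T r (src G e)) → Result
  rooted r reach = let b , span = spanning-bush T (proj₂ tree) r reach in outcome⇒result (explore b span)

  -- The root has to reach every tree edge, so it is taken at a tree edge if there is one; if `T` is
  -- empty, any vertex does. A graph without vertices has no root and is covered trivially.
  result : Result
  result with any? (λ e → T e 𝔹.≟ true)
  ... | yes (e₀ , p₀) = rooted (src G e₀) (λ e p → proj₁ tree e₀ e p₀ p)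
  ... | no edgeless with any? {n = n G} (λ v → yes tt)
  ...   | yes (r , _) = rooted r (λ e p → ⊥-elim (edgeless (e , p)))
  ...   | no empty-graph = inj₁ (edgeless-CDC G cyc (λ v → empty-graph (v , tt)))

theorem3p5 : (G : Graph) → TwoEdgeConnected G →
    (T C : EdgeSet G) → Decomposition G T C → IsTree G T → IsCycle G C →
    (k : ℕ) → HasComponents G C k → k ≤ 3 →
    (∃ λ r → HasCDCWith G r C) ×
    (k ≤ 2 → HasCDCWith G 5 C) ×
    (k ≡ 3 → (¬ ContractibleToPetersen G → HasCDCWith G 5 C) ×
             (ContractibleToPetersen G → HasCDCWith G 6 C))
theorem3p5 G 2ec T C dec tree cyc k comp k≤3 with Assembly.result G 2ec T C dec tree cyc k comp k≤3
... | inj₁ S = (5 , S) , (λ _ → S) , λ _ → (λ _ → S) , λ _ → with-empty {G} {C} S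
... | inj₂ (2<k , P , S) = (6 , S) , (λ k≤2 → ⊥-elim (<⇒≱ 2<k k≤2)) , λ _ → (λ ¬P → ⊥-elim (¬P P)) , λ _ → S
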